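{- Let $N\in\mathbb{N}$. For $0\le k\le N$, the map $U_k^{(N)}\colon V_k^{(N)}\to\hat V_k^{(N)}$ is invertible. For $1\le k\le N$, \[ U_k^{(N)}M_{k-1}^{(N)}=\hat M_{k-1}U_{k-1}^{(N)},\qquad \hat D_kU_k^{(N)}=U_{k-1}^{(N)}D_k . \]
   Context: Infinite-color setting. Let $\bm x=(x_1,x_2,\dots)$, let $e_j$ be the elementary symmetric functions in $\bm x$ ($e_0=1$), and let $I_k$ be the set of $k$-tuples of distinct positive integers. $V_k$ is the $\mathbb{Q}(e_1,e_2,\dots)$-vector space with basis $\{b_\sigma:\sigma\in I_k\}$. For $\sigma\in I_k$ set \[ A(1\mid\sigma)=\prod_r\frac{\sigma_r-1}{\sigma_r},\qquad A(\sigma_r+1\mid\sigma)=\frac{\sigma_r+1}{\sigma_r}\prod_{r'\ne r}\frac{\sigma_r-\sigma_{r'}+1}{\sigma_r-\sigma_{r'}}, \] and $A(y\mid\sigma)=0$ for all other positive integers $y$. Let $M_kb_\sigma=\sum_{y\notin\sigma}A(y\mid\sigma)b_{\sigma,y}$ and $D_kb_\sigma=\frac{e_{\sigma_1}}{e_{\sigma_1-1}}b_{\sigma_2,\dots,\sigma_k}$ ($b_{\sigma,y}$ is indexed by $\sigma$ with $y$ appended). $\hat V_k$ is the space of infinite formal sums $\sum_{i\in I_k}F(x_{i_1},\dots,x_{i_k})\hat b_i$ with $F\in x_1\cdots x_k\,\mathbb{Q}(e_1,e_2,\dots)[x_1,\dots,x_k]$ (polynomials in $k$ indeterminates over $\mathbb{Q}(e_1,e_2,\dots)$),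 and $\hat M_k\hat b_i=\sum_{c\notin i}x_c\hat b_{i,c}$, $\hat D_k\hat b_i=\hat b_{i_2,\dots,i_k}$, extended termwise to infinite sums (with $\sum_{c\ge 1} x_c^m=p_m\in\mathbb{Q}[e_1,e_2,\dots]$ for $m\ge1$). The maps $U_k$. $(U_k)_{k\ge0}$ is the family of $\mathbb{Q}(e_1,e_2,\dots)$-linear maps $U_k\colon V_k\to\hat V_k$ with $U_0b_\emptyset=\hat b_\emptyset$, $U_kM_{k-1}=\hat M_{k-1}U_{k-1}$ and $\hat D_kU_k=U_{k-1}D_k$ for all $k\ge1$; such a family exists and these conditions determine it. For $\sigma\in I_k$ one has $U_kb_\sigma=\sum_iF_\sigma(x_{i_1},\dots,x_{i_k})\hat b_i$ where $F_\sigma$ is divisible by $x_1\cdots x_k$ and the coefficient $F_\sigma(x_{i_1},\dots,x_{i_k})$ lies in $x_{i_1}\cdots x_{i_k}\mathbb{Q}[\bm x][e_j^{ -1}:j<\max\sigma]$ (here $\mathbb{Q}[\bm x]$ includes symmetric functions in $\bm x$). Finite-color setting. Fix $N\in\mathbb{N}$, work over $\mathbb{Q}(x_1,\dots,x_N)$, and let $I_k^{(N)}$ be the set of $k$-tuples of distinct elements of $[N]=\{1,\dots,N\}$. $V_k^{(N)}$ and $\hat V_k^{(N)}$ are the $\mathbb{Q}(x_1,\dots,x_N)$-vector spaces with bases $\{b_\sigma\}$ and $\{\hat b_i\}$ indexed by $I_k^{(N)}$. (The paper writes simply $I_k,V_k,\hat V_k$ for these.) On these spaces, $M_k^{(N)}b_\sigma=\sum_{y\in[N]\setminus\sigma}A(y\mid\sigma)b_{\sigma,y}$,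 $D_kb_\sigma=\frac{e_{\sigma_1}}{e_{\sigma_1-1}}b_{\sigma_2,\dots,\sigma_k}$ with $e_j=e_j(x_1,\dots,x_N)$, $\hat M_k\hat b_i=\sum_{c\in[N]\setminus i}x_c\hat b_{i,c}$, and $\hat D_k\hat b_i=\hat b_{i_2,\dots,i_k}$. The map $U_k^{(N)}\colon V_k^{(N)}\to\hat V_k^{(N)}$ is obtained from $U_k$ by setting $x_c=0$ for all $c>N$ in the coefficients of $U_kb_\sigma$, $\sigma\in I_k^{(N)}$ (so $e_j$ becomes $e_j(x_1,\dots,x_N)$; no $e_j$ with $j>N$ occurs in a denominator, and terms $\hat b_i$ with some $i_r>N$ vanish), and extending linearly. -}

module Defs where

open import Level using (0ℓ)
open import Algebra.Bundles using (CommutativeRing; CommutativeMonoid)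
import Algebra.Module.Construct.TensorUnit as TensorUnit
open import Algebra.Module.Bundles using (Module)
open import Algebra.Module.Morphism.Structures using (IsModuleHomomorphism)
open import Algebra.Module.Structures using (IsLeftModule)
open import Algebra.Module.Structures.Biased using (IsModuleFromLeft)
import Algebra.Properties.Ring as RingProperties
import Algebra.Solver.Ring.NaturalCoefficients.Default as NaturalCoefficientsSolver
open import Data.Fin.Base as Fin using (Fin)
import Data.Fin.Properties as Finₚ
open import Data.Integer.Base as ℤ using (ℤ; +_; -[1+_]; _⊖_)
open import Data.List.Base as List using (List; []; _∷_; _++_; length)
open import Data.List.Relation.Unary.All as All using (All; []; _∷_)
import Data.List.Relation.Unary.All.Properties as Allₚ
open import Data.Maybe.Base using (Maybe; nothing; just)
open import Data.Nat.Base as ℕ using (ℕ; zero; suc; pred; s≤s; z≤n)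
import Data.Nat.Properties as ℕₚ
open import Data.Product.Base using (_×_; _,_; ∃; proj₁; proj₂)
open import Data.Rational.Base as ℚ using (ℚ; 0ℚ; 1ℚ)
import Data.Rational.Properties as ℚₚ
open import Data.Sum.Base using (_⊎_; inj₁; inj₂)
open import Data.Vec.Base as Vec using (Vec; []; _∷_; _∷ʳ_; lookup)
open import Data.Vec.Membership.DecPropositional ℕₚ._≟_ using (_∈?_)
open import Data.Vec.Membership.Propositional using (_∉_)
import Data.Vec.Properties as Vecₚ
open import Data.Vec.Relation.Unary.All as Allᵛ using ([]; _∷_)
import Data.Vec.Relation.Unary.All.Properties as Allᵛₚ
open import Data.Vec.Relation.Unary.AllPairs.Core using ([]; _∷_)
open import Data.Vec.Relation.Unary.Any using (here; there)
open import Data.Vec.Relation.Unary.Unique.Propositional using (Unique)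
open import Function.Base using (_∘_)
open import Function.Definitions using (Inverseᵇ)
open import Relation.Binary.Bundles using (DecSetoid)
import Relation.Binary.Construct.On as On
open import Relation.Binary.Core using (Rel)
open import Relation.Binary.Definitions
  using (Decidable; Transitive; Trichotomous; tri<; tri≈; tri>)
open import Relation.Binary.PropositionalEquality as ≡ using (_≡_; _≢_)
import Relation.Binary.PropositionalEquality.Algebra as ≡
import Relation.Binary.Reasoning.Setoid as SetoidReasoning
open import Relation.Nullary using (¬_; Dec; yes; no; contradiction; ¬?)

linear : {R : CommutativeRing 0ℓ 0ℓ} {B : Set} (W : Module R 0ℓ 0ℓ) →
         (B → Module.Carrierᴹ W) →
         List (CommutativeRing.Carrier R × B) → Module.Carrierᴹ W
linear W f []            = Module.0ᴹ W
linear W f ((a , b) ∷ p) = Module._+ᴹ_ W (Module._*ₗ_ W a (f b)) (linear W f p)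

module Free (R : CommutativeRing 0ℓ 0ℓ) (B : DecSetoid 0ℓ 0ℓ) where
  open CommutativeRing R
  open DecSetoid B using () renaming
    ( Carrier to Basis; _≈_ to _∼_; _≟_ to _∼?_
    ; refl to ∼-refl; sym to ∼-sym; trans to ∼-trans )
  open SetoidReasoning setoid
  open RingProperties ring using (-0#≈0#; -‿+-comm; -1*x≈-x)

  Combination : Set
  Combination = List (Carrier × Basis)

  coefficient : Combination → Basis → Carrier
  coefficient []            c = 0#
  coefficient ((a , b) ∷ p) c with b ∼? c
  ... | yes _ = a + coefficient p c
  ... | no  _ = coefficient p c

  infix 4 _≋_
  record _≋_ (p q : Combination) : Set where
    constructor mk≋
    field coefficients : ∀ b → coefficient p b ≈ coefficient q b
  open _≋_ public

  scale : Carrier → Combination → Combination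
  scale a = List.map (λ (c , b) → (a * c , b))

  negate : Combination → Combination
  negate = List.map (λ (c , b) → (- c , b))

  basis : Basis → Combination
  basis b = (1# , b) ∷ []

  coefficient-++ : ∀ p q c → coefficient (p ++ q) c ≈ coefficient p c + coefficient q c
  coefficient-++ []            q c = sym (+-identityˡ _)
  coefficient-++ ((a , b) ∷ p) q c with b ∼? c
  ... | yes _ = trans (+-congˡ (coefficient-++ p q c)) (sym (+-assoc _ _ _))
  ... | no  _ = coefficient-++ p q c

  coefficient-scale : ∀ a p c → coefficient (scale a p) c ≈ a * coefficient p c
  coefficient-scale a []            c = sym (zeroʳ a)
  coefficient-scale a ((d , b) ∷ p) c with b ∼? c
  ... | yes _ = trans (+-congˡ (coefficient-scale a p c)) (sym (distribˡ _ _ _))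
  ... | no  _ = coefficient-scale a p c

  coefficient-negate : ∀ p c → coefficient (negate p) c ≈ - coefficient p c
  coefficient-negate []            c = sym -0#≈0#
  coefficient-negate ((d , b) ∷ p) c with b ∼? c
  ... | yes _ = trans (+-congˡ (coefficient-negate p c)) (-‿+-comm _ _)
  ... | no  _ = coefficient-negate p c

  coefficient-∼ : ∀ p {b c} → b ∼ c → coefficient p b ≈ coefficient p c
  coefficient-∼ []            b∼c = refl
  coefficient-∼ ((a , d) ∷ p) {b} {c} b∼c with d ∼? b | d ∼? c
  ... | yes _ | yes _ = +-congˡ (coefficient-∼ p b∼c)
  ... | no  _ | no  _ = coefficient-∼ p b∼c
  ... | yes d∼b | no d≁c = contradiction (∼-trans d∼b b∼c) d≁c
  ... | no d≁b | yes d∼c = contradiction (∼-trans d∼c (∼-sym b∼c)) d≁b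

  freeModule : Module R 0ℓ 0ℓ
  freeModule = record
    { Carrierᴹ = Combination
    ; _≈ᴹ_     = _≋_
    ; _+ᴹ_     = _++_
    ; _*ₗ_     = scale
    ; _*ᵣ_     = λ p a → scale a p
    ; 0ᴹ       = []
    ; -ᴹ_      = negate
    ; isModule = IsModuleFromLeft.isModule (record { isLeftModule = isLeftModule })
    }
    where
    infix 1 _via_via_
    _via_via_ : ∀ {x y u v} → x ≈ y → u ≈ x → v ≈ y → u ≈ v
    x≈y via u≈x via v≈y = trans u≈x (trans x≈y (sym v≈y))

    isLeftModule : IsLeftModule ring _≋_ _++_ [] negate scale
    isLeftModule = record
      { isLeftSemimodule = record
        { +ᴹ-isCommutativeMonoid = record
          { isMonoid = record
            { isSemigroup = record
              { isMagma = record
                { isEquivalence = record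
                  { refl  = mk≋ λ _ → refl
                  ; sym   = λ e → mk≋ λ b → sym (coefficients e b)
                  ; trans = λ e f → mk≋ λ b → trans (coefficients e b) (coefficients f b)
                  }
                ; ∙-cong = λ {p} {p′} {q} {q′} e f → mk≋ λ b →
                    +-cong (coefficients e b) (coefficients f b)
                    via coefficient-++ p q b via coefficient-++ p′ q′ b
                }
              ; assoc = λ p q r → mk≋ λ b →
                  +-assoc (coefficient p b) (coefficient q b) (coefficient r b)
                  via trans (coefficient-++ (p ++ q) r b) (+-congʳ (coefficient-++ p q b))
                  via trans (coefficient-++ p (q ++ r) b) (+-congˡ (coefficient-++ q r b))
              }
            ; identity = (λ _ → mk≋ λ _ → refl)
                       , (λ p → mk≋ λ b → trans (coefficient-++ p [] b) (+-identityʳ _))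
            }
          ; comm = λ p q → mk≋ λ b →
              +-comm (coefficient p b) (coefficient q b)
              via coefficient-++ p q b via coefficient-++ q p b
          }
        ; isPreleftSemimodule = record
          { *ₗ-cong = λ {x} {y} {p} {q} x≈y e → mk≋ λ b →
              *-cong x≈y (coefficients e b)
              via coefficient-scale x p b via coefficient-scale y q b
          ; *ₗ-zeroˡ = λ p → mk≋ λ b → trans (coefficient-scale 0# p b) (zeroˡ _)
          ; *ₗ-distribʳ = λ p x y → mk≋ λ b →
              distribʳ (coefficient p b) x y
              via coefficient-scale (x + y) p b
              via trans (coefficient-++ (scale x p) (scale y p) b)
                        (+-cong (coefficient-scale x p b) (coefficient-scale y p b))
          ; *ₗ-identityˡ = λ p → mk≋ λ b → trans (coefficient-scale 1# p b) (*-identityˡ _)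
          ; *ₗ-assoc = λ x y p → mk≋ λ b →
              *-assoc x y (coefficient p b)
              via coefficient-scale (x * y) p b
              via trans (coefficient-scale x (scale y p) b) (*-congˡ (coefficient-scale y p b))
          ; *ₗ-zeroʳ = λ _ → mk≋ λ _ → refl
          ; *ₗ-distribˡ = λ x p q → mk≋ λ b →
              distribˡ x (coefficient p b) (coefficient q b)
              via trans (coefficient-scale x (p ++ q) b) (*-congˡ (coefficient-++ p q b))
              via trans (coefficient-++ (scale x p) (scale x q) b)
                        (+-cong (coefficient-scale x p b) (coefficient-scale x q b))
          }
        }
      ; -ᴹ‿cong = λ {p} {q} e → mk≋ λ b →
          -‿cong (coefficients e b) via coefficient-negate p b via coefficient-negate q b
      ; -ᴹ‿inverse =
            (λ p → mk≋ λ b → trans (coefficient-++ (negate p) p b)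
              (trans (+-congʳ (coefficient-negate p b)) (-‿inverseˡ _)))
          , (λ p → mk≋ λ b → trans (coefficient-++ p (negate p) b)
              (trans (+-congˡ (coefficient-negate p b)) (-‿inverseʳ _)))
      }

module LinearProperties
  {R : CommutativeRing 0ℓ 0ℓ} {B : DecSetoid 0ℓ 0ℓ} (W : Module R 0ℓ 0ℓ) where
  open CommutativeRing R
  open DecSetoid B using () renaming
    ( Carrier to Basis; _≈_ to _∼_; _≟_ to _∼?_
    ; refl to ∼-refl; sym to ∼-sym; trans to ∼-trans )
  open Module W
  open Free R B
  open SetoidReasoning ≈ᴹ-setoid

  linear-++ : ∀ (f : Basis → Carrierᴹ) p q → linear W f (p ++ q) ≈ᴹ linear W f p +ᴹ linear W f q
  linear-++ f []      q = ≈ᴹ-sym (+ᴹ-identityˡ _)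
  linear-++ f (_ ∷ p) q = ≈ᴹ-trans (+ᴹ-congˡ (linear-++ f p q)) (≈ᴹ-sym (+ᴹ-assoc _ _ _))

  linear-scale : ∀ (f : Basis → Carrierᴹ) a p → linear W f (scale a p) ≈ᴹ a *ₗ linear W f p
  linear-scale f a []      = ≈ᴹ-sym (*ₗ-zeroʳ a)
  linear-scale f a (_ ∷ p) =
    ≈ᴹ-trans (+ᴹ-cong (*ₗ-assoc _ _ _) (linear-scale f a p)) (≈ᴹ-sym (*ₗ-distribˡ _ _ _))

  linear-basis : ∀ f b → linear W f (basis b) ≈ᴹ f b
  linear-basis f b = ≈ᴹ-trans (+ᴹ-identityʳ _) (*ₗ-identityˡ _)

  linear-ext : ∀ {f g : Basis → Carrierᴹ} → (∀ b → f b ≈ᴹ g b) → ∀ p → linear W f p ≈ᴹ linear W g p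
  linear-ext f≈g []            = ≈ᴹ-refl
  linear-ext f≈g ((_ , b) ∷ p) = +ᴹ-cong (*ₗ-congˡ (f≈g b)) (linear-ext f≈g p)

  interchange : ∀ x y z w → (x +ᴹ y) +ᴹ (z +ᴹ w) ≈ᴹ (x +ᴹ z) +ᴹ (y +ᴹ w)
  interchange x y z w = begin
    (x +ᴹ y) +ᴹ (z +ᴹ w)  ≈⟨ +ᴹ-assoc x y _ ⟩
    x +ᴹ (y +ᴹ (z +ᴹ w))  ≈⟨ +ᴹ-congˡ (+ᴹ-assoc y z w) ⟨
    x +ᴹ ((y +ᴹ z) +ᴹ w)  ≈⟨ +ᴹ-congˡ (+ᴹ-congʳ (+ᴹ-comm y z)) ⟩
    x +ᴹ ((z +ᴹ y) +ᴹ w)  ≈⟨ +ᴹ-congˡ (+ᴹ-assoc z y w) ⟩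
    x +ᴹ (z +ᴹ (y +ᴹ w))  ≈⟨ +ᴹ-assoc x z _ ⟨
    (x +ᴹ z) +ᴹ (y +ᴹ w)  ∎

  linear-0 : ∀ p → linear W (λ (_ : Basis) → 0ᴹ) p ≈ᴹ 0ᴹ
  linear-0 []      = ≈ᴹ-refl
  linear-0 (_ ∷ p) = ≈ᴹ-trans (+ᴹ-cong (*ₗ-zeroʳ _) (linear-0 p)) (+ᴹ-identityˡ _)

  linear-+ : ∀ (f g : Basis → Carrierᴹ) p →
             linear W (λ b → f b +ᴹ g b) p ≈ᴹ linear W f p +ᴹ linear W g p
  linear-+ f g []      = ≈ᴹ-sym (+ᴹ-identityˡ _)
  linear-+ f g (_ ∷ p) =
    ≈ᴹ-trans (+ᴹ-cong (*ₗ-distribˡ _ _ _) (linear-+ f g p)) (interchange _ _ _ _)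

  linear-* : ∀ a (f : Basis → Carrierᴹ) p → linear W (λ b → a *ₗ f b) p ≈ᴹ a *ₗ linear W f p
  linear-* a f []            = ≈ᴹ-sym (*ₗ-zeroʳ a)
  linear-* a f ((c , b) ∷ p) = begin
    c *ₗ (a *ₗ f b) +ᴹ linear W (λ b → a *ₗ f b) p
      ≈⟨ +ᴹ-cong (≈ᴹ-sym (*ₗ-assoc c a (f b))) (linear-* a f p) ⟩
    (c * a) *ₗ f b +ᴹ a *ₗ linear W f p
      ≈⟨ +ᴹ-congʳ (≈ᴹ-trans (*ₗ-congʳ (*-comm c a)) (*ₗ-assoc a c (f b))) ⟩
    a *ₗ (c *ₗ f b) +ᴹ a *ₗ linear W f p
      ≈⟨ *ₗ-distribˡ a _ _ ⟨
    a *ₗ (c *ₗ f b +ᴹ linear W f p) ∎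

  module _ {f : Basis → Carrierᴹ} (f-cong : ∀ {b c} → b ∼ c → f b ≈ᴹ f c) where

    private
      remove : Basis → Combination → Combination
      remove c [] = []
      remove c ((a , b) ∷ p) with b ∼? c
      ... | yes _ = remove c p
      ... | no  _ = (a , b) ∷ remove c p

      length-remove : ∀ c p → length (remove c p) ℕ.≤ length p
      length-remove c [] = z≤n
      length-remove c ((a , b) ∷ p) with b ∼? c
      ... | yes _ = ℕₚ.m≤n⇒m≤1+n (length-remove c p)
      ... | no  _ = s≤s (length-remove c p)

      linear-remove : ∀ c p → linear W f p ≈ᴹ coefficient p c *ₗ f c +ᴹ linear W f (remove c p)
      linear-remove c [] = ≈ᴹ-sym (≈ᴹ-trans (+ᴹ-identityʳ _) (*ₗ-zeroˡ _))
      linear-remove c ((a , b) ∷ p) with b ∼? c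
      ... | yes b∼c = begin
        a *ₗ f b +ᴹ linear W f p
          ≈⟨ +ᴹ-cong (*ₗ-congˡ (f-cong b∼c)) (linear-remove c p) ⟩
        a *ₗ f c +ᴹ (coefficient p c *ₗ f c +ᴹ linear W f (remove c p))
          ≈⟨ +ᴹ-assoc _ _ _ ⟨
        (a *ₗ f c +ᴹ coefficient p c *ₗ f c) +ᴹ linear W f (remove c p)
          ≈⟨ +ᴹ-congʳ (*ₗ-distribʳ _ _ _) ⟨
        (a + coefficient p c) *ₗ f c +ᴹ linear W f (remove c p) ∎
      ... | no _ = begin
        a *ₗ f b +ᴹ linear W f p
          ≈⟨ +ᴹ-congˡ (linear-remove c p) ⟩
        a *ₗ f b +ᴹ (coefficient p c *ₗ f c +ᴹ linear W f (remove c p))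
          ≈⟨ +ᴹ-assoc _ _ _ ⟨
        (a *ₗ f b +ᴹ coefficient p c *ₗ f c) +ᴹ linear W f (remove c p)
          ≈⟨ +ᴹ-congʳ (+ᴹ-comm _ _) ⟩
        (coefficient p c *ₗ f c +ᴹ a *ₗ f b) +ᴹ linear W f (remove c p)
          ≈⟨ +ᴹ-assoc _ _ _ ⟩
        coefficient p c *ₗ f c +ᴹ (a *ₗ f b +ᴹ linear W f (remove c p)) ∎

      coefficient-remove : ∀ c p {d} → ¬ c ∼ d → coefficient (remove c p) d ≈ coefficient p d
      coefficient-remove c [] c≁d = refl
      coefficient-remove c ((a , b) ∷ p) {d} c≁d with b ∼? c
      coefficient-remove c ((a , b) ∷ p) {d} c≁d | yes b∼c with b ∼? d
      ... | yes b∼d = contradiction (∼-trans (∼-sym b∼c) b∼d) c≁d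
      ... | no  _   = coefficient-remove c p c≁d
      coefficient-remove c ((a , b) ∷ p) {d} c≁d | no _ with b ∼? d
      ... | yes _ = +-congˡ (coefficient-remove c p c≁d)
      ... | no  _ = coefficient-remove c p c≁d

      coefficient-removed : ∀ c p {d} → c ∼ d → coefficient (remove c p) d ≈ 0#
      coefficient-removed c [] c∼d = refl
      coefficient-removed c ((a , b) ∷ p) {d} c∼d with b ∼? c
      coefficient-removed c ((a , b) ∷ p) {d} c∼d | yes _ = coefficient-removed c p c∼d
      coefficient-removed c ((a , b) ∷ p) {d} c∼d | no b≁c with b ∼? d
      ... | yes b∼d = contradiction (∼-trans b∼d (∼-sym c∼d)) b≁c
      ... | no  _   = coefficient-removed c p c∼d

      remove-≋0 : ∀ c p → p ≋ [] → remove c p ≋ []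
      remove-≋0 c p p≋0 = mk≋ λ d → helper d
        where
        helper : ∀ d → coefficient (remove c p) d ≈ 0#
        helper d with c ∼? d
        ... | yes c∼d = coefficient-removed c p c∼d
        ... | no  c≁d = trans (coefficient-remove c p c≁d) (coefficients p≋0 d)

      remove-head : ∀ a b p → length (remove b ((a , b) ∷ p)) ℕ.≤ length p
      remove-head a b p with b ∼? b
      ... | yes _  = length-remove b p
      ... | no b≁b = contradiction ∼-refl b≁b

      linear-≋0 : ∀ n p → length p ℕ.≤ n → p ≋ [] → linear W f p ≈ᴹ 0ᴹ
      linear-≋0 n       []              _         _   = ≈ᴹ-refl
      linear-≋0 (suc n) p@((a , b) ∷ q) (s≤s q≤n) p≋0 = begin
        linear W f p
          ≈⟨ linear-remove b p ⟩
        coefficient p b *ₗ f b +ᴹ linear W f (remove b p)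
          ≈⟨ +ᴹ-cong (≈ᴹ-trans (*ₗ-congʳ (coefficients p≋0 b)) (*ₗ-zeroˡ _))
                     (linear-≋0 n (remove b p) (ℕₚ.≤-trans (remove-head a b q) q≤n)
                                (remove-≋0 b p p≋0)) ⟩
        0ᴹ +ᴹ 0ᴹ
          ≈⟨ +ᴹ-identityˡ 0ᴹ ⟩
        0ᴹ ∎

    linear-cong : ∀ {p q} → p ≋ q → linear W f p ≈ᴹ linear W f q
    linear-cong {p} {q} p≋q = begin
      linear W f p                                ≈⟨ +ᴹ-identityʳ _ ⟨
      linear W f p +ᴹ 0ᴹ                          ≈⟨ +ᴹ-congˡ (linear-q+-q) ⟨
      linear W f p +ᴹ (linear W f (scale (- 1#) q) +ᴹ linear W f q)
                                                  ≈⟨ +ᴹ-assoc _ _ _ ⟨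
      (linear W f p +ᴹ linear W f (scale (- 1#) q)) +ᴹ linear W f q
                                                  ≈⟨ +ᴹ-congʳ (linear-++ f p (scale (- 1#) q)) ⟨
      linear W f (p ++ scale (- 1#) q) +ᴹ linear W f q
                                                  ≈⟨ +ᴹ-congʳ (linear-≋0 _ _ ℕₚ.≤-refl p-q≋0) ⟩
      0ᴹ +ᴹ linear W f q                          ≈⟨ +ᴹ-identityˡ _ ⟩
      linear W f q ∎
      where
      -1-cancelˡ : ∀ x → - 1# * x + x ≈ 0#
      -1-cancelˡ x = trans (+-congʳ (RingProperties.-1*x≈-x ring x)) (-‿inverseˡ x)
      linear-q+-q : linear W f (scale (- 1#) q) +ᴹ linear W f q ≈ᴹ 0ᴹ
      linear-q+-q = begin
        linear W f (scale (- 1#) q) +ᴹ linear W f q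
          ≈⟨ +ᴹ-cong (linear-scale f (- 1#) q) (≈ᴹ-sym (*ₗ-identityˡ _)) ⟩
        (- 1#) *ₗ linear W f q +ᴹ 1# *ₗ linear W f q
          ≈⟨ *ₗ-distribʳ _ _ _ ⟨
        (- 1# + 1#) *ₗ linear W f q
          ≈⟨ *ₗ-congʳ (-‿inverseˡ 1#) ⟩
        0# *ₗ linear W f q
          ≈⟨ *ₗ-zeroˡ _ ⟩
        0ᴹ ∎
      p-q≋0 : p ++ scale (- 1#) q ≋ []
      p-q≋0 = mk≋ λ b →
        trans (coefficient-++ p (scale (- 1#) q) b)
       (trans (+-cong (coefficients p≋q b) (coefficient-scale (- 1#) q b))
       (trans (+-comm _ _) (-1-cancelˡ _)))

  linear-swap : ∀ {C : Set} (g : C → Basis → Carrierᴹ) (p : List (Carrier × C)) q →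
                linear W (λ c → linear W (g c) q) p ≈ᴹ
                linear W (λ b → linear W (λ c → g c b) p) q
  linear-swap g []            q = ≈ᴹ-sym (linear-0 q)
  linear-swap g ((a , c) ∷ p) q = begin
    a *ₗ linear W (g c) q +ᴹ linear W (λ c → linear W (g c) q) p
      ≈⟨ +ᴹ-cong (≈ᴹ-sym (linear-* a (g c) q)) (linear-swap g p q) ⟩
    linear W (λ b → a *ₗ g c b) q +ᴹ linear W (λ b → linear W (λ c → g c b) p) q
      ≈⟨ linear-+ _ _ q ⟨
    linear W (λ b → a *ₗ g c b +ᴹ linear W (λ c → g c b) p) q ∎

linear-∘ : {R : CommutativeRing 0ℓ 0ℓ} {B : DecSetoid 0ℓ 0ℓ} {C : Set} (W : Module R 0ℓ 0ℓ)
           (g : DecSetoid.Carrier B → Module.Carrierᴹ W)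
           (f : C → List (CommutativeRing.Carrier R × DecSetoid.Carrier B)) →
           ∀ p → Module._≈ᴹ_ W (linear W g (linear (Free.freeModule R B) f p))
                               (linear W (λ c → linear W g (f c)) p)
linear-∘ W g f []            = Module.≈ᴹ-refl W
linear-∘ {R} {B} W g f ((a , c) ∷ p) = ≈ᴹ-trans (linear-++ g (scale a (f c)) (linear freeModule f p))
  (+ᴹ-cong (linear-scale g a (f c)) (linear-∘ {R} {B} W g f p))
  where
  open Module W
  open Free R B
  open LinearProperties {R} {B} W

Invertible : {R : CommutativeRing 0ℓ 0ℓ} (V W : Module R 0ℓ 0ℓ) →
             (Module.Carrierᴹ V → Module.Carrierᴹ W) → Set
Invertible V W f =
  IsModuleHomomorphism (Module.rawModule V) (Module.rawModule W) f ×
  ∃ λ g → IsModuleHomomorphism (Module.rawModule W) (Module.rawModule V) g ×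
          Inverseᵇ (Module._≈ᴹ_ V) (Module._≈ᴹ_ W) f g

module MonoidAlgebra
  (R : CommutativeRing 0ℓ 0ℓ) (M : CommutativeMonoid 0ℓ 0ℓ)
  (_≟_ : Decidable (CommutativeMonoid._≈_ M)) where

  open CommutativeRing R
  open CommutativeMonoid M using (_∙_; ε) renaming
    ( Carrier to Monomial; _≈_ to _∼_; isEquivalence to ∼-isEquivalence
    ; refl to ∼-refl; sym to ∼-sym; trans to ∼-trans; ∙-cong to ∙-∼
    ; assoc to ∙-assoc; comm to ∙-comm; identityˡ to ∙-identityˡ )

  monomials : DecSetoid 0ℓ 0ℓ
  monomials = record
    { isDecEquivalence = record { isEquivalence = ∼-isEquivalence ; _≟_ = _≟_ } }

  open Free R monomials public
  open Module freeModule using (_+ᴹ_; +ᴹ-cong; *ₗ-congˡ; *ₗ-congʳ; ≈ᴹ-setoid)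
    renaming (≈ᴹ-refl to ≋-refl; ≈ᴹ-sym to ≋-sym; ≈ᴹ-trans to ≋-trans)
  open LinearProperties {R} {monomials} freeModule
  open SetoidReasoning ≈ᴹ-setoid

  constant : Carrier → Combination
  constant a = (a , ε) ∷ []

  shift : Monomial → Combination → Combination
  shift m = linear freeModule (λ n → basis (m ∙ n))

  infixl 7 _⊛_
  _⊛_ : Combination → Combination → Combination
  p ⊛ q = linear freeModule (λ m → shift m q) p

  basis-cong : ∀ {m n} → m ∼ n → basis m ≋ basis n
  basis-cong {m} {n} m∼n = mk≋ helper
    where
    helper : ∀ k → coefficient (basis m) k ≈ coefficient (basis n) k
    helper k with m ≟ k | n ≟ k
    ... | yes _ | yes _ = refl
    ... | no  _ | no  _ = refl
    ... | yes m∼k | no n≁k = contradiction (∼-trans (∼-sym m∼n) m∼k) n≁k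
    ... | no m≁k | yes n∼k = contradiction (∼-trans m∼n n∼k) m≁k

  shift-cong : ∀ m {p q} → p ≋ q → shift m p ≋ shift m q
  shift-cong m = linear-cong (λ n∼n′ → basis-cong (∙-∼ ∼-refl n∼n′))

  shift-congˡ : ∀ {m n} p → m ∼ n → shift m p ≋ shift n p
  shift-congˡ p m∼n = linear-ext (λ _ → basis-cong (∙-∼ m∼n ∼-refl)) p

  linear-linear : ∀ (g : Monomial → Combination) {C : Set} (f : C → Combination) p →
                  linear freeModule g (linear freeModule f p) ≋
                  linear freeModule (λ c → linear freeModule g (f c)) p
  linear-linear g f p = linear-∘ {R} {monomials} freeModule g f p

  linear-id : ∀ p → linear freeModule basis p ≋ p
  linear-id []            = ≋-refl
  linear-id ((a , b) ∷ p) =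
    +ᴹ-cong {x = (a * 1# , b) ∷ []} {y = (a , b) ∷ []} {u = linear freeModule basis p} {v = p}
      (mk≋ helper) (linear-id p)
    where
    helper : ∀ k → coefficient ((a * 1# , b) ∷ []) k ≈ coefficient ((a , b) ∷ []) k
    helper k with b ≟ k
    ... | yes _ = +-congʳ (*-identityʳ a)
    ... | no  _ = refl

  ⊛-cong : ∀ {p p′ q q′} → p ≋ p′ → q ≋ q′ → p ⊛ q ≋ p′ ⊛ q′
  ⊛-cong {p} {p′} {q} {q′} p≋p′ q≋q′ = ≋-trans
    (linear-cong {λ m → shift m q} (shift-congˡ q) p≋p′)
    (linear-ext (λ m → shift-cong m q≋q′) p′)

  ⊛-comm : ∀ p q → p ⊛ q ≋ q ⊛ p
  ⊛-comm p q = ≋-trans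
    (linear-swap (λ m n → basis (m ∙ n)) p q)
    (linear-ext (λ n → linear-ext (λ m → basis-cong (∙-comm m n)) p) q)

  shift-shift : ∀ m n p → shift m (shift n p) ≋ shift (m ∙ n) p
  shift-shift m n p = begin
    shift m (shift n p)
      ≈⟨ linear-linear _ _ p ⟩
    linear freeModule (λ k → shift m (basis (n ∙ k))) p
      ≈⟨ linear-ext (λ k → linear-basis (λ k → basis (m ∙ k)) (n ∙ k)) p ⟩
    linear freeModule (λ k → basis (m ∙ (n ∙ k))) p
      ≈⟨ linear-ext (λ k → basis-cong (∙-assoc m n k)) p ⟨
    shift (m ∙ n) p ∎

  ⊛-assoc : ∀ p q r → (p ⊛ q) ⊛ r ≋ p ⊛ (q ⊛ r)
  ⊛-assoc p q r = begin
    (p ⊛ q) ⊛ r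
      ≈⟨ linear-linear _ _ p ⟩
    linear freeModule (λ m → shift m q ⊛ r) p
      ≈⟨ linear-ext inner p ⟩
    p ⊛ (q ⊛ r) ∎
    where
    inner : ∀ m → shift m q ⊛ r ≋ shift m (q ⊛ r)
    inner m = begin
      shift m q ⊛ r
        ≈⟨ linear-linear _ _ q ⟩
      linear freeModule (λ n → basis (m ∙ n) ⊛ r) q
        ≈⟨ linear-ext (λ n → linear-basis (λ k → shift k r) (m ∙ n)) q ⟩
      linear freeModule (λ n → shift (m ∙ n) r) q
        ≈⟨ linear-ext (λ n → shift-shift m n r) q ⟨
      linear freeModule (λ n → shift m (shift n r)) q
        ≈⟨ linear-linear _ _ q ⟨
      shift m (q ⊛ r) ∎

  ⊛-identityˡ : ∀ p → basis ε ⊛ p ≋ p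
  ⊛-identityˡ p = begin
    basis ε ⊛ p                ≈⟨ linear-basis (λ m → shift m p) ε ⟩
    shift ε p                  ≈⟨ linear-ext (λ n → basis-cong (∙-identityˡ n)) p ⟩
    linear freeModule basis p  ≈⟨ linear-id p ⟩
    p                          ∎

  ⊛-distribʳ : ∀ r p q → (p ++ q) ⊛ r ≋ (p ⊛ r) ++ (q ⊛ r)
  ⊛-distribʳ r p q = linear-++ (λ m → shift m r) p q

  commutativeRing : CommutativeRing 0ℓ 0ℓ
  commutativeRing = record
    { Carrier = Combination
    ; _≈_ = _≋_
    ; _+_ = _++_
    ; _*_ = _⊛_
    ; -_  = negate
    ; 0#  = []
    ; 1#  = basis ε
    ; isCommutativeRing = record
      { isRing = record
        { +-isAbelianGroup = Module.+ᴹ-isAbelianGroup freeModule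
        ; *-cong     = λ {p} {p′} {q} {q′} → ⊛-cong {p} {p′} {q} {q′}
        ; *-assoc    = ⊛-assoc
        ; *-identity = ⊛-identityˡ
                     , (λ p → ≋-trans (⊛-comm p (basis ε)) (⊛-identityˡ p))
        ; distrib    = (λ r p q → ≋-trans (⊛-comm r (p ++ q)) (≋-trans (⊛-distribʳ r p q)
                         (+ᴹ-cong {x = p ⊛ r} {y = r ⊛ p} {u = q ⊛ r} {v = r ⊛ q}
                            (⊛-comm p r) (⊛-comm q r))))
                     , ⊛-distribʳ
        }
      ; *-comm = ⊛-comm
      }
    }

  augmentation : Combination → Carrier
  augmentation = linear {R} TensorUnit.⟨module⟩ (λ _ → 1#)

  private module Augmentation = LinearProperties {R} {monomials} TensorUnit.⟨module⟩

  augmentation-cong : ∀ {p q} → p ≋ q → augmentation p ≈ augmentation q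
  augmentation-cong = Augmentation.linear-cong (λ _ → refl)

  augmentation-+ : ∀ p q → augmentation (p ++ q) ≈ augmentation p + augmentation q
  augmentation-+ = Augmentation.linear-++ (λ _ → 1#)

  augmentation-* : ∀ p q → augmentation (p ⊛ q) ≈ augmentation p * augmentation q
  augmentation-* p q =
    trans (linear-∘ {R} {monomials} TensorUnit.⟨module⟩ (λ _ → 1#) (λ m → shift m q) p)
   (trans (Augmentation.linear-ext augmentation-shift p)
   (trans (Augmentation.linear-ext (λ _ → sym (*-identityʳ _)) p)
   (trans (Augmentation.linear-* (augmentation q) (λ _ → 1#) p) (*-comm _ _))))
    where
    augmentation-shift : ∀ m → augmentation (shift m q) ≈ augmentation q
    augmentation-shift m =
      trans (linear-∘ {R} {monomials} TensorUnit.⟨module⟩ (λ _ → 1#) (λ n → basis (m ∙ n)) q)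
            (Augmentation.linear-ext (λ n → Augmentation.linear-basis (λ _ → 1#) (m ∙ n)) q)

record IsDomain (R : CommutativeRing 0ℓ 0ℓ) : Set where
  open CommutativeRing R
  field
    1≉0             : ¬ 1# ≈ 0#
    noZeroDivisors  : ∀ x y → x * y ≈ 0# → x ≈ 0# ⊎ y ≈ 0#

  *-≉0 : ∀ {x y} → ¬ x ≈ 0# → ¬ y ≈ 0# → ¬ x * y ≈ 0#
  *-≉0 x≉0 y≉0 xy≈0 with noZeroDivisors _ _ xy≈0
  ... | inj₁ x≈0 = x≉0 x≈0
  ... | inj₂ y≈0 = y≉0 y≈0

record TermOrder (M : CommutativeMonoid 0ℓ 0ℓ) : Set₁ where
  open CommutativeMonoid M
  field
    _<_      : Rel Carrier 0ℓ
    <-trans  : Transitive _<_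
    <-cmp    : Trichotomous _≈_ _<_
    ∙-monoˡ  : ∀ {m m′} n → m < m′ → (m ∙ n) < (m′ ∙ n)
    <-respʳ  : ∀ {k m n} → m ≈ n → k < m → k < n
    <-respˡ  : ∀ {k m n} → m ≈ n → m < k → n < k

module MonoidAlgebraDomain
  (R : CommutativeRing 0ℓ 0ℓ) (M : CommutativeMonoid 0ℓ 0ℓ)
  (_≟_ : Decidable (CommutativeMonoid._≈_ M))
  (R-isDomain : IsDomain R)
  (_≟0 : ∀ a → Dec (CommutativeRing._≈_ R a (CommutativeRing.0# R)))
  (termOrder : TermOrder M)
  where

  open CommutativeRing R hiding (zero)
  private module M = CommutativeMonoid M
  open TermOrder termOrder
  open MonoidAlgebra R M _≟_
  open IsDomain R-isDomain
  open M using (_∙_; ε)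
  open CommutativeRing commutativeRing using () renaming
    (refl to ≋-refl; sym to ≋-sym; trans to ≋-trans)

  private
    <⇒≁ : ∀ {m n} → m < n → ¬ m M.≈ n
    <⇒≁ {m} {n} m<n m∼n with <-cmp m n
    ... | tri< _ m≁n _ = m≁n m∼n
    ... | tri≈ m≮n _ _ = m≮n m<n
    ... | tri> m≮n _ _ = m≮n m<n

    ∙-monoʳ : ∀ {m m′} n → m < m′ → (n ∙ m) < (n ∙ m′)
    ∙-monoʳ n m<m′ = <-respʳ (M.comm _ n) (<-respˡ (M.comm _ n) (∙-monoˡ n m<m′))

    Below : M.Carrier → Combination → Set
    Below u = All (λ (_ , m) → m < u)

    data Leading (n : ℕ) (p : Combination) : Set where
      vanishing : p ≋ [] → Leading n p
      nonzero   : ∀ {a m q} → ¬ a ≈ 0# → p ≋ (a , m) ∷ q → Below m q → length q ℕ.< n →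
                  Leading n p

    transfer : ∀ {n n′ p p′} → n′ ℕ.≤ n → p ≋ p′ → Leading n′ p′ → Leading n p
    transfer n′≤n e (vanishing p′≋0)         = vanishing (≋-trans e p′≋0)
    transfer n′≤n e (nonzero a≉0 f b l) = nonzero a≉0 (≋-trans e f) b (ℕₚ.<-≤-trans l n′≤n)

    cons-cong : ∀ x {p q} → p ≋ q → x ∷ p ≋ x ∷ q
    cons-cong (a , m) {p} {q} p≋q = mk≋ helper
      where
      helper : ∀ k → coefficient ((a , m) ∷ p) k ≈ coefficient ((a , m) ∷ q) k
      helper k with m ≟ k
      ... | yes _ = +-congˡ (coefficients p≋q k)
      ... | no  _ = coefficients p≋q k

    drop-zero : ∀ {a m p} → a ≈ 0# → (a , m) ∷ p ≋ p
    drop-zero {a} {m} {p} a≈0 = mk≋ helper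
      where
      helper : ∀ k → coefficient ((a , m) ∷ p) k ≈ coefficient p k
      helper k with m ≟ k
      ... | yes _ = trans (+-congʳ a≈0) (+-identityˡ _)
      ... | no  _ = refl

    swap : ∀ {a b m n p} → (a , m) ∷ (b , n) ∷ p ≋ (b , n) ∷ (a , m) ∷ p
    swap {a} {b} {m} {n} {p} = mk≋ helper
      where
      helper : ∀ k → coefficient ((a , m) ∷ (b , n) ∷ p) k ≈
                     coefficient ((b , n) ∷ (a , m) ∷ p) k
      helper k with m ≟ k in eq₁ | n ≟ k in eq₂
      ... | yes _ | yes _ rewrite eq₁ | eq₂ =
        trans (sym (+-assoc _ _ _)) (trans (+-congʳ (+-comm a b)) (+-assoc _ _ _))
      ... | yes _ | no  _ rewrite eq₁ | eq₂ = refl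
      ... | no  _ | yes _ rewrite eq₁ | eq₂ = refl
      ... | no  _ | no  _ rewrite eq₁ | eq₂ = refl

    merge : ∀ {a b m n p} → m M.≈ n → (a , m) ∷ (b , n) ∷ p ≋ (a + b , n) ∷ p
    merge {a} {b} {m} {n} {p} m∼n = mk≋ helper
      where
      helper : ∀ k → coefficient ((a , m) ∷ (b , n) ∷ p) k ≈ coefficient ((a + b , n) ∷ p) k
      helper k with m ≟ k | n ≟ k in eq
      ... | yes _ | yes _ rewrite eq = sym (+-assoc _ _ _)
      ... | no  _ | no  _ rewrite eq = refl
      ... | yes m∼k | no n≁k = contradiction (M.trans (M.sym m∼n) m∼k) n≁k
      ... | no m≁k | yes n∼k = contradiction (M.trans m∼n n∼k) m≁k

    leading : ∀ n p → length p ℕ.≤ n → Leading n p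
    leading _ [] _ = vanishing ≋-refl
    leading (suc n) ((a , m) ∷ p) (s≤s l) with a ≟0
    ... | yes a≈0 = transfer (ℕₚ.n≤1+n n) (drop-zero a≈0) (leading n p l)
    ... | no a≉0 with leading n p l
    ... | vanishing p≋0 = nonzero a≉0 (cons-cong (a , m) p≋0) [] (s≤s z≤n)
    ... | nonzero {b} {k} {q} b≉0 e below l′ with <-cmp m k
    ... | tri< m<k _ _ =
      nonzero b≉0 (≋-trans (cons-cong (a , m) e) swap) (m<k ∷ below) (s≤s l′)
    ... | tri> _ _ k<m =
      nonzero a≉0 (cons-cong (a , m) e)
              (k<m ∷ All.map (λ x<k → <-trans x<k k<m) below) (s≤s l′)
    ... | tri≈ _ m∼k _ with (a + b) ≟0
    ... | yes a+b≈0 = transfer (ℕₚ.n≤1+n n)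
      (≋-trans (cons-cong (a , m) e) (≋-trans (merge m∼k) (drop-zero a+b≈0)))
      (leading n q (ℕₚ.<⇒≤ l′))
    ... | no a+b≉0 = nonzero a+b≉0 (≋-trans (cons-cong (a , m) e) (merge m∼k)) below
      (ℕₚ.<-trans l′ ℕₚ.≤-refl)

    below-coefficient : ∀ u p → Below u p → coefficient p u ≈ 0#
    below-coefficient u []            []            = refl
    below-coefficient u ((_ , m) ∷ p) (m<u ∷ below) with m ≟ u
    ... | yes m∼u = contradiction m∼u (<⇒≁ m<u)
    ... | no  _   = below-coefficient u p below

    below-++ : ∀ {u p q} → Below u p → Below u q → Below u (p ++ q)
    below-++ []       bs = bs
    below-++ (b ∷ as) bs = b ∷ below-++ as bs

    below-scale : ∀ {u a p} → Below u p → Below u (scale a p)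
    below-scale []       = []
    below-scale (b ∷ bs) = b ∷ below-scale bs

    below-shift : ∀ {u} m q → All (λ (_ , n) → (m ∙ n) < u) q → Below u (shift m q)
    below-shift m []      []       = []
    below-shift m (_ ∷ q) (b ∷ bs) = b ∷ below-shift m q bs

    below-⊛ : ∀ {u} p q → All (λ (_ , m) → All (λ (_ , n) → (m ∙ n) < u) q) p → Below u (p ⊛ q)
    below-⊛ []            q []       = []
    below-⊛ ((_ , m) ∷ p) q (b ∷ bs) =
      below-++ (below-scale (below-shift m q b)) (below-⊛ p q bs)

    leading-coefficient : ∀ {a b m n p q} → Below m p → Below n q →
      coefficient (((a , m) ∷ p) ⊛ ((b , n) ∷ q)) (m ∙ n) ≈ a * b
    leading-coefficient {a} {b} {m} {n} {p} {q} p< q<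
      with (m ∙ n) ≟ (m ∙ n)
    ... | no ¬refl = contradiction M.refl ¬refl
    ... | yes _ = trans (+-cong (*-congˡ (*-identityʳ b)) (below-coefficient _ _ rest))
                        (+-identityʳ _)
      where
      rest : Below (m ∙ n) (scale a (shift m q) ++ (p ⊛ ((b , n) ∷ q)))
      rest = below-++ (below-scale (below-shift m q (All.map (∙-monoʳ m) q<)))
               (below-⊛ p ((b , n) ∷ q) (All.map
                 (λ x<m → ∙-monoˡ n x<m ∷
                          All.map (λ y<n → <-trans (∙-monoʳ _ y<n) (∙-monoˡ n x<m)) q<)
                 p<))

  isDomain : IsDomain commutativeRing
  isDomain = record
    { 1≉0            = λ 1≋0 → 1≉0 (trans (sym coefficient-1) (coefficients 1≋0 ε))
    ; noZeroDivisors = λ p q → helper p q (leading _ p ℕₚ.≤-refl) (leading _ q ℕₚ.≤-refl)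
    }
    where
    coefficient-1 : coefficient (basis ε) ε ≈ 1#
    coefficient-1 with ε ≟ ε
    ... | yes _  = +-identityʳ 1#
    ... | no ε≁ε = contradiction M.refl ε≁ε

    helper : ∀ p q → Leading (length p) p → Leading (length q) q →
             p ⊛ q ≋ [] → p ≋ [] ⊎ q ≋ []
    helper p q (vanishing p≋0) _          _    = inj₁ p≋0
    helper p q _          (vanishing q≋0) _    = inj₂ q≋0
    helper p q (nonzero {a} {m} {p′} a≉0 p≋ p< _) (nonzero {b} {n} {q′} b≉0 q≋ q< _) pq≋0 =
      contradiction
        (trans (sym (leading-coefficient p< q<))
               (coefficients (≋-trans (≋-sym (⊛-cong {p} {_} {q} p≋ q≋)) pq≋0) (m ∙ n)))
        (*-≉0 a≉0 b≉0)

module Fractions (D : CommutativeRing 0ℓ 0ℓ) (D-isDomain : IsDomain D) where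
  open CommutativeRing D hiding (zero)
  open IsDomain D-isDomain
  open SetoidReasoning setoid
  open NaturalCoefficientsSolver commutativeSemiring using (solve)
    renaming (_:+_ to _⊕_; _:*_ to _⊗_; _:=_ to _⊜_)
  open RingProperties ring using (-‿distribˡ-*)

  record Fraction : Set where
    constructor fraction
    field
      numerator     : Carrier
      denominator   : Carrier
      denominator≉0 : ¬ denominator ≈ 0#
  open Fraction public

  infix 4 _≃_
  record _≃_ (x y : Fraction) : Set where
    constructor mk≃
    field cross : numerator x * denominator y ≈ numerator y * denominator x
  open _≃_ public

  embed : Carrier → Fraction
  embed a = fraction a 1# 1≉0

  *-cancelʳ : ∀ {x y z} → ¬ z ≈ 0# → x * z ≈ y * z → x ≈ y
  *-cancelʳ {x} {y} {z} z≉0 xz≈yz with noZeroDivisors (x - y) z (begin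
    (x - y) * z      ≈⟨ trans (distribʳ z x (- y)) (+-congˡ (sym (-‿distribˡ-* y z))) ⟩
    x * z - y * z    ≈⟨ +-congʳ xz≈yz ⟩
    y * z - y * z    ≈⟨ -‿inverseʳ _ ⟩
    0#               ∎)
  ... | inj₂ z≈0   = contradiction z≈0 z≉0
  ... | inj₁ x-y≈0 = begin
    x              ≈⟨ trans (+-congˡ (-‿inverseˡ y)) (+-identityʳ x) ⟨
    x + (- y + y)  ≈⟨ +-assoc x (- y) y ⟨
    (x - y) + y    ≈⟨ +-congʳ x-y≈0 ⟩
    0# + y         ≈⟨ +-identityˡ y ⟩
    y              ∎

  infixl 6 _+ᶠ_
  infixl 7 _*ᶠ_
  _+ᶠ_ _*ᶠ_ : Fraction → Fraction → Fraction
  fraction a b b≉0 +ᶠ fraction c d d≉0 = fraction (a * d + c * b) (b * d) (*-≉0 b≉0 d≉0)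
  fraction a b b≉0 *ᶠ fraction c d d≉0 = fraction (a * c) (b * d) (*-≉0 b≉0 d≉0)

  -ᶠ_ : Fraction → Fraction
  -ᶠ fraction a b b≉0 = fraction (- a) b b≉0

  private
    ≃-trans : Transitive _≃_
    ≃-trans {fraction a b _} {fraction c d d≉0} {fraction e f _} (mk≃ ad≈cb) (mk≃ cf≈ed) =
      mk≃ (*-cancelʳ d≉0 (begin
        (a * f) * d  ≈⟨ solve 3 (λ a d f → (a ⊗ f) ⊗ d ⊜ (a ⊗ d) ⊗ f) refl a d f ⟩
        (a * d) * f  ≈⟨ *-congʳ ad≈cb ⟩
        (c * b) * f  ≈⟨ solve 3 (λ c b f → (c ⊗ b) ⊗ f ⊜ (c ⊗ f) ⊗ b) refl c b f ⟩
        (c * f) * b  ≈⟨ *-congʳ cf≈ed ⟩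
        (e * d) * b  ≈⟨ solve 3 (λ e d b → (e ⊗ d) ⊗ b ⊜ (e ⊗ b) ⊗ d) refl e d b ⟩
        (e * b) * d  ∎))

    +ᶠ-cong : ∀ {x y u v} → x ≃ y → u ≃ v → x +ᶠ u ≃ y +ᶠ v
    +ᶠ-cong {fraction a b _} {fraction a′ b′ _} {fraction c d _} {fraction c′ d′ _}
            (mk≃ e) (mk≃ f) = mk≃ (begin
      (a * d + c * b) * (b′ * d′)
        ≈⟨ solve 6 (λ a b c d b′ d′ → (a ⊗ d ⊕ c ⊗ b) ⊗ (b′ ⊗ d′) ⊜
                      (a ⊗ b′) ⊗ (d ⊗ d′) ⊕ (c ⊗ d′) ⊗ (b ⊗ b′)) refl a b c d b′ d′ ⟩
      (a * b′) * (d * d′) + (c * d′) * (b * b′)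
        ≈⟨ +-cong (*-congʳ e) (*-congʳ f) ⟩
      (a′ * b) * (d * d′) + (c′ * d) * (b * b′)
        ≈⟨ solve 6 (λ a′ b c′ d b′ d′ → (a′ ⊗ b) ⊗ (d ⊗ d′) ⊕ (c′ ⊗ d) ⊗ (b ⊗ b′) ⊜
                      (a′ ⊗ d′ ⊕ c′ ⊗ b′) ⊗ (b ⊗ d)) refl a′ b c′ d b′ d′ ⟩
      (a′ * d′ + c′ * b′) * (b * d) ∎)

    *ᶠ-cong : ∀ {x y u v} → x ≃ y → u ≃ v → x *ᶠ u ≃ y *ᶠ v
    *ᶠ-cong {fraction a b _} {fraction a′ b′ _} {fraction c d _} {fraction c′ d′ _}
            (mk≃ e) (mk≃ f) = mk≃ (begin
      (a * c) * (b′ * d′)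
        ≈⟨ solve 4 (λ a b′ c d′ → (a ⊗ c) ⊗ (b′ ⊗ d′) ⊜ (a ⊗ b′) ⊗ (c ⊗ d′)) refl a b′ c d′ ⟩
      (a * b′) * (c * d′)
        ≈⟨ *-cong e f ⟩
      (a′ * b) * (c′ * d)
        ≈⟨ solve 4 (λ a′ b c′ d → (a′ ⊗ b) ⊗ (c′ ⊗ d) ⊜ (a′ ⊗ c′) ⊗ (b ⊗ d)) refl a′ b c′ d ⟩
      (a′ * c′) * (b * d) ∎)

    by-numerators : ∀ {x y} → numerator x ≈ numerator y → denominator x ≈ denominator y → x ≃ y
    by-numerators n≈ d≈ = mk≃ (*-cong n≈ (sym d≈))

  commutativeRing : CommutativeRing 0ℓ 0ℓ
  commutativeRing = record
    { Carrier = Fraction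
    ; _≈_ = _≃_
    ; _+_ = _+ᶠ_
    ; _*_ = _*ᶠ_
    ; -_  = -ᶠ_
    ; 0#  = embed 0#
    ; 1#  = embed 1#
    ; isCommutativeRing = record
      { isRing = record
        { +-isAbelianGroup = record
          { isGroup = record
            { isMonoid = record
              { isSemigroup = record
                { isMagma = record
                  { isEquivalence = record
                    { refl  = mk≃ refl
                    ; sym   = λ e → mk≃ (sym (cross e))
                    ; trans = ≃-trans
                    }
                  ; ∙-cong = +ᶠ-cong
                  }
                ; assoc = λ (fraction a b _) (fraction c d _) (fraction e f _) → by-numerators
                    (solve 6 (λ a b c d e f → (a ⊗ d ⊕ c ⊗ b) ⊗ f ⊕ e ⊗ (b ⊗ d) ⊜
                                a ⊗ (d ⊗ f) ⊕ (c ⊗ f ⊕ e ⊗ d) ⊗ b) refl a b c d e f)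
                    (*-assoc b d f)
                }
              ; identity =
                  (λ (fraction a b _) → by-numerators
                    (trans (+-cong (zeroˡ b) (*-identityʳ a)) (+-identityˡ a)) (*-identityˡ b))
                , (λ (fraction a b _) → by-numerators
                    (trans (+-cong (*-identityʳ a) (zeroˡ b)) (+-identityʳ a)) (*-identityʳ b))
              }
            ; inverse =
                (λ (fraction a b _) → mk≃ (trans (*-identityʳ _)
                  (trans (sym (distribʳ b (- a) a))
                  (trans (*-congʳ (-‿inverseˡ a)) (trans (zeroˡ b) (sym (zeroˡ (b * b))))))))
              , (λ (fraction a b _) → mk≃ (trans (*-identityʳ _)
                  (trans (sym (distribʳ b a (- a)))
                  (trans (*-congʳ (-‿inverseʳ a)) (trans (zeroˡ b) (sym (zeroˡ (b * b))))))))
            ; ⁻¹-cong = λ {(fraction a b _)} {(fraction c d _)} (mk≃ e) → mk≃ (begin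
                - a * d    ≈⟨ -‿distribˡ-* a d ⟨
                - (a * d)  ≈⟨ -‿cong e ⟩
                - (c * b)  ≈⟨ -‿distribˡ-* c b ⟩
                - c * b    ∎)
            }
          ; comm = λ (fraction a b _) (fraction c d _) → by-numerators (+-comm _ _) (*-comm b d)
          }
        ; *-cong     = *ᶠ-cong
        ; *-assoc    = λ (fraction a b _) (fraction c d _) (fraction e f _) →
                         by-numerators (*-assoc a c e) (*-assoc b d f)
        ; *-identity = (λ (fraction a b _) → by-numerators (*-identityˡ a) (*-identityˡ b))
                     , (λ (fraction a b _) → by-numerators (*-identityʳ a) (*-identityʳ b))
        ; distrib    =
            (λ (fraction a b _) (fraction c d _) (fraction e f _) → mk≃
              (solve 6 (λ a b c d e f →
                 (a ⊗ (c ⊗ f ⊕ e ⊗ d)) ⊗ ((b ⊗ d) ⊗ (b ⊗ f)) ⊜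
                 ((a ⊗ c) ⊗ (b ⊗ f) ⊕ (a ⊗ e) ⊗ (b ⊗ d)) ⊗ (b ⊗ (d ⊗ f))) refl a b c d e f))
          , (λ (fraction a b _) (fraction c d _) (fraction e f _) → mk≃
              (solve 6 (λ a b c d e f →
                 ((c ⊗ f ⊕ e ⊗ d) ⊗ a) ⊗ ((d ⊗ b) ⊗ (f ⊗ b)) ⊜
                 ((c ⊗ a) ⊗ (f ⊗ b) ⊕ (e ⊗ a) ⊗ (d ⊗ b)) ⊗ ((d ⊗ f) ⊗ b)) refl a b c d e f))
        }
      ; *-comm = λ (fraction a b _) (fraction c d _) → by-numerators (*-comm a c) (*-comm b d)
      }
    }

record Exponents (M : CommutativeMonoid 0ℓ 0ℓ) : Set where
  open CommutativeMonoid M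
  field
    exponent   : Carrier → ℕ → ℕ
    cong       : ∀ {m n} → m ≈ n → ∀ j → exponent m j ≡ exponent n j
    injective  : ∀ {m n} → (∀ j → exponent m j ≡ exponent n j) → m ≈ n
    homo       : ∀ m n j → exponent (m ∙ n) j ≡ exponent m j ℕ.+ exponent n j
    bound      : Carrier → ℕ
    bounded    : ∀ m {j} → bound m ℕ.≤ j → exponent m j ≡ 0

module Lexicographic {M : CommutativeMonoid 0ℓ 0ℓ} (E : Exponents M) where
  open CommutativeMonoid M
  open Exponents E

  infix 4 _≺_
  record _≺_ (m n : Carrier) : Set where
    constructor mk≺
    field
      index  : ℕ
      before : ∀ {i} → i ℕ.< index → exponent m i ≡ exponent n i
      at     : exponent m index ℕ.< exponent n index

  private
    Agreement : Carrier → Carrier → ℕ → Set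
    Agreement m n b = ∀ {i} → i ℕ.< b → exponent m i ≡ exponent n i

    compareBelow : ∀ m n b → m ≺ n ⊎ Agreement m n b ⊎ n ≺ m
    compareBelow m n zero = inj₂ (inj₁ λ ())
    compareBelow m n (suc b) with compareBelow m n b
    ... | inj₁ m≺n = inj₁ m≺n
    ... | inj₂ (inj₂ n≺m) = inj₂ (inj₂ n≺m)
    ... | inj₂ (inj₁ agree) with ℕₚ.<-cmp (exponent m b) (exponent n b)
    ... | tri< m<n _ _ = inj₁ (mk≺ b agree m<n)
    ... | tri> _ _ n<m = inj₂ (inj₂ (mk≺ b (λ i<b → ≡.sym (agree i<b)) n<m))
    ... | tri≈ _ m≡n _ = inj₂ (inj₁ λ i<1+b → extend (ℕₚ.m<1+n⇒m<n∨m≡n i<1+b))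
      where
      extend : ∀ {i} → i ℕ.< b ⊎ i ≡ b → exponent m i ≡ exponent n i
      extend (inj₁ i<b)    = agree i<b
      extend (inj₂ ≡.refl) = m≡n

    compare : ∀ m n → m ≺ n ⊎ m ≈ n ⊎ n ≺ m
    compare m n with compareBelow m n (bound m ℕ.⊔ bound n)
    ... | inj₁ m≺n          = inj₁ m≺n
    ... | inj₂ (inj₂ n≺m)   = inj₂ (inj₂ n≺m)
    ... | inj₂ (inj₁ agree) = inj₂ (inj₁ (injective λ j → everywhere j))
      where
      everywhere : ∀ j → exponent m j ≡ exponent n j
      everywhere j with j ℕₚ.<? bound m ℕ.⊔ bound n
      ... | yes j<b = agree j<b
      ... | no  j≮b = ≡.trans
        (bounded m (ℕₚ.≤-trans (ℕₚ.m≤m⊔n _ _) (ℕₚ.≮⇒≥ j≮b)))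
        (≡.sym (bounded n (ℕₚ.≤-trans (ℕₚ.m≤n⊔m (bound m) _) (ℕₚ.≮⇒≥ j≮b))))

    ≺-trans : Transitive _≺_
    ≺-trans {k} {m} {n} (mk≺ i before at) (mk≺ j before′ at′) with ℕₚ.<-cmp i j
    ... | tri< i<j _ _ = mk≺ i
      (λ l → ≡.trans (before l) (before′ (ℕₚ.<-trans l i<j)))
      (≡.subst (exponent k i ℕ.<_) (before′ i<j) at)
    ... | tri> _ _ j<i = mk≺ j
      (λ l → ≡.trans (before (ℕₚ.<-trans l j<i)) (before′ l))
      (≡.subst (ℕ._< exponent n j) (≡.sym (before j<i)) at′)
    ... | tri≈ _ ≡.refl _ = mk≺ i (λ l → ≡.trans (before l) (before′ l)) (ℕₚ.<-trans at at′)

    ≺-irrefl : ∀ {m n} → m ≈ n → ¬ m ≺ n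
    ≺-irrefl m≈n (mk≺ i _ at) = ℕₚ.<-irrefl (cong m≈n i) at

    ≺-cmp : Trichotomous _≈_ _≺_
    ≺-cmp m n with compare m n
    ... | inj₁ m≺n = tri< m≺n (λ m≈n → ≺-irrefl m≈n m≺n)
                          (λ n≺m → ≺-irrefl refl (≺-trans m≺n n≺m))
    ... | inj₂ (inj₁ m≈n) = tri≈ (≺-irrefl m≈n) m≈n (≺-irrefl (sym m≈n))
    ... | inj₂ (inj₂ n≺m) = tri> (λ m≺n → ≺-irrefl refl (≺-trans m≺n n≺m))
                                 (λ m≈n → ≺-irrefl (sym m≈n) n≺m) n≺m

  termOrder : TermOrder M
  termOrder = record
    { _<_     = _≺_
    ; <-trans = ≺-trans
    ; <-cmp   = ≺-cmp
    ; ∙-monoˡ = λ {m} {m′} n (mk≺ i before at) → mk≺ i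
        (λ {j} l → ≡.trans (homo m n j)
          (≡.trans (≡.cong (ℕ._+ exponent n j) (before l)) (≡.sym (homo m′ n j))))
        (≡.subst₂ ℕ._<_ (≡.sym (homo m n i)) (≡.sym (homo m′ n i))
          (ℕₚ.+-monoˡ-< (exponent n i) at))
    ; <-respʳ = λ {k} m≈n (mk≺ i before at) → mk≺ i
        (λ {j} l → ≡.trans (before l) (cong m≈n j)) (≡.subst (exponent k i ℕ.<_) (cong m≈n i) at)
    ; <-respˡ = λ {k} m≈n (mk≺ i before at) → mk≺ i
        (λ {j} l → ≡.trans (≡.sym (cong m≈n j)) (before l))
        (≡.subst (ℕ._< exponent k i) (cong m≈n i) at)
    }

  infix 4 _≟_
  _≟_ : Decidable _≈_
  m ≟ n with ≺-cmp m n
  ... | tri< _ m≉n _ = no m≉n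
  ... | tri≈ _ m≈n _ = yes m≈n
  ... | tri> _ m≉n _ = no m≉n

-- Monomials in countably many variables: lists of exponents, where trailing
-- zeros are irrelevant.

infixl 9 _!_
_!_ : List ℕ → ℕ → ℕ
[]      ! j     = 0
(a ∷ m) ! zero  = a
(a ∷ m) ! suc j = m ! j

infixl 6 _⊕_
_⊕_ : List ℕ → List ℕ → List ℕ
[]      ⊕ n       = n
(a ∷ m) ⊕ []      = a ∷ m
(a ∷ m) ⊕ (b ∷ n) = a ℕ.+ b ∷ m ⊕ n

!-⊕ : ∀ m n j → (m ⊕ n) ! j ≡ m ! j ℕ.+ n ! j
!-⊕ []      n       j       = ≡.refl
!-⊕ (a ∷ m) []      j       = ≡.sym (ℕₚ.+-identityʳ _)
!-⊕ (a ∷ m) (b ∷ n) zero    = ≡.refl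
!-⊕ (a ∷ m) (b ∷ n) (suc j) = !-⊕ m n j

infix 4 _≐_
record _≐_ (m n : List ℕ) : Set where
  constructor mk≐
  field exponents : ∀ j → m ! j ≡ n ! j
open _≐_ public

countableMonomials : CommutativeMonoid 0ℓ 0ℓ
countableMonomials = record
  { Carrier = List ℕ
  ; _≈_ = _≐_
  ; _∙_ = _⊕_
  ; ε   = []
  ; isCommutativeMonoid = record
    { isMonoid = record
      { isSemigroup = record
        { isMagma = record
          { isEquivalence = record
            { refl  = mk≐ λ _ → ≡.refl
            ; sym   = λ e → mk≐ λ j → ≡.sym (exponents e j)
            ; trans = λ e f → mk≐ λ j → ≡.trans (exponents e j) (exponents f j)
            }
          ; ∙-cong = λ {m} {m′} {n} {n′} e f → mk≐ λ j → ≡.trans (!-⊕ m n j)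
              (≡.trans (≡.cong₂ ℕ._+_ (exponents e j) (exponents f j)) (≡.sym (!-⊕ m′ n′ j)))
          }
        ; assoc = λ k m n → mk≐ λ j →
            ≡.trans (≡.trans (!-⊕ (k ⊕ m) n j) (≡.cong (ℕ._+ n ! j) (!-⊕ k m j)))
           (≡.trans (ℕₚ.+-assoc (k ! j) (m ! j) (n ! j))
           (≡.sym (≡.trans (!-⊕ k (m ⊕ n) j) (≡.cong (k ! j ℕ.+_) (!-⊕ m n j)))))
        }
      ; identity = (λ _ → mk≐ λ _ → ≡.refl)
                 , (λ m → mk≐ λ j → ≡.trans (!-⊕ m [] j) (ℕₚ.+-identityʳ (m ! j)))
      }
    ; comm = λ m n → mk≐ λ j →
        ≡.trans (!-⊕ m n j) (≡.trans (ℕₚ.+-comm (m ! j) (n ! j)) (≡.sym (!-⊕ n m j)))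
    }
  }

!-bounded : ∀ m {j} → length m ℕ.≤ j → m ! j ≡ 0
!-bounded []      _         = ≡.refl
!-bounded (_ ∷ m) (s≤s m≤j) = !-bounded m m≤j

countableExponents : Exponents countableMonomials
countableExponents = record
  { exponent  = _!_
  ; cong      = exponents
  ; injective = mk≐
  ; homo      = !-⊕
  ; bound     = length
  ; bounded   = !-bounded
  }

finiteMonomials : ℕ → CommutativeMonoid 0ℓ 0ℓ
finiteMonomials n = record
  { Carrier = Vec ℕ n
  ; _≈_ = _≡_
  ; _∙_ = Vec.zipWith ℕ._+_
  ; ε   = Vec.replicate n 0
  ; isCommutativeMonoid = record
    { isMonoid = record
      { isSemigroup = record
        { isMagma = ≡.isMagma (Vec.zipWith ℕ._+_)
        ; assoc   = Vecₚ.zipWith-assoc ℕₚ.+-assoc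
        }
      ; identity = Vecₚ.zipWith-identityˡ ℕₚ.+-identityˡ , Vecₚ.zipWith-identityʳ ℕₚ.+-identityʳ
      }
    ; comm = Vecₚ.zipWith-comm ℕₚ.+-comm
    }
  }

finiteExponents : ∀ n → Exponents (finiteMonomials n)
finiteExponents n = record
  { exponent  = λ m → Vec.toList m !_
  ; cong      = λ m≡m′ j → ≡.cong (λ m → Vec.toList m ! j) m≡m′
  ; injective = injective _ _
  ; homo      = homo
  ; bound     = length ∘ Vec.toList
  ; bounded   = !-bounded ∘ Vec.toList
  }
  where
  injective : ∀ {n} (m m′ : Vec ℕ n) → (∀ j → Vec.toList m ! j ≡ Vec.toList m′ ! j) → m ≡ m′
  injective []      []       e = ≡.refl
  injective (_ ∷ m) (_ ∷ m′) e = ≡.cong₂ _∷_ (e 0) (injective m m′ (e ∘ suc))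

  homo : ∀ {n} (m m′ : Vec ℕ n) j →
         Vec.toList (Vec.zipWith ℕ._+_ m m′) ! j ≡ Vec.toList m ! j ℕ.+ Vec.toList m′ ! j
  homo []      []       j       = ≡.refl
  homo (_ ∷ m) (_ ∷ m′) zero    = ≡.refl
  homo (_ ∷ m) (_ ∷ m′) (suc j) = homo m m′ j

ℚring : CommutativeRing 0ℓ 0ℓ
ℚring = ℚₚ.+-*-commutativeRing

ℚ-isDomain : IsDomain ℚring
ℚ-isDomain = record { 1≉0 = ℚₚ.1≢0 ; noZeroDivisors = noZeroDivisors }
  where
  noZeroDivisors : ∀ p q → p ℚ.* q ≡ 0ℚ → p ≡ 0ℚ ⊎ q ≡ 0ℚ
  noZeroDivisors p q pq≡0 with p ℚₚ.≟ 0ℚ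
  ... | yes p≡0 = inj₁ p≡0
  ... | no  p≢0 = inj₂ (begin
    q                      ≡⟨ ℚₚ.*-identityˡ q ⟨
    1ℚ ℚ.* q               ≡⟨ ≡.cong (ℚ._* q) (ℚₚ.*-inverseˡ p) ⟨
    (ℚ.1/ p ℚ.* p) ℚ.* q   ≡⟨ ℚₚ.*-assoc (ℚ.1/ p) p q ⟩
    ℚ.1/ p ℚ.* (p ℚ.* q)   ≡⟨ ≡.cong (ℚ.1/ p ℚ.*_) pq≡0 ⟩
    ℚ.1/ p ℚ.* 0ℚ          ≡⟨ ℚₚ.*-zeroʳ (ℚ.1/ p) ⟩
    0ℚ                     ∎)
    where
    open ≡.≡-Reasoning
    instance _ = ℚ.≢-nonZero p≢0

module PolynomialRing {M : CommutativeMonoid 0ℓ 0ℓ} (E : Exponents M) where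
  open MonoidAlgebra ℚring M (Lexicographic._≟_ E) public
  open CommutativeRing commutativeRing public
    using (_+_; _*_; -_; 0#; 1#; _≈_; _≉_)
  open MonoidAlgebraDomain ℚring M (Lexicographic._≟_ E) ℚ-isDomain
    (ℚₚ._≟ 0ℚ) (Lexicographic.termOrder E) public using (isDomain)

  Polynomial : Set
  Polynomial = Combination

  infixr 8 _^_
  _^_ : Polynomial → ℕ → Polynomial
  p ^ zero  = 1#
  p ^ suc a = p * p ^ a

  ∏ : List Polynomial → Polynomial
  ∏ = List.foldr _*_ 1#

  ∏-≉0 : ∀ {ps} → All (_≉ 0#) ps → ∏ ps ≉ 0#
  ∏-≉0 []         = IsDomain.1≉0 isDomain
  ∏-≉0 (p≉0 ∷ ps) = IsDomain.*-≉0 isDomain p≉0 (∏-≉0 ps)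

  augmentation-≉0 : ∀ {p} → augmentation p ≢ 0ℚ → p ≉ 0#
  augmentation-≉0 p≢0 p≈0 = p≢0 (augmentation-cong p≈0)

  module FractionField = Fractions commutativeRing isDomain

-- Λ = ℚ[e₁,e₂,…] and K = ℚ(e₁,e₂,…); the variable with index j is e_{j+1}.

module Λ = PolynomialRing countableExponents
module K = Λ.FractionField

e : ℕ → Λ.Polynomial
e zero    = Λ.1#
e (suc j) = Λ.basis (List.replicate j 0 ++ 1 ∷ [])

e≉0 : ∀ j → e j Λ.≉ Λ.0#
e≉0 zero    = Λ.augmentation-≉0 {e 0} λ ()
e≉0 (suc j) = Λ.augmentation-≉0 {e (suc j)} λ ()

-- hook r m is the symmetric function Σ_c x_c^{m+1} e_r(all x except x_c).  Since
-- e_{r+1} = e_{r+1}(all x except x_c) + x_c e_r(all x except x_c) for every c, one has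
-- e_{r+1} p_{m+1} = hook (r+1) m + hook r (m+1); together with
-- hook r 0 = (r+1) e_{r+1} this is Newton's recursion for the power sums.

hook : ℕ → ℕ → Λ.Polynomial
hook r zero    = Λ.constant (+ suc r ℚ./ 1) Λ.* e (suc r)
hook r (suc m) = (e (suc r) Λ.* hook 0 m) Λ.+ (Λ.- hook (suc r) m)

-- p[1+ m ] = p_{m+1} = Σ_c x_c^{m+1}

p[1+_] : ℕ → Λ.Polynomial
p[1+ m ] = hook 0 m

constantᴷ : ℚ → K.Fraction
constantᴷ q = K.embed (Λ.constant q)

module FiniteVariables (N : ℕ) where
  open PolynomialRing (finiteExponents N) public

  var : Fin N → Polynomial
  var i = basis (Vec.replicate N 0 Vec.[ i ]≔ 1)

  -- x c = x_c for 1 ≤ c ≤ N, and x_c is set to 0 for c > N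
  x : ℕ → Polynomial
  x zero = 0#
  x (suc j) with j ℕₚ.<? N
  ... | yes j<N = var (Fin.fromℕ< j<N)
  ... | no  _   = 0#

  elementary : ∀ {n} → Vec Polynomial n → ℕ → Polynomial
  elementary xs       zero    = 1#
  elementary []       (suc j) = 0#
  elementary (y ∷ ys) (suc j) = (y * elementary ys j) + elementary ys (suc j)

  -- e_j(x₁,…,x_N)
  ē : ℕ → Polynomial
  ē = elementary (Vec.tabulate var)

  private
    augmentation-var : ∀ i → augmentation (var i) ≡ 1ℚ
    augmentation-var i = ≡.refl

    augmentation-step : ∀ y p q → augmentation y ≡ 1ℚ →
                        augmentation ((y * p) + q) ≡ augmentation p ℚ.+ augmentation q
    augmentation-step y p q y↦1 = begin
      augmentation ((y * p) + q)
        ≡⟨ augmentation-+ (y * p) q ⟩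
      augmentation (y * p) ℚ.+ augmentation q
        ≡⟨ ≡.cong (ℚ._+ augmentation q) (augmentation-* y p) ⟩
      (augmentation y ℚ.* augmentation p) ℚ.+ augmentation q
        ≡⟨ ≡.cong (λ u → (u ℚ.* augmentation p) ℚ.+ augmentation q) y↦1 ⟩
      (1ℚ ℚ.* augmentation p) ℚ.+ augmentation q
        ≡⟨ ≡.cong (ℚ._+ augmentation q) (ℚₚ.*-identityˡ (augmentation p)) ⟩
      augmentation p ℚ.+ augmentation q ∎
      where open ≡.≡-Reasoning

    OnesAtOne : ∀ {n} → Vec Polynomial n → Set
    OnesAtOne = Allᵛ.All (λ y → augmentation y ≡ 1ℚ)

    elementary-nonNegative : ∀ {n} (ys : Vec Polynomial n) → OnesAtOne ys →
                             ∀ j → 0ℚ ℚ.≤ augmentation (elementary ys j)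
    elementary-nonNegative ys       _              zero    = ℚₚ.nonNegative⁻¹ 1ℚ
    elementary-nonNegative []       _              (suc j) = ℚₚ.≤-refl
    elementary-nonNegative (y ∷ ys) (y↦1 ∷ ys↦1) (suc j) =
      ≡.subst (0ℚ ℚ.≤_)
        (≡.sym (augmentation-step y (elementary ys j) (elementary ys (suc j)) y↦1))
        (ℚₚ.+-mono-≤ (elementary-nonNegative ys ys↦1 j)
                     (elementary-nonNegative ys ys↦1 (suc j)))

    elementary-positive : ∀ {n} (ys : Vec Polynomial n) → OnesAtOne ys →
                          ∀ {j} → j ℕ.≤ n → 0ℚ ℚ.< augmentation (elementary ys j)
    elementary-positive ys       _              z≤n           = ℚₚ.positive⁻¹ 1ℚ
    elementary-positive (y ∷ ys) (y↦1 ∷ ys↦1) (s≤s {j} j≤n) =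
      ≡.subst (0ℚ ℚ.<_)
        (≡.sym (augmentation-step y (elementary ys j) (elementary ys (suc j)) y↦1))
        (ℚₚ.+-mono-<-≤ (elementary-positive ys ys↦1 j≤n)
                       (elementary-nonNegative ys ys↦1 (suc j)))

  ē≉0 : ∀ {j} → j ℕ.≤ N → ē j ≉ 0#
  ē≉0 {j} j≤N = augmentation-≉0 {ē j} λ eq →
    ℚₚ.<-irrefl (≡.sym eq) (elementary-positive (Vec.tabulate var) (Allᵛₚ.tabulate⁺ augmentation-var) j≤N)

  -- The ring homomorphism Λ → ℚ[x₁,…,x_N] with e_j ↦ e_j(x₁,…,x_N)
  evaluate : Λ.Polynomial → Polynomial
  evaluate = linear freeModule (product 1)
    where
    product : ℕ → List ℕ → Polynomial
    product j []      = 1#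
    product j (a ∷ m) = ē j ^ a * product (suc j) m

  open FractionField public using (Fraction; fraction; embed)

  field⟨x⟩ : CommutativeRing 0ℓ 0ℓ
  field⟨x⟩ = FractionField.commutativeRing

  constantᶠ : ℚ → Fraction
  constantᶠ q = embed (constant q)

open import Data.Nat.Base using (_≤_; _<_)

record Tuple (Label : ℕ → Set) (k : ℕ) : Set where
  constructor tuple
  field
    entries  : Vec ℕ k
    labels   : Allᵛ.All Label entries
    distinct : Unique entries
open Tuple public

tuples : (ℕ → Set) → ℕ → DecSetoid 0ℓ 0ℓ
tuples Label k = On.decSetoid (≡.decSetoid (Vecₚ.≡-dec ℕₚ._≟_)) (entries {Label} {k})

∅ : ∀ {Label} → Tuple Label 0
∅ = tuple [] [] []

rest : ∀ {Label k} → Tuple Label (suc k) → Tuple Label k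
rest (tuple (_ ∷ σ) (_ ∷ ls) (_ ∷ ds)) = tuple σ ls ds

append : ∀ {Label k} (σ : Tuple Label k) {y : ℕ} → Label y → y ∉ entries σ → Tuple Label (suc k)
append (tuple σ ls ds) {y} l y∉σ = tuple (σ ∷ʳ y) (all-∷ʳ ls l) (unique-∷ʳ ds y∉σ)
  where
  all-∷ʳ : ∀ {P : ℕ → Set} {k} {xs : Vec ℕ k} {y} → Allᵛ.All P xs → P y → Allᵛ.All P (xs ∷ʳ y)
  all-∷ʳ []         py = py ∷ []
  all-∷ʳ (px ∷ pxs) py = px ∷ all-∷ʳ pxs py

  unique-∷ʳ : ∀ {k} {xs : Vec ℕ k} {y} → Unique xs → y ∉ xs → Unique (xs ∷ʳ y)
  unique-∷ʳ []       y∉xs = [] ∷ []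
  unique-∷ʳ (d ∷ ds) y∉xs =
    all-∷ʳ d (λ x≡y → y∉xs (here (≡.sym x≡y))) ∷ unique-∷ʳ ds (y∉xs ∘ there)

-- All pairs (y , σ,y) with y ∈ {1,…,b} and y ∉ σ

extensions : ∀ {Label k} (b : ℕ) → (∀ {y} → 1 ≤ y → y ≤ b → Label y) →
             Tuple Label k → List (ℕ × Tuple Label (suc k))
extensions {Label} {k} b label σ = List.mapMaybe extend (List.allFin b)
  where
  extend : Fin b → Maybe (ℕ × Tuple Label (suc k))
  extend j with suc (Fin.toℕ j) ∈? entries σ
  ... | yes _   = nothing
  ... | no  y∉σ = just (suc (Fin.toℕ j) , append σ (label (s≤s z≤n) (Finₚ.toℕ<n j)) y∉σ)

-- In A below all denominators are nonzero when the entries of σ are positive and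
-- distinct, so the convention m ÷ 0 = 0 plays no role.

infixl 7 _÷_
_÷_ : ℤ → ℤ → ℚ
m ÷ (+ zero)  = 0ℚ
m ÷ (+ suc n) = m ℚ./ suc n
m ÷ -[1+ n ]  = (ℤ.- m) ℚ./ suc n

∏ℚ : List ℚ → ℚ
∏ℚ = List.foldr ℚ._*_ 1ℚ

A : ∀ {k} → ℕ → Vec ℕ k → ℚ
A {k} y σ with y ℕₚ.≟ 1 | Finₚ.any? (λ r → y ℕₚ.≟ suc (lookup σ r))
... | yes _ | _           = ∏ℚ (List.map (λ r → (lookup σ r ⊖ 1) ÷ (+ lookup σ r)) (List.allFin k))
... | no  _ | yes (r , _) =
  ((+ suc (lookup σ r)) ÷ (+ lookup σ r)) ℚ.*
  ∏ℚ (List.map (λ r′ → (suc (lookup σ r) ⊖ lookup σ r′) ÷ (lookup σ r ⊖ lookup σ r′))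
               (List.filter (λ r′ → ¬? (r′ Finₚ.≟ r)) (List.allFin k)))
... | no  _ | no  _       = 0ℚ

max : ∀ {k} → Vec ℕ k → ℕ
max = Vec.foldr′ ℕ._⊔_ 0

I : ℕ → Set
I = Tuple (1 ≤_)

V : ℕ → Module K.commutativeRing 0ℓ 0ℓ
V k = Free.freeModule K.commutativeRing (tuples (1 ≤_) k)

b : ∀ {k} → I k → Module.Carrierᴹ (V k)
b {k} = Free.basis K.commutativeRing (tuples (1 ≤_) k)

-- A(y ∣ σ) = 0 for y > 1 + max σ, so the sum over y ∉ σ stops there.
M : ∀ k → Module.Carrierᴹ (V k) → Module.Carrierᴹ (V (suc k))
M k = linear (V (suc k)) λ σ →
  List.map (λ (y , σy) → constantᴷ (A y (entries σ)) , σy)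
           (extensions (suc (max (entries σ))) (λ 1≤y _ → 1≤y) σ)

D : ∀ k → Module.Carrierᴹ (V (suc k)) → Module.Carrierᴹ (V k)
D k = linear (V k) λ σ →
  let s = Vec.head (entries σ) in
  (K.fraction (e s) (e (pred s)) (e≉0 (pred s)) , rest σ) ∷ []

-- A formal sum Σ_i F(x_{i₁},…,x_{i_k}) b̂_i with F ∈ x₁⋯x_k K[x₁,…,x_k] is given by F,
-- which it determines because any finitely many of the x_c are algebraically
-- independent over K.  The polynomials F are the linear combinations of the
-- monomials with positive exponents: the exponent vector m : Vec ℕ k stands for
-- F = x₁^{m₁+1} ⋯ x_k^{m_k+1}, that is for Σ_i x_{i₁}^{m₁+1} ⋯ x_{i_k}^{m_k+1} b̂_i.

exponentVectors : ℕ → DecSetoid 0ℓ 0ℓ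
exponentVectors k = ≡.decSetoid (Vecₚ.≡-dec {n = k} ℕₚ._≟_)

V̂ : ℕ → Module K.commutativeRing 0ℓ 0ℓ
V̂ k = Free.freeModule K.commutativeRing (exponentVectors k)

b̂ : ∀ {k} → Vec ℕ k → Module.Carrierᴹ (V̂ k)
b̂ {k} = Free.basis K.commutativeRing (exponentVectors k)

-- F ↦ F x_{k+1}
M̂ : ∀ k → Module.Carrierᴹ (V̂ k) → Module.Carrierᴹ (V̂ (suc k))
M̂ k = linear (V̂ (suc k)) λ m → b̂ (m ∷ʳ 0)

-- The coefficient of b̂_j in D̂ (Σ_i F(x_{i₁},…,x_{i_k}) b̂_i) is
--   Σ_{c∉j} F(x_c,x_{j₁},…) = Σ_c F(x_c,x_{j₁},…) - Σ_r F(x_{j_r},x_{j₁},…),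
-- where Σ_c x_c^{a+1} = p_{a+1}.
D̂ : ∀ k → Module.Carrierᴹ (V̂ (suc k)) → Module.Carrierᴹ (V̂ k)
D̂ k = linear (V̂ k) λ am →
  let a = Vec.head am
      m = Vec.tail am
  in (K.embed p[1+ a ] , m) ∷
     List.map (λ r → constantᴷ (ℚ.- 1ℚ) , Vec.updateAt m r (λ mᵣ → mᵣ ℕ.+ suc a)) (List.allFin k)

Family : Set
Family = ∀ k → Module.Carrierᴹ (V k) → Module.Carrierᴹ (V̂ k)

record IsIntertwiner (U : Family) : Set where
  field
    isLinear : ∀ k → IsModuleHomomorphism (Module.rawModule (V k)) (Module.rawModule (V̂ k)) (U k)
    U-∅      : Module._≈ᴹ_ (V̂ 0) (U 0 (b ∅)) (b̂ [])
    U-M      : ∀ k v → Module._≈ᴹ_ (V̂ (suc k)) (U (suc k) (M k v)) (M̂ k (U k v))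
    D̂-U      : ∀ k v → Module._≈ᴹ_ (V̂ k) (D̂ k (U (suc k) v)) (U k (D k v))

-- F ∈ x₁⋯x_k Λ[x₁,…,x_k][e_j⁻¹ : j < n]: the product of the e_j over j ∈ factors
-- times F equals numerator, a polynomial with coefficients in Λ.

record Localised (n : ℕ) {k : ℕ} (F : Module.Carrierᴹ (V̂ k)) : Set where
  field
    factors   : List ℕ
    factors<n : All (_< n) factors
    numerator : List (Λ.Polynomial × Vec ℕ k)
    equation  : Module._≈ᴹ_ (V̂ k)
      (Module._*ₗ_ (V̂ k) (K.embed (Λ.∏ (List.map e factors))) F)
      (List.map (λ (a , m) → K.embed a , m) numerator)

HasDenominators : Family → Set
HasDenominators U = ∀ {k} (σ : I k) → Localised (max (entries σ)) (U k (b σ))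

module FiniteColours (N : ℕ) where
  open FiniteVariables N

  InRange : ℕ → Set
  InRange y = 1 ≤ y × y ≤ N

  Iᴺ : ℕ → Set
  Iᴺ = Tuple InRange

  colours : ∀ {k} → Iᴺ k → List (ℕ × Iᴺ (suc k))
  colours = extensions N _,_

  enumerate : ∀ k → List (Iᴺ k)
  enumerate zero    = ∅ ∷ []
  enumerate (suc k) = List.concatMap (List.map proj₂ ∘ colours) (enumerate k)

  Vᴺ : ℕ → Module field⟨x⟩ 0ℓ 0ℓ
  Vᴺ k = Free.freeModule field⟨x⟩ (tuples InRange k)

  V̂ᴺ : ℕ → Module field⟨x⟩ 0ℓ 0ℓ
  V̂ᴺ k = Free.freeModule field⟨x⟩ (tuples InRange k)

  Mᴺ : ∀ k → Module.Carrierᴹ (Vᴺ k) → Module.Carrierᴹ (Vᴺ (suc k))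
  Mᴺ k = linear (Vᴺ (suc k)) λ σ →
    List.map (λ (y , σy) → constantᶠ (A y (entries σ)) , σy) (colours σ)

  Dᴺ : ∀ k → Module.Carrierᴹ (Vᴺ (suc k)) → Module.Carrierᴹ (Vᴺ k)
  Dᴺ k = linear (Vᴺ k) λ where
    σ@(tuple (s ∷ _) ((_ , s≤N) ∷ _) _) →
      (fraction (ē s) (ē (pred s)) (ē≉0 (ℕₚ.≤-trans ℕₚ.pred[n]≤n s≤N)) , rest σ) ∷ []

  M̂ᴺ : ∀ k → Module.Carrierᴹ (V̂ᴺ k) → Module.Carrierᴹ (V̂ᴺ (suc k))
  M̂ᴺ k = linear (V̂ᴺ (suc k)) λ i → List.map (λ (c , ic) → embed (x c) , ic) (colours i)

  D̂ᴺ : ∀ k → Module.Carrierᴹ (V̂ᴺ (suc k)) → Module.Carrierᴹ (V̂ᴺ k)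
  D̂ᴺ k = linear (V̂ᴺ k) λ i → (embed 1# , rest i) ∷ []

  forget : ∀ {k} → Iᴺ k → I k
  forget (tuple σ ls ds) = tuple σ (Allᵛ.map proj₁ ls) ds

  max≤N : ∀ {k} {σ : Vec ℕ k} → Allᵛ.All InRange σ → max σ ≤ N
  max≤N []               = z≤n
  max≤N ((_ , s≤N) ∷ ls) = ℕₚ.⊔-lub s≤N (max≤N ls)

  -- F(x_{i₁},…,x_{i_k}) with e_j replaced by e_j(x₁,…,x_N)
  specialise : ∀ {k n} {F : Module.Carrierᴹ (V̂ k)} → Localised n F → n ≤ N → Iᴺ k → Fraction
  specialise {k} loc n≤N i = fraction
    (linear {commutativeRing} TensorUnit.⟨module⟩ monomial
       (List.map (λ (a , m) → evaluate a , m) numerator))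
    (∏ (List.map ē factors))
    (∏-≉0 (Allₚ.map⁺ (All.map (λ j<n → ē≉0 (ℕₚ.≤-trans (ℕₚ.<⇒≤ j<n) n≤N)) factors<n)))
    where
    open Localised loc
    monomial : Vec ℕ k → Polynomial
    monomial m = ∏ (List.map (λ r → x (lookup (entries i) r) ^ suc (lookup m r)) (List.allFin k))

  Uᴺ : (U : Family) → HasDenominators U →
       ∀ k → Module.Carrierᴹ (Vᴺ k) → Module.Carrierᴹ (V̂ᴺ k)
  Uᴺ U hasDenominators k = linear (V̂ᴺ k) λ σ →
    List.map (λ i → specialise (hasDenominators (forget σ)) (max≤N (labels σ)) i , i) (enumerate k)

{-# OPTIONS --safe #-}
-- The e_j with j ≤ N survive the passage to N variables, so every U b_σ with max σ ≤ N + 1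
-- specialises to a polynomial Φ_σ, and both intertwining relations can be specialised
-- coefficient by coefficient; for D̂ this uses Newton's identities.  The operator M also
-- creates the colour N + 1, which Mᴺ does not.  These terms vanish: if N + 1 occurs in σ, the
-- relation for D, applied to (s, σ) with s ≤ N missing from σ, expresses e_s/e_{s-1} Φ_σ through
-- the values of Φ_{s,σ} at (k+1)-tuples, and after enough steps there are no tuples of
-- distinct colours left.
--
-- For the invertibility, the image of Uᴺ is stable under M̂ᴺ and D̂ᴺ, and M̂D̂ - D̂M̂ sends
-- b̂_i to x_{i₁} b̂_{i₂,…,i_k,i₁}.  Its k-th power is the diagonal operator x_{i₁}⋯x_{i_k}, which
-- separates the terms of M̂ b̂_i = Σ_c x_c b̂_{i,c} (Vandermonde).  By induction on k the image
-- contains every b̂_i, and a surjective square system over a field is injective.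

module Submission where

open import Defs
open import Algebra.Bundles using (CommutativeRing)
open import Algebra.Module.Bundles using (Module)
import Algebra.Module.Construct.TensorUnit as TensorUnit
open import Algebra.Module.Morphism.Structures using (IsModuleHomomorphism)
import Algebra.Properties.Group as GroupProperties
import Algebra.Properties.Ring as RingProperties
import Algebra.Properties.Semiring.Exp as SemiringExp
import Algebra.Properties.Semiring.Sum as SemiringSum
import Algebra.Solver.Ring.NaturalCoefficients.Default as NaturalCoefficientsSolver
open import Data.Bool.Base using (if_then_else_)
open import Data.Fin.Base as Fin using (Fin; zero; suc; toℕ)
import Data.Fin.Properties as Finₚ
import Data.Integer.Base as ℤ
import Data.Integer.Properties as ℤₚ
open import Data.List.Base as List using (List; []; _∷_; _++_)
open import Data.List.Membership.Propositional.Properties using (∈-lookup)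
import Data.List.Properties as Listₚ
open import Data.List.Relation.Binary.Pointwise as Pointwise using (Pointwise; []; _∷_)
open import Data.List.Relation.Unary.All as All using (All; []; _∷_)
import Data.List.Relation.Unary.All.Properties as Allₚ
open import Data.List.Relation.Unary.AllPairs as AllPairs using (AllPairs; []; _∷_)
import Data.List.Relation.Unary.AllPairs.Properties as AllPairsₚ
open import Data.List.Relation.Unary.Any as Any using (Any; here; there)
open import Data.Maybe.Base using (Maybe; nothing; just; maybe)
import Data.Maybe.Relation.Unary.All as MaybeAll
open import Data.Nat.Base as ℕ using (ℕ; zero; suc; s≤s; z≤n; _≤_; _<_)
import Data.Nat.Properties as ℕₚ
open import Data.Product.Base using (_×_; _,_; ∃; proj₁; proj₂; ∃₂)
open import Data.Rational.Base as ℚ using (ℚ; 0ℚ; 1ℚ)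
import Data.Rational.Properties as ℚₚ
import Data.Rational.Unnormalised.Base as ℚᵘ
import Data.Rational.Unnormalised.Properties as ℚᵘₚ
open import Data.Vec.Base as Vec using (Vec; []; _∷_; _∷ʳ_; lookup)
open import Data.Vec.Membership.DecPropositional ℕₚ._≟_ using (_∈?_)
open import Data.Vec.Membership.Propositional using (_∈_; _∉_)
import Data.Vec.Properties as Vecₚ
open import Data.Vec.Relation.Unary.All as Allᵛ using ([]; _∷_)
import Data.Vec.Relation.Unary.All.Properties as Allᵛₚ
open import Data.Vec.Relation.Unary.AllPairs using (allPairs?)
open import Data.Vec.Relation.Unary.AllPairs.Core using ([]; _∷_)
import Data.Vec.Relation.Unary.Any as Anyᵛ
open import Data.Vec.Relation.Unary.Any using (here; there)
import Data.Vec.Relation.Unary.Any.Properties as Anyᵛₚ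
open import Data.Vec.Relation.Unary.Unique.Propositional using (Unique)
open import Data.Vec.Relation.Unary.Unique.Propositional.Properties using (lookup-injective)
open import Function.Base using (_∘_; id)
open import Level using (0ℓ)
open import Relation.Binary.Bundles using (DecSetoid)
open import Relation.Binary.PropositionalEquality as ≡ using (_≡_; _≢_)
import Relation.Binary.Reasoning.Setoid as SetoidReasoning
open import Relation.Nullary using (¬_; Dec; yes; no; contradiction; does; ¬?; _×-dec_)
open import Relation.Nullary.Decidable using (decidable-stable)

-- Setting x_c = 0 for c > N sends e_j to 0 when j > N, so it defines no map from K = ℚ(e₁,e₂,...)
-- to the rational functions in N variables. It is replaced by a relation between fractions that
-- carries a representative whose denominator survives. This relation is functional and compatible
-- with sums and products, so an identity over K passes to N variables once both of its sides are
-- related to something. The bound N + 1 on max σ meets two demands: the denominators e_j with j <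
-- max σ survive, and the tuples that M creates from colours in [N] are included.
--
-- In N variables, a polynomial Φ_σ enters only through its values at tuples of distinct colours,
-- which are the coefficients of the image of b_σ. The vanishing for tuples with the colour N + 1
-- concerns these values and not the polynomial: for N = 0 and σ = (1), Φ_σ is the nonzero
-- polynomial x₁ in one indeterminate, but there is no colour at which to evaluate it.

-- Iverson brackets and finite sums

module ListSums (R : CommutativeRing 0ℓ 0ℓ) where
  open CommutativeRing R hiding (zero)
  open SemiringSum semiring public
    using (sum; sum-cong-≋; ∑-distrib-+; *-distribˡ-sum; sum-replicate-zero; sum-remove)

  abstract
    -- The Iverson bracket of P. It is abstract so that it does not unfold to the decision
    -- procedure; outside this block it is handled through `⟦⟧-yes` and `⟦⟧-no`.
    ⟦_⟧ : {P : Set} → Dec P → Carrier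
    ⟦ P? ⟧ = if does P? then 1# else 0#

    ⟦⟧-yes : {P : Set} (P? : Dec P) → P → ⟦ P? ⟧ ≈ 1#
    ⟦⟧-yes (yes _) _ = refl
    ⟦⟧-yes (no ¬p) p = contradiction p ¬p

    ⟦⟧-no : {P : Set} (P? : Dec P) → ¬ P → ⟦ P? ⟧ ≈ 0#
    ⟦⟧-no (yes p) ¬p = contradiction p ¬p
    ⟦⟧-no (no _)  _  = refl

  ⟦⟧-× : {P Q S : Set} (P? : Dec P) (Q? : Dec Q) (S? : Dec S) →
         (P → Q × S) → (Q → S → P) → ⟦ P? ⟧ ≈ ⟦ Q? ⟧ * ⟦ S? ⟧
  ⟦⟧-× P? Q?@(no ¬q) S?      f g =
    trans (⟦⟧-no P? (¬q ∘ proj₁ ∘ f)) (sym (trans (*-congʳ (⟦⟧-no Q? ¬q)) (zeroˡ _)))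
  ⟦⟧-× P? (yes q) S?@(no ¬s) f g =
    trans (⟦⟧-no P? (¬s ∘ proj₂ ∘ f)) (sym (trans (*-congˡ (⟦⟧-no S? ¬s)) (zeroʳ _)))
  ⟦⟧-× P? Q?@(yes q) S?@(yes s) f g = trans (⟦⟧-yes P? (g q s))
    (sym (trans (*-cong (⟦⟧-yes Q? q) (⟦⟧-yes S? s)) (*-identityʳ 1#)))

  ⟦⟧-split : {P : Set} (P? : Dec P) → ∀ a → a ≈ ⟦ ¬? P? ⟧ * a + a * ⟦ P? ⟧
  ⟦⟧-split P?@(yes p) a = sym (trans
    (+-cong (trans (*-congʳ (⟦⟧-no (¬? P?) (λ ¬p → ¬p p))) (zeroˡ _))
            (trans (*-congˡ (⟦⟧-yes P? p)) (*-identityʳ _))) (+-identityˡ _))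
  ⟦⟧-split P?@(no ¬p) a = sym (trans
    (+-cong (trans (*-congʳ (⟦⟧-yes (¬? P?) ¬p)) (*-identityˡ _))
            (trans (*-congˡ (⟦⟧-no P? ¬p)) (zeroʳ _))) (+-identityʳ _))

  ⟦⟧-cong : {P Q : Set} (P? : Dec P) (Q? : Dec Q) → (P → Q) → (Q → P) → ⟦ P? ⟧ ≈ ⟦ Q? ⟧
  ⟦⟧-cong P?@(yes p) Q? f g = trans (⟦⟧-yes P? p) (sym (⟦⟧-yes Q? (f p)))
  ⟦⟧-cong P?@(no ¬p) Q? f g = trans (⟦⟧-no P? ¬p) (sym (⟦⟧-no Q? (¬p ∘ g)))

  listSum : {C : Set} → (C → Carrier) → List C → Carrier
  listSum f []       = 0#
  listSum f (c ∷ cs) = f c + listSum f cs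

  listSum-cong : {C : Set} {f g : C → Carrier} → (∀ c → f c ≈ g c) →
                 ∀ cs → listSum f cs ≈ listSum g cs
  listSum-cong e []       = refl
  listSum-cong e (c ∷ cs) = +-cong (e c) (listSum-cong e cs)

  listSum-++ : {C : Set} (f : C → Carrier) (cs ds : List C) →
               listSum f (cs ++ ds) ≈ listSum f cs + listSum f ds
  listSum-++ f []       ds = sym (+-identityˡ _)
  listSum-++ f (c ∷ cs) ds = trans (+-congˡ (listSum-++ f cs ds)) (sym (+-assoc _ _ _))

  listSum-*ˡ : {C : Set} (a : Carrier) (f : C → Carrier) (cs : List C) →
               listSum (λ c → a * f c) cs ≈ a * listSum f cs
  listSum-*ˡ a f []       = sym (zeroʳ a)
  listSum-*ˡ a f (c ∷ cs) = trans (+-congˡ (listSum-*ˡ a f cs)) (sym (distribˡ _ _ _))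

  listSum-map : {C D : Set} (f : D → Carrier) (g : C → D) (cs : List C) →
                listSum f (List.map g cs) ≡ listSum (f ∘ g) cs
  listSum-map f g []       = ≡.refl
  listSum-map f g (c ∷ cs) = ≡.cong (f (g c) +_) (listSum-map f g cs)

  listSum-concatMap : {C D : Set} (f : D → Carrier) (g : C → List D) (cs : List C) →
                      listSum f (List.concatMap g cs) ≈ listSum (listSum f ∘ g) cs
  listSum-concatMap f g []       = refl
  listSum-concatMap f g (c ∷ cs) =
    trans (listSum-++ f (g c) (List.concatMap g cs)) (+-congˡ (listSum-concatMap f g cs))

  listSum-mapMaybe : {C D : Set} (f : D → Carrier) (g : C → Maybe D) (cs : List C) →
                     listSum f (List.mapMaybe g cs) ≈ listSum (maybe f 0# ∘ g) cs
  listSum-mapMaybe f g []       = refl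
  listSum-mapMaybe f g (c ∷ cs) with g c
  ... | just d  = +-congˡ (listSum-mapMaybe f g cs)
  ... | nothing = trans (listSum-mapMaybe f g cs) (sym (+-identityˡ _))

  listSum-tabulate : {C : Set} (f : C → Carrier) {n : ℕ} (g : Fin n → C) →
                     listSum f (List.tabulate g) ≡ sum (f ∘ g)
  listSum-tabulate f {zero}  g = ≡.refl
  listSum-tabulate f {suc n} g = ≡.cong (f (g zero) +_) (listSum-tabulate f (g ∘ suc))

  sum-zero : ∀ {n} {f : Fin n → Carrier} → (∀ i → f i ≈ 0#) → sum f ≈ 0#
  sum-zero {n} e = trans (sum-cong-≋ e) (sum-replicate-zero n)

  sum-single : ∀ {n} (f : Fin n → Carrier) (i : Fin n) →
               (∀ j → j ≢ i → f j ≈ 0#) → sum f ≈ f i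
  sum-single f zero e =
    trans (+-congˡ (sum-zero (λ j → e (suc j) λ ()))) (+-identityʳ _)
  sum-single f (suc i) e = trans
    (+-cong (e zero λ ()) (sum-single (f ∘ suc) i (λ j j≢i →
        e (suc j) (j≢i ∘ Finₚ.suc-injective))))
    (+-identityˡ _)

  -- Serves to compare `M`, which sums over colours up to 1 + max σ, with `Mᴺ`, which sums over
  -- colours up to N.
  sum-extend : ∀ {m n} (f : ℕ → Carrier) → m ℕ.≤ n → (∀ d → m ℕ.≤ d → d ℕ.< n → f d ≈ 0#) →
               sum {n} (f ∘ toℕ) ≈ sum {m} (f ∘ toℕ)
  sum-extend f z≤n       e = sum-zero (λ i → e (toℕ i) z≤n (Finₚ.toℕ<n i))
  sum-extend f (s≤s m≤n) e =
    +-congˡ (sum-extend (f ∘ suc) m≤n (λ d m≤d d<n → e (suc d) (s≤s m≤d) (s≤s d<n)))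

  sum-⟦⟧ : ∀ {n} (i : Fin n) (f : Fin n → Carrier) {P : Fin n → Set} (P? : ∀ j → Dec (P j)) →
           P i → (∀ j → P j → j ≡ i) → sum (λ j → f j * ⟦ P? j ⟧) ≈ f i
  sum-⟦⟧ i f P? p only = trans
    (sum-single _ i λ j j≢i → trans (*-congˡ (⟦⟧-no (P? j) (j≢i ∘ only j))) (zeroʳ _))
    (trans (*-congˡ (⟦⟧-yes (P? i) p)) (*-identityʳ _))

-- Linear functionals and linear maps on free modules

module FreeProperties (R : CommutativeRing 0ℓ 0ℓ) (B : DecSetoid 0ℓ 0ℓ) where
  open CommutativeRing R hiding (zero)
  open DecSetoid B using () renaming
    ( Carrier to Basis; _≈_ to _∼_; _≟_ to _∼?_
    ; sym to ∼-sym; trans to ∼-trans )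
  open Free R B public
  open ListSums R

  -- The linear functional with given values on the basis. Both the coefficient of a vector (`_at_`)
  -- and the value of a polynomial at a tuple of colours (`evalAt`) have this form, so one set of
  -- lemmas covers both.
  pairing : (Basis → Carrier) → Combination → Carrier
  pairing = linear {R} TensorUnit.⟨module⟩

  private module P = LinearProperties {R} {B} TensorUnit.⟨module⟩

  pairing-ext : ∀ {f g} → (∀ b → f b ≈ g b) → ∀ p → pairing f p ≈ pairing g p
  pairing-ext = P.linear-ext

  pairing-++ : ∀ f p q → pairing f (p ++ q) ≈ pairing f p + pairing f q
  pairing-++ = P.linear-++

  pairing-scale : ∀ f a p → pairing f (scale a p) ≈ a * pairing f p
  pairing-scale = P.linear-scale

  pairing-basis : ∀ f b → pairing f (basis b) ≈ f b
  pairing-basis = P.linear-basis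

  pairing-* : ∀ a f p → pairing (λ b → a * f b) p ≈ a * pairing f p
  pairing-* = P.linear-*

  pairing-+ : ∀ f g p → pairing (λ b → f b + g b) p ≈ pairing f p + pairing g p
  pairing-+ = P.linear-+

  pairing-0 : ∀ p → pairing (λ _ → 0#) p ≈ 0#
  pairing-0 = P.linear-0

  pairing-cong : ∀ {f} → (∀ {b c} → b ∼ c → f b ≈ f c) → ∀ {p q} → p ≋ q →
                 pairing f p ≈ pairing f q
  pairing-cong f-cong = P.linear-cong f-cong

  pairing-sum : ∀ {n} (f : Fin n → Basis → Carrier) p →
                pairing (λ b → sum (λ i → f i b)) p ≈ sum (λ i → pairing (f i) p)
  pairing-sum {zero}  f p = pairing-0 p
  pairing-sum {suc n} f p = trans (pairing-+ _ _ p) (+-congˡ (pairing-sum (f ∘ suc) p))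

  pairing-map : {C : Set} (f : Basis → Carrier) (w : C → Carrier) (g : C → Basis) (cs : List C) →
                pairing f (List.map (λ c → w c , g c) cs) ≡ listSum (λ c → w c * f (g c)) cs
  pairing-map f w g []       = ≡.refl
  pairing-map f w g (c ∷ cs) = ≡.cong (w c * f (g c) +_) (pairing-map f w g cs)

  coefficient-pairing : ∀ p c → coefficient p c ≈ pairing (λ b → ⟦ b ∼? c ⟧) p
  coefficient-pairing []            c = refl
  coefficient-pairing ((a , b) ∷ p) c with b ∼? c
  ... | yes b∼c = +-cong (sym (trans (*-congˡ (⟦⟧-yes (yes b∼c) b∼c)) (*-identityʳ a)))
                         (coefficient-pairing p c)
  ... | no  b≁c = trans (coefficient-pairing p c) (trans (sym (+-identityˡ _))
                    (+-congʳ (sym (trans (*-congˡ (⟦⟧-no (no b≁c) b≁c)) (zeroʳ a)))))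

  scale-basis : ∀ a b → scale a (basis b) ≋ (a , b) ∷ []
  scale-basis a b = mk≋ helper
    where
    helper : ∀ c → coefficient (scale a (basis b)) c ≈ coefficient ((a , b) ∷ []) c
    helper c with b ∼? c
    ... | yes _ = +-congʳ (*-identityʳ a)
    ... | no  _ = refl

  basis-cong : ∀ {b c} → b ∼ c → basis b ≋ basis c
  basis-cong {b} {c} b∼c = mk≋ helper
    where
    helper : ∀ d → coefficient (basis b) d ≈ coefficient (basis c) d
    helper d with b ∼? d | c ∼? d
    ... | yes _   | yes _   = refl
    ... | no  _   | no  _   = refl
    ... | yes b∼d | no  c≁d = contradiction (∼-trans (∼-sym b∼c) b∼d) c≁d
    ... | no  b≁d | yes c∼d = contradiction (∼-trans b∼c c∼d) b≁d

  module _ (W : Module R 0ℓ 0ℓ) {U : Combination → Module.Carrierᴹ W}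
           (U-hom : IsModuleHomomorphism (Module.rawModule freeModule) (Module.rawModule W) U)
               where
    open Module W using (_≈ᴹ_; _+ᴹ_; _*ₗ_; ≈ᴹ-refl; ≈ᴹ-trans; ≈ᴹ-sym; +ᴹ-cong)
    open IsModuleHomomorphism U-hom

    homomorphism-linear : ∀ p → U p ≈ᴹ linear W (U ∘ basis) p
    homomorphism-linear []            = 0ᴹ-homo
    homomorphism-linear ((a , b) ∷ p) = ≈ᴹ-trans
      (+ᴹ-homo ((a , b) ∷ []) p)
      (+ᴹ-cong (≈ᴹ-trans (U-cong (Module.≈ᴹ-sym freeModule (scale-basis a b)))
          (*ₗ-homo a (basis b)))
               (homomorphism-linear p))
      where
      U-cong : ∀ {p q} → p ≋ q → U p ≈ᴹ U q
      U-cong = IsModuleHomomorphism.⟦⟧-cong U-hom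

  linear-homomorphism : (W : Module R 0ℓ 0ℓ) {f : Basis → Module.Carrierᴹ W} →
    (∀ {b c} → b ∼ c → Module._≈ᴹ_ W (f b) (f c)) →
    IsModuleHomomorphism (Module.rawModule freeModule) (Module.rawModule W) (linear W f)
  linear-homomorphism W {f} f-cong = record
    { isBimoduleHomomorphism = record
      { +ᴹ-isGroupHomomorphism = record
        { isMonoidHomomorphism = record
          { isMagmaHomomorphism = record
            { isRelHomomorphism = record { cong = linear-cong f-cong }
            ; homo = linear-++ f
            }
          ; ε-homo = ≈ᴹ-refl
          }
        ; ⁻¹-homo = negated
        }
      ; *ₗ-homo = linear-scale f
      ; *ᵣ-homo = λ a p → ≈ᴹ-trans (linear-scale f a p) *ₗ-*ᵣ-coincident′
      }
    }
    where
    open LinearProperties {R} {B} W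
    open Module W
    *ₗ-*ᵣ-coincident′ : ∀ {a w} → a *ₗ w ≈ᴹ w *ᵣ a
    *ₗ-*ᵣ-coincident′ = *ₗ-*ᵣ-coincident _ _
    cancel : ∀ {u v} → u +ᴹ v ≈ᴹ 0ᴹ → u ≈ᴹ -ᴹ v
    cancel {u} {v} e = ≈ᴹ-trans (≈ᴹ-sym (+ᴹ-identityʳ u))
      (≈ᴹ-trans (+ᴹ-congˡ (≈ᴹ-sym (-ᴹ‿inverseʳ v)))
      (≈ᴹ-trans (≈ᴹ-sym (+ᴹ-assoc u v _))
      (≈ᴹ-trans (+ᴹ-congʳ e) (+ᴹ-identityˡ _))))
    negated : ∀ p → linear W f (negate p) ≈ᴹ -ᴹ linear W f p
    negated p = cancel (≈ᴹ-trans (≈ᴹ-sym (linear-++ f (negate p) p))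
      (linear-cong f-cong (proj₁ (Module.-ᴹ‿inverse freeModule) p)))

-- Linear dependence over a field, and inverses of linear bijections

record IsDiscreteField (R : CommutativeRing 0ℓ 0ℓ) : Set where
  open CommutativeRing R hiding (zero)
  field
    1≉0     : ¬ 1# ≈ 0#
    _≟0     : ∀ a → Dec (a ≈ 0#)
    inverse : ∀ a → ¬ a ≈ 0# → ∃ λ b → b * a ≈ 1#

  *-cancel-0 : ∀ {a b} → ¬ a ≈ 0# → a * b ≈ 0# → b ≈ 0#
  *-cancel-0 {a} {b} a≉0 ab≈0 =
    let a⁻¹ , a⁻¹a≈1 = inverse a a≉0 in
    trans (sym (*-identityˡ b)) (trans (*-congʳ (sym a⁻¹a≈1))
      (trans (*-assoc a⁻¹ a b) (trans (*-congˡ ab≈0) (zeroʳ a⁻¹))))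

module LinearDependence (R : CommutativeRing 0ℓ 0ℓ) (R-field : IsDiscreteField R) where
  open CommutativeRing R hiding (zero)
  open IsDiscreteField R-field
  open ListSums R
  open SetoidReasoning setoid
  open RingProperties ring using (-‿distribˡ-*; -‿distribʳ-*)

  -- Gaussian elimination on the rows of a; decidability of zero is what allows the search for a
  -- pivot. If the first column vanishes, row 0 gets coefficient 0 and the induction hypothesis
  -- applies to the other rows. Otherwise the pivot row clears the first column of the other rows,
  -- and a dependence of the reduced rows is lifted back.
  dependence : ∀ n (a : Fin (suc n) → Fin n → Carrier) →
               ∃ λ (c : Fin (suc n) → Carrier) →
                 (∃ λ i → ¬ c i ≈ 0#) × (∀ j → sum (λ i → c i * a i j) ≈ 0#)
  dependence zero    a = (λ _ → 1#) , (zero , 1≉0) , λ ()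
  dependence (suc n) a with Finₚ.any? (λ i → ¬? (a i zero ≟0))
  ... | no  column≈0 =
    let c , (i , cᵢ≉0) , e = dependence n (λ i j → a (suc i) (suc j))
        extended : Fin (suc (suc n)) → Carrier
        extended = λ { zero → 0# ; (suc i) → c i }
        vanishes : ∀ i → a i zero ≈ 0#
        vanishes i = decidable-stable (a i zero ≟0) λ aᵢ≉0 → column≈0 (i , aᵢ≉0)
    in extended , (suc i , cᵢ≉0) , λ
      { zero    → sum-zero {f = λ i → extended i * a i zero}
                    (λ i → trans (*-congˡ {extended i} (vanishes i)) (zeroʳ _))
      ; (suc j) → trans (+-cong (zeroˡ _) (e j)) (+-identityˡ 0#) }
  ... | yes (p , pivot≉0) = eliminated
    where
    pivot⁻¹ = proj₁ (inverse (a p zero) pivot≉0)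
    r : Fin (suc n) → Carrier
    r i = a (Fin.punchIn p i) zero * pivot⁻¹
    reduced : Fin (suc n) → Fin n → Carrier
    reduced i j = a (Fin.punchIn p i) (suc j) + - (r i * a p (suc j))
    ih = dependence n reduced
    c = proj₁ ih
    -- The coefficient of the pivot row makes up for the multiples `r i` of it that were subtracted
    -- from the other rows.
    c₀ : Carrier
    c₀ = - sum (λ i → c i * r i)
    extended : Fin (suc (suc n)) → Carrier
    extended i with i Finₚ.≟ p
    ... | yes _   = c₀
    ... | no  i≢p = c (Fin.punchOut (i≢p ∘ ≡.sym))
    extended-p : extended p ≡ c₀
    extended-p with p Finₚ.≟ p
    ... | yes _  = ≡.refl
    ... | no p≢p = contradiction ≡.refl p≢p
    extended-punchIn : ∀ i → extended (Fin.punchIn p i) ≡ c i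
    extended-punchIn i with Fin.punchIn p i Finₚ.≟ p
    ... | yes e = contradiction e (Finₚ.punchInᵢ≢i p i)
    ... | no  ≢p = ≡.cong c (≡.trans (Finₚ.punchOut-cong p ≡.refl) (Finₚ.punchOut-punchIn p))
    split : ∀ j → sum (λ i → extended i * a i j) ≈
                  c₀ * a p j + sum (λ i → c i * a (Fin.punchIn p i) j)
    split j = trans (sum-remove {i = p} (λ i → extended i * a i j))
      (+-cong (*-congʳ (reflexive extended-p))
              (sum-cong-≋ {x = λ i → extended (Fin.punchIn p i) * a (Fin.punchIn p i) j}
                {y = λ i → c i * a (Fin.punchIn p i) j}
                (λ i → *-congʳ {a (Fin.punchIn p i) j} (reflexive (extended-punchIn i)))))
    total : ∀ j → sum (λ i → extended i * a i j) ≈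
                  sum (λ i → c i * (a (Fin.punchIn p i) j + - (r i * a p j)))
    total j = begin
      sum (λ i → extended i * a i j)
        ≈⟨ split j ⟩
      c₀ * a p j + sum (λ i → c i * a (Fin.punchIn p i) j)
        ≈⟨ +-congʳ (-‿distribˡ-* _ _) ⟨
      - (sum (λ i → c i * r i) * a p j) + sum (λ i → c i * a (Fin.punchIn p i) j)
        ≈⟨ +-congʳ (-‿distribʳ-* _ _) ⟩
      sum (λ i → c i * r i) * (- a p j) + sum (λ i → c i * a (Fin.punchIn p i) j)
        ≈⟨ +-congʳ (*-comm _ _) ⟩
      (- a p j) * sum (λ i → c i * r i) + sum (λ i → c i * a (Fin.punchIn p i) j)
        ≈⟨ +-congʳ (*-distribˡ-sum (- a p j) (λ i → c i * r i)) ⟩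
      sum (λ i → (- a p j) * (c i * r i)) + sum (λ i → c i * a (Fin.punchIn p i) j)
        ≈⟨ ∑-distrib-+ (λ i → (- a p j) * (c i * r i)) (λ i → c i * a (Fin.punchIn p i) j) ⟨
      sum (λ i → (- a p j) * (c i * r i) + c i * a (Fin.punchIn p i) j)
        ≈⟨ sum-cong-≋ term ⟩
      sum (λ i → c i * (a (Fin.punchIn p i) j + - (r i * a p j))) ∎
      where
      term : ∀ i → (- a p j) * (c i * r i) + c i * a (Fin.punchIn p i) j ≈
                   c i * (a (Fin.punchIn p i) j + - (r i * a p j))
      term i = begin
        (- a p j) * (c i * r i) + c i * a (Fin.punchIn p i) j
          ≈⟨ +-comm _ _ ⟩
        c i * a (Fin.punchIn p i) j + (- a p j) * (c i * r i)
          ≈⟨ +-congˡ (trans (*-comm _ _) (*-assoc (c i) (r i) _)) ⟩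
        c i * a (Fin.punchIn p i) j + c i * (r i * (- a p j))
          ≈⟨ +-congˡ (*-congˡ (-‿distribʳ-* (r i) (a p j))) ⟨
        c i * a (Fin.punchIn p i) j + c i * - (r i * a p j)
          ≈⟨ distribˡ (c i) _ _ ⟨
        c i * (a (Fin.punchIn p i) j + - (r i * a p j)) ∎
    pivot-column : ∀ i → a (Fin.punchIn p i) zero + - (r i * a p zero) ≈ 0#
    pivot-column i = trans
      (+-congˡ (-‿cong (trans (*-assoc _ _ _)
        (trans (*-congˡ (proj₂ (inverse (a p zero) pivot≉0))) (*-identityʳ _)))))
      (-‿inverseʳ _)
    eliminated : ∃ λ (c : Fin (suc (suc n)) → Carrier) →
                 (∃ λ i → ¬ c i ≈ 0#) × (∀ j → sum (λ i → c i * a i j) ≈ 0#)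
    eliminated = extended
      , (Fin.punchIn p (proj₁ (proj₁ (proj₂ ih)))
        , λ e → proj₂ (proj₁ (proj₂ ih)) (trans (sym (reflexive (extended-punchIn _))) e))
      , λ { zero    → trans (total zero)
                        (sum-zero {f = λ i → c i * (a (Fin.punchIn p i) zero + -
                            (r i * a p zero))}
                          (λ i → trans (*-congˡ {c i} (pivot-column i)) (zeroʳ _)))
          ; (suc j) → trans (total (suc j)) (proj₂ (proj₂ ih) j) }

-- The preimages are chosen without any compatibility between them. Injectivity, which follows from
-- the trivial kernel, forces the choice to respect equality and to be linear.
bijective⇒invertible : {R : CommutativeRing 0ℓ 0ℓ} (V W : Module R 0ℓ 0ℓ) {f : Module.Carrierᴹ V →
    Module.Carrierᴹ W} →
  IsModuleHomomorphism (Module.rawModule V) (Module.rawModule W) f →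
  (∀ v → Module._≈ᴹ_ W (f v) (Module.0ᴹ W) → Module._≈ᴹ_ V v (Module.0ᴹ V)) →
  (∀ w → ∃ λ v → Module._≈ᴹ_ W (f v) w) →
  Invertible V W f
bijective⇒invertible {R} V W {f} f-hom kernel preimage = f-hom , g , g-hom , left , right
  where
  module V = Module V
  module W = Module W
  open IsModuleHomomorphism f-hom

  injective : ∀ {u v} → f u W.≈ᴹ f v → u V.≈ᴹ v
  injective {u} {v} fu≈fv = Group.x∙y⁻¹≈ε⇒x≈y u v (kernel (u V.+ᴹ V.-ᴹ v)
    (W.≈ᴹ-trans (+ᴹ-homo u (V.-ᴹ v)) (W.≈ᴹ-trans (W.+ᴹ-cong fu≈fv (-ᴹ-homo v))
        (W.-ᴹ‿inverseʳ (f v)))))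
    where module Group = GroupProperties V.+ᴹ-group

  g : W.Carrierᴹ → V.Carrierᴹ
  g w = proj₁ (preimage w)

  fg : ∀ w → f (g w) W.≈ᴹ w
  fg w = proj₂ (preimage w)

  g-hom : IsModuleHomomorphism W.rawModule V.rawModule g
  g-hom = record
    { isBimoduleHomomorphism = record
      { +ᴹ-isGroupHomomorphism = record
        { isMonoidHomomorphism = record
          { isMagmaHomomorphism = record
            { isRelHomomorphism = record
              { cong = λ {w} {w′} w≈w′ →
                  injective (W.≈ᴹ-trans (fg w) (W.≈ᴹ-trans w≈w′ (W.≈ᴹ-sym (fg w′)))) }
            ; homo = λ w w′ → injective (W.≈ᴹ-trans (fg (w W.+ᴹ w′)) (W.≈ᴹ-sym
                (W.≈ᴹ-trans (+ᴹ-homo (g w) (g w′)) (W.+ᴹ-cong (fg w) (fg w′)))))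
            }
          ; ε-homo = injective (W.≈ᴹ-trans (fg W.0ᴹ) (W.≈ᴹ-sym 0ᴹ-homo))
          }
        ; ⁻¹-homo = λ w → injective (W.≈ᴹ-trans (fg (W.-ᴹ w)) (W.≈ᴹ-sym
            (W.≈ᴹ-trans (-ᴹ-homo (g w)) (W.-ᴹ‿cong (fg w)))))
        }
      ; *ₗ-homo = λ a w → injective (W.≈ᴹ-trans (fg (a W.*ₗ w)) (W.≈ᴹ-sym
          (W.≈ᴹ-trans (*ₗ-homo a (g w)) (W.*ₗ-congˡ (fg w)))))
      ; *ᵣ-homo = λ a w → injective (W.≈ᴹ-trans (fg (w W.*ᵣ a)) (W.≈ᴹ-sym
          (W.≈ᴹ-trans (*ᵣ-homo a (g w)) (W.*ᵣ-congʳ (fg w)))))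
      }
    }

  left : ∀ {w v} → v V.≈ᴹ g w → f v W.≈ᴹ w
  left {w} v≈gw = W.≈ᴹ-trans (IsModuleHomomorphism.⟦⟧-cong f-hom v≈gw) (fg w)

  right : ∀ {v w} → w W.≈ᴹ f v → g w V.≈ᴹ v
  right {v} {w} w≈fv = injective (W.≈ᴹ-trans (fg w) w≈fv)

-- Separating eigencomponents inside a submodule

record Submodule {R : CommutativeRing 0ℓ 0ℓ} (W : Module R 0ℓ 0ℓ) : Set₁ where
  open Module W
  field
    _∈      : Carrierᴹ → Set
    ∈-resp  : ∀ {u v} → u ≈ᴹ v → u ∈ → v ∈
    ∈-+     : ∀ {u v} → u ∈ → v ∈ → (u +ᴹ v) ∈
    ∈-*     : ∀ a {u} → u ∈ → (a *ₗ u) ∈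
    ∈-0     : 0ᴹ ∈

module Vandermonde (R : CommutativeRing 0ℓ 0ℓ) (R-field : IsDiscreteField R)
                   {W : Module R 0ℓ 0ℓ} (S : Submodule W) where
  open CommutativeRing R hiding (zero)
  open IsDiscreteField R-field
  open Module W
  open Submodule S

  open SetoidReasoning ≈ᴹ-setoid

  open SemiringExp semiring using (_^_)

  moment : ℕ → List (Carrier × Carrierᴹ) → Carrierᴹ
  moment m []            = 0ᴹ
  moment m ((y , w) ∷ l) = (y ^ m) *ₗ w +ᴹ moment m l

  moment-∈ : ∀ m {l} → All (λ (_ , w) → w ∈) l → moment m l ∈
  moment-∈ m []         = ∈-0
  moment-∈ m (w∈ ∷ ws∈) = ∈-+ (∈-* _ w∈) (moment-∈ m ws∈)

  +ᴹ-interchange : ∀ x y z w → (x +ᴹ y) +ᴹ (z +ᴹ w) ≈ᴹ (x +ᴹ z) +ᴹ (y +ᴹ w)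
  +ᴹ-interchange = LinearProperties.interchange {R} {≡.decSetoid ℕₚ._≟_} W

  *ₗ-cancelˡ-∈ : ∀ {a u} → ¬ a ≈ 0# → (a *ₗ u) ∈ → u ∈
  *ₗ-cancelˡ-∈ {a} {u} a≉0 au∈ =
    let a⁻¹ , a⁻¹a≈1 = inverse a a≉0 in
    ∈-resp (≈ᴹ-trans (≈ᴹ-sym (*ₗ-assoc a⁻¹ a u)) (≈ᴹ-trans (*ₗ-congʳ a⁻¹a≈1) (*ₗ-identityˡ u)))
           (∈-* a⁻¹ au∈)

  +ᴹ-cancelʳ-∈ : ∀ {u v} → (u +ᴹ v) ∈ → v ∈ → u ∈
  +ᴹ-cancelʳ-∈ {u} {v} uv∈ v∈ = ∈-resp cancel (∈-+ uv∈ (∈-* (- 1#) v∈))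
    where
    cancel : (u +ᴹ v) +ᴹ (- 1#) *ₗ v ≈ᴹ u
    cancel = begin
      (u +ᴹ v) +ᴹ (- 1#) *ₗ v         ≈⟨ +ᴹ-assoc u v _ ⟩
      u +ᴹ (v +ᴹ (- 1#) *ₗ v)         ≈⟨ +ᴹ-congˡ (+ᴹ-congʳ (*ₗ-identityˡ v)) ⟨
      u +ᴹ (1# *ₗ v +ᴹ (- 1#) *ₗ v)   ≈⟨ +ᴹ-congˡ (*ₗ-distribʳ v 1# (- 1#)) ⟨
      u +ᴹ (1# + - 1#) *ₗ v           ≈⟨ +ᴹ-congˡ (*ₗ-congʳ (-‿inverseʳ 1#)) ⟩
      u +ᴹ 0# *ₗ v                    ≈⟨ +ᴹ-congˡ (*ₗ-zeroˡ v) ⟩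
      u +ᴹ 0ᴹ                         ≈⟨ +ᴹ-identityʳ u ⟩
      u                               ∎

  private
    -- Moment m + 1 minus y times moment m kills a component with eigenvalue y and multiplies one
    -- with eigenvalue z by z - y. The result is the m-th moment of these new components.
    differences : Carrier → List (Carrier × Carrierᴹ) → List (Carrier × Carrierᴹ)
    differences y = List.map (λ (z , v) → z , (z + - y) *ₗ v)

    moment-differences : ∀ m y l → moment m (differences y l) +ᴹ y *ₗ moment m l ≈ᴹ moment (suc m)
        l
    moment-differences m y []            = ≈ᴹ-trans (+ᴹ-identityˡ _) (*ₗ-zeroʳ y)
    moment-differences m y ((z , v) ∷ l) = begin
      ((z ^ m) *ₗ ((z + - y) *ₗ v) +ᴹ moment m (differences y l)) +ᴹ
          y *ₗ ((z ^ m) *ₗ v +ᴹ moment m l)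
        ≈⟨ +ᴹ-cong (+ᴹ-congʳ (≈ᴹ-sym (*ₗ-assoc _ _ _)))
                   (≈ᴹ-trans (*ₗ-distribˡ _ _ _) (+ᴹ-congʳ (≈ᴹ-sym (*ₗ-assoc _ _ _)))) ⟩
      ((z ^ m * (z + - y)) *ₗ v +ᴹ moment m (differences y l)) +ᴹ
          ((y * z ^ m) *ₗ v +ᴹ y *ₗ moment m l)
        ≈⟨ +ᴹ-interchange _ _ _ _ ⟩
      ((z ^ m * (z + - y)) *ₗ v +ᴹ (y * z ^ m) *ₗ v) +ᴹ
          (moment m (differences y l) +ᴹ y *ₗ moment m l)
        ≈⟨ +ᴹ-cong (≈ᴹ-trans (≈ᴹ-sym (*ₗ-distribʳ _ _ _)) (*ₗ-congʳ scalar))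
                   (moment-differences m y l) ⟩
      (z ^ suc m) *ₗ v +ᴹ moment (suc m) l ∎
      where
      scalar : z ^ m * (z + - y) + y * z ^ m ≈ z ^ suc m
      scalar = trans (+-congˡ (*-comm y _)) (trans (sym (distribˡ _ _ _))
        (trans (*-congˡ (trans (+-assoc z (- y) y) (trans (+-congˡ (-‿inverseˡ y))
            (+-identityʳ z))))
               (*-comm _ z)))

    moment-difference : ∀ m y w l → moment m (differences y l) +ᴹ y *ₗ moment m ((y , w) ∷ l) ≈ᴹ
                                    moment (suc m) ((y , w) ∷ l)
    moment-difference m y w l = begin
      moment m (differences y l) +ᴹ y *ₗ ((y ^ m) *ₗ w +ᴹ moment m l)
        ≈⟨ +ᴹ-congˡ (≈ᴹ-trans (*ₗ-distribˡ _ _ _) (+ᴹ-congʳ (≈ᴹ-sym (*ₗ-assoc _ _ _)))) ⟩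
      moment m (differences y l) +ᴹ ((y ^ suc m) *ₗ w +ᴹ y *ₗ moment m l)
        ≈⟨ +ᴹ-assoc _ _ _ ⟨
      (moment m (differences y l) +ᴹ (y ^ suc m) *ₗ w) +ᴹ y *ₗ moment m l
        ≈⟨ +ᴹ-congʳ (+ᴹ-comm _ _) ⟩
      ((y ^ suc m) *ₗ w +ᴹ moment m (differences y l)) +ᴹ y *ₗ moment m l
        ≈⟨ +ᴹ-assoc _ _ _ ⟩
      (y ^ suc m) *ₗ w +ᴹ (moment m (differences y l) +ᴹ y *ₗ moment m l)
        ≈⟨ +ᴹ-congˡ (moment-differences m y l) ⟩
      (y ^ suc m) *ₗ w +ᴹ moment (suc m) l ∎

  Distinct : List (Carrier × Carrierᴹ) → Set
  Distinct = AllPairs (λ (y , _) (z , _) → ¬ z + - y ≈ 0#)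

  private
    differences-distinct : ∀ y {l} → Distinct l → Distinct (differences y l)
    differences-distinct y = AllPairsₚ.map⁺

    undo-differences : ∀ y {l} → All (λ (z , _) → ¬ z + - y ≈ 0#) l →
                       All (λ (_ , w) → w ∈) (differences y l) → All (λ (_ , w) → w ∈) l
    undo-differences y []         []         = []
    undo-differences y (z≉y ∷ ds) (v∈ ∷ vs∈) = *ₗ-cancelˡ-∈ z≉y v∈ ∷ undo-differences y ds vs∈

  -- Elimination of the first eigenvalue: the moments of the differences lie in the submodule, hence
  -- so do all components but the first, and moment 0 then yields the first one. The length n is
  -- explicit because the recursive call is on `differences y l`, which is no sublist of l.
  vandermonde : ∀ n l → List.length l ≡ n → Distinct l → (∀ m → moment m l ∈) →
      All (λ (_ , w) → w ∈) l
  vandermonde n       []            _      _        _  = []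
  vandermonde (suc n) ((y , w) ∷ l) length≡ (d ∷ ds) s∈ = w∈ ∷ l∈
    where
    l∈ : All (λ (_ , v) → v ∈) l
    l∈ = undo-differences y d (vandermonde n (differences y l) 
      (≡.trans (Listₚ.length-map _ l) (ℕₚ.suc-injective length≡))
      (differences-distinct y ds) λ m →
        +ᴹ-cancelʳ-∈ (∈-resp (≈ᴹ-sym (moment-difference m y w l)) (s∈ (suc m))) (∈-* y (s∈ m)))
    w∈ : w ∈
    w∈ = ∈-resp (*ₗ-identityˡ w) (+ᴹ-cancelʳ-∈ (s∈ 0) (moment-∈ 0 l∈))

  -- Applying powers of Y to the sum of the components produces their moments.
  eigencomponents : ∀ {Y} → IsModuleHomomorphism rawModule rawModule Y → (∀ {u} → u ∈ → Y u ∈) →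
    ∀ l → All (λ (y , w) → Y w ≈ᴹ y *ₗ w) l → Distinct l → moment 0 l ∈ → All (λ (_ , w) → w ∈) l
  eigencomponents {Y} Y-hom Y-∈ l eigen distinct s∈ = vandermonde _ l ≡.refl distinct moments∈
    where
    open IsModuleHomomorphism Y-hom
    Y-moment : ∀ m {l} → All (λ (y , w) → Y w ≈ᴹ y *ₗ w) l → Y (moment m l) ≈ᴹ moment (suc m) l
    Y-moment m []                        = 0ᴹ-homo
    Y-moment m (_∷_ {y , w} {l} yw≈ es) = begin
      Y ((y ^ m) *ₗ w +ᴹ moment m l)            ≈⟨ +ᴹ-homo _ _ ⟩
      Y ((y ^ m) *ₗ w) +ᴹ Y (moment m l)        ≈⟨ +ᴹ-cong (*ₗ-homo _ _) (Y-moment m es) ⟩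
      (y ^ m) *ₗ Y w +ᴹ moment (suc m) l        ≈⟨ +ᴹ-congʳ (*ₗ-congˡ yw≈) ⟩
      (y ^ m) *ₗ (y *ₗ w) +ᴹ moment (suc m) l   ≈⟨ +ᴹ-congʳ (*ₗ-assoc _ _ _) ⟨
      (y ^ m * y) *ₗ w +ᴹ moment (suc m) l      ≈⟨ +ᴹ-congʳ (*ₗ-congʳ (*-comm _ _)) ⟩
      (y ^ suc m) *ₗ w +ᴹ moment (suc m) l      ∎
    moments∈ : ∀ m → moment m l ∈
    moments∈ zero    = s∈
    moments∈ (suc m) = ∈-resp (Y-moment m eigen) (Y-∈ (moments∈ m))

-- Deciding equality with zero

module DecidableZero (R : CommutativeRing 0ℓ 0ℓ) (B : DecSetoid 0ℓ 0ℓ)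
  (_≟0 : ∀ a → Dec (CommutativeRing._≈_ R a (CommutativeRing.0# R))) where
  open CommutativeRing R
  open DecSetoid B using () renaming (_≈_ to _∼_; _≟_ to _∼?_)
  open Free R B

  coefficient-absent : ∀ p {c} → ¬ Any (λ (_ , b) → b ∼ c) p → coefficient p c ≈ 0#
  coefficient-absent []            _      = refl
  coefficient-absent ((a , b) ∷ p) {c} absent with b ∼? c
  ... | yes b∼c = contradiction (here b∼c) absent
  ... | no  _   = coefficient-absent p (absent ∘ there)

  -- Only the finitely many basis elements listed in p can have a nonzero coefficient, so testing
  -- these is enough.
  _≋0? : ∀ p → Dec (p ≋ [])
  p ≋0? with All.all? (λ (_ , b) → coefficient p b ≟0) p
  ... | no  ¬all = no λ p≋0 → ¬all (All.universal (λ (_ , b) → coefficients p≋0 b) p)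
  ... | yes all  = yes (mk≋ vanishes)
    where
    found : ∀ {c} q → All (λ (_ , b) → coefficient p b ≈ 0#) q → Any (λ (_ , b) → b ∼ c) q →
            coefficient p c ≈ 0#
    found (_ ∷ q) (z ∷ _)  (here b∼c)  = trans (sym (coefficient-∼ p b∼c)) z
    found (_ ∷ q) (_ ∷ zs) (there any) = found q zs any
    vanishes : ∀ c → coefficient p c ≈ 0#
    vanishes c with Any.any? (λ (_ , b) → b ∼? c) p
    ... | yes any   = found p all any
    ... | no absent = coefficient-absent p absent

module FractionDecidability (D : CommutativeRing 0ℓ 0ℓ) (D-isDomain : IsDomain D)
  (_≟0 : ∀ a → Dec (CommutativeRing._≈_ D a (CommutativeRing.0# D))) where
  open CommutativeRing D
  open Fractions D D-isDomain hiding (commutativeRing)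
  private module Q = CommutativeRing (Fractions.commutativeRing D D-isDomain)

  ≃0⇒numerator≈0 : ∀ {x} → x ≃ Q.0# → numerator x ≈ 0#
  ≃0⇒numerator≈0 (mk≃ e) = trans (sym (*-identityʳ _)) (trans e (zeroˡ _))

  numerator≈0⇒≃0 : ∀ {x} → numerator x ≈ 0# → x ≃ Q.0#
  numerator≈0⇒≃0 e = mk≃ (trans (*-identityʳ _) (trans e (sym (zeroˡ _))))

  discreteField : IsDiscreteField (Fractions.commutativeRing D D-isDomain)
  discreteField = record
    { 1≉0     = λ e → IsDomain.1≉0 D-isDomain (≃0⇒numerator≈0 e)
    ; _≟0     = decide
    ; inverse = λ x x≉0 →
        fraction (denominator x) (numerator x) (x≉0 ∘ numerator≈0⇒≃0) ,
        mk≃ (trans (*-identityʳ _) (trans (*-comm _ _) (sym (*-identityˡ _))))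
    }
    where
    decide : ∀ x → Dec (x ≃ Q.0#)
    decide x with numerator x ≟0
    ... | yes e = yes (numerator≈0⇒≃0 e)
    ... | no ¬e = no (¬e ∘ ≃0⇒numerator≈0)

-- Specialisation as a relation between fractions

-- κ ↦ f says that f is the image of κ under the homomorphism φ, which is defined on the
-- fractions whose denominator is not in the kernel of φ.
module Specialisation
  (D E : CommutativeRing 0ℓ 0ℓ) (D-isDomain : IsDomain D) (E-isDomain : IsDomain E)
  (φ : CommutativeRing.Carrier D → CommutativeRing.Carrier E)
  (φ-cong : ∀ {a b} → CommutativeRing._≈_ D a b → CommutativeRing._≈_ E (φ a) (φ b))
  (φ-+ : ∀ a b → CommutativeRing._≈_ E (φ (CommutativeRing._+_ D a b))
      (CommutativeRing._+_ E (φ a) (φ b)))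
  (φ-* : ∀ a b → CommutativeRing._≈_ E (φ (CommutativeRing._*_ D a b))
      (CommutativeRing._*_ E (φ a) (φ b)))
  (φ-0 : CommutativeRing._≈_ E (φ (CommutativeRing.0# D)) (CommutativeRing.0# E))
  (φ-1 : CommutativeRing._≈_ E (φ (CommutativeRing.1# D)) (CommutativeRing.1# E))
  where
  private
    module D = CommutativeRing D
    module E = CommutativeRing E
    module FD = Fractions D D-isDomain
    module FE = Fractions E E-isDomain
    module QD = CommutativeRing FD.commutativeRing
    module QE = CommutativeRing FE.commutativeRing

    φ≉0⇒≉0 : ∀ {a} → ¬ φ a E.≈ E.0# → ¬ a D.≈ D.0#
    φ≉0⇒≉0 φa≉0 a≈0 = φa≉0 (E.trans (φ-cong a≈0) φ-0)

  infix 4 _↦_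
  record _↦_ (κ : FD.Fraction) (f : FE.Fraction) : Set where
    field
      num den : D.Carrier
      φden≉0  : ¬ φ den E.≈ E.0#
      source  : κ QD.≈ FD.fraction num den (φ≉0⇒≉0 φden≉0)
      target  : f QE.≈ FE.fraction (φ num) (φ den) φden≉0

  -- Two representatives of the same fraction satisfy a cross-multiplied identity in D. φ carries it
  -- to E, where both denominators are still nonzero.
  ↦-functional : ∀ {κ κ′ f f′} → κ QD.≈ κ′ → κ ↦ f → κ′ ↦ f′ → f QE.≈ f′
  ↦-functional κ≃κ′ s t = QE.trans S.target (QE.trans (FE.mk≃ images) (QE.sym T.target))
    where
    module S = _↦_ s
    module T = _↦_ t
    images : φ S.num E.* φ T.den E.≈ φ T.num E.* φ S.den
    images = E.trans (E.sym (φ-* _ _)) (E.trans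
      (φ-cong (FD.cross (QD.trans (QD.sym S.source) (QD.trans κ≃κ′ T.source)))) (φ-* _ _))

  ↦-fraction : ∀ a b (b≉0 : ¬ b D.≈ D.0#) (φb≉0 : ¬ φ b E.≈ E.0#) →
               FD.fraction a b b≉0 ↦ FE.fraction (φ a) (φ b) φb≉0
  ↦-fraction a b _ φb≉0 = record
    { num = a ; den = b ; φden≉0 = φb≉0 ; source = FD.mk≃ D.refl ; target = FE.mk≃ E.refl }

  ↦-resp : ∀ {κ κ′ f f′} → κ QD.≈ κ′ → f QE.≈ f′ → κ ↦ f → κ′ ↦ f′
  ↦-resp κ≃κ′ f≃f′ s = record
    { num = S.num ; den = S.den ; φden≉0 = S.φden≉0
    ; source = QD.trans (QD.sym κ≃κ′) S.source ; target = QE.trans (QE.sym f≃f′) S.target }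
    where module S = _↦_ s

  private
    ≃-fraction : ∀ {a a′ b b′} {b≉0 : ¬ b E.≈ E.0#} {b′≉0 : ¬ b′ E.≈ E.0#} →
                 a E.≈ a′ → b E.≈ b′ → FE.fraction a b b≉0 QE.≈ FE.fraction a′ b′ b′≉0
    ≃-fraction a≈ b≈ = FE.mk≃ (E.*-cong a≈ (E.sym b≈))

    φ-*≉0 : ∀ {a b} → ¬ φ a E.≈ E.0# → ¬ φ b E.≈ E.0# → ¬ φ (a D.* b) E.≈ E.0#
    φ-*≉0 φa≉0 φb≉0 e = IsDomain.*-≉0 E-isDomain φa≉0 φb≉0 (E.trans (E.sym (φ-* _ _)) e)

  ↦-embed : ∀ a → FD.embed a ↦ FE.embed (φ a)
  ↦-embed a = ↦-resp QD.refl (≃-fraction E.refl φ-1)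
    (↦-fraction a D.1# _ (λ e → IsDomain.1≉0 E-isDomain (E.trans (E.sym φ-1) e)))

  ↦-1 : QD.1# ↦ QE.1#
  ↦-1 = ↦-resp QD.refl (≃-fraction φ-1 E.refl) (↦-embed D.1#)

  ↦-+ : ∀ {κ κ′ f f′} → κ ↦ f → κ′ ↦ f′ → κ QD.+ κ′ ↦ f QE.+ f′
  ↦-+ s t = record
    { num    = S.num D.* T.den D.+ T.num D.* S.den
    ; den    = S.den D.* T.den
    ; φden≉0 = φ-*≉0 S.φden≉0 T.φden≉0
    ; source = QD.trans (QD.+-cong S.source T.source) (FD.mk≃ D.refl)
    ; target = QE.trans (QE.+-cong S.target T.target) (≃-fraction
        (E.sym (E.trans (φ-+ _ _) (E.+-cong (φ-* _ _) (φ-* _ _)))) (E.sym (φ-* _ _)))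
    }
    where
    module S = _↦_ s
    module T = _↦_ t

  ↦-* : ∀ {κ κ′ f f′} → κ ↦ f → κ′ ↦ f′ → κ QD.* κ′ ↦ f QE.* f′
  ↦-* s t = record
    { num    = S.num D.* T.num
    ; den    = S.den D.* T.den
    ; φden≉0 = φ-*≉0 S.φden≉0 T.φden≉0
    ; source = QD.trans (QD.*-cong S.source T.source) (FD.mk≃ D.refl)
    ; target = QE.trans (QE.*-cong S.target T.target) (≃-fraction
        (E.sym (φ-* _ _)) (E.sym (φ-* _ _)))
    }
    where
    module S = _↦_ s
    module T = _↦_ t

  module Combinations (B : DecSetoid 0ℓ 0ℓ) where
    module V = Free FD.commutativeRing B
    module W = Free FE.commutativeRing B
    private
      module Vᴹ = Module V.freeModule
      module Wᴹ = Module W.freeModule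
      Basis = DecSetoid.Carrier B

    infix 4 _↦*_ _⇝_
    _↦*_ : V.Combination → W.Combination → Set
    _↦*_ = Pointwise (λ (κ , b) (f , c) → κ ↦ f × b ≡ c)

    -- Equal combinations can be different lists, so the entrywise relation `_↦*_` is not stable
    -- under equality. `_⇝_` allows a change of representative on both sides.
    record _⇝_ (F : V.Combination) (Φ : W.Combination) : Set where
      constructor mk⇝
      field
        {F′}      : V.Combination
        {Φ′}      : W.Combination
        F≋F′      : F V.≋ F′
        Φ≋Φ′      : Φ W.≋ Φ′
        pointwise : F′ ↦* Φ′

    ⇝-pointwise : ∀ {F Φ} → F ↦* Φ → F ⇝ Φ
    ⇝-pointwise p = mk⇝ Vᴹ.≈ᴹ-refl Wᴹ.≈ᴹ-refl p

    ⇝-resp : ∀ {F G Φ Ψ} → F V.≋ G → Φ W.≋ Ψ → F ⇝ Φ → G ⇝ Ψ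
    ⇝-resp F≋G Φ≋Ψ (mk⇝ e f p) =
      mk⇝ (Vᴹ.≈ᴹ-trans (Vᴹ.≈ᴹ-sym F≋G) e) (Wᴹ.≈ᴹ-trans (Wᴹ.≈ᴹ-sym Φ≋Ψ) f) p

    private
      ↦*-coefficient : ∀ {F Φ} → F ↦* Φ → ∀ b → V.coefficient F b ↦ W.coefficient Φ b
      ↦*-coefficient []                               b =
          ↦-resp QD.refl (≃-fraction φ-0 E.refl) (↦-embed D.0#)
      ↦*-coefficient (_∷_ {_ , c} (κ↦f , ≡.refl) p) b with DecSetoid._≟_ B c b
      ... | yes _ = ↦-+ κ↦f (↦*-coefficient p b)
      ... | no  _ = ↦*-coefficient p b

    -- The transfer principle: an identity over the fractions of D becomes one over the fractions of
    -- E, since at every basis element both coefficients are images of the same fraction. All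
    -- relations between the specialised polynomials are obtained in this way.
    ⇝-functional : ∀ {F G Φ Ψ} → F V.≋ G → F ⇝ Φ → G ⇝ Ψ → Φ W.≋ Ψ
    ⇝-functional F≋G (mk⇝ F≋F′ Φ≋Φ′ p) (mk⇝ G≋G′ Ψ≋Ψ′ q) =
      Wᴹ.≈ᴹ-trans Φ≋Φ′ (Wᴹ.≈ᴹ-trans
        (W.mk≋ λ b → ↦-functional (V.coefficients F′≋G′ b) (↦*-coefficient p b)
            (↦*-coefficient q b))
        (Wᴹ.≈ᴹ-sym Ψ≋Ψ′))
      where F′≋G′ = Vᴹ.≈ᴹ-trans (Vᴹ.≈ᴹ-sym F≋F′) (Vᴹ.≈ᴹ-trans F≋G G≋G′)

    ⇝-++ : ∀ {F G Φ Ψ} → F ⇝ Φ → G ⇝ Ψ → F ++ G ⇝ Φ ++ Ψ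
    ⇝-++ (mk⇝ {F′} {Φ′} e f p) (mk⇝ {G′} {Ψ′} e′ f′ p′) = mk⇝
      (Vᴹ.+ᴹ-cong {y = F′} {v = G′} e e′) (Wᴹ.+ᴹ-cong {y = Φ′} {v = Ψ′} f f′) (Pointwise.++⁺ p p′)

    ⇝-scale : ∀ {κ f F Φ} → κ ↦ f → F ⇝ Φ → V.scale κ F ⇝ W.scale f Φ
    ⇝-scale {κ} {f} κ↦f (mk⇝ {F′} {Φ′} e e′ p) =
      mk⇝ (Vᴹ.*ₗ-congˡ {κ} {y = F′} e) (Wᴹ.*ₗ-congˡ {f} {y = Φ′} e′) (scaled p)
      where
      scaled : ∀ {F Φ} → F ↦* Φ → V.scale κ F ↦* W.scale f Φ
      scaled []            = []
      scaled ((s , e) ∷ p) = (↦-* κ↦f s , e) ∷ scaled p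

    ⇝-linear : {C C′ : Set} {g : C → V.Combination} {h : C′ → W.Combination} →
               ∀ {F Φ} → Pointwise (λ (κ , c) (f , c′) → κ ↦ f × g c ⇝ h c′) F Φ →
               linear V.freeModule g F ⇝ linear W.freeModule h Φ
    ⇝-linear []                  = ⇝-pointwise []
    ⇝-linear ((κ↦f , g⇝h) ∷ p) = ⇝-++ (⇝-scale κ↦f g⇝h) (⇝-linear p)

    ⇝-basis : ∀ b → V.basis b ⇝ W.basis b
    ⇝-basis b = ⇝-pointwise ((↦-1 , ≡.refl) ∷ [])

    -- The form in which `Localised` supplies F. The list F may contain fractions whose denominators
    -- die under φ, but F equals the numerator divided by π. The denominator d is separate from
    -- `φ π` because the image of a product of the e_j equals the product of the ē_j only up to the
    -- equality of E.
    ⇝-quotient : ∀ {F π d} → ¬ φ π E.≈ E.0# → φ π E.≈ d → (d≉0 : ¬ d E.≈ E.0#) →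
      (l : List (D.Carrier × Basis)) → V.scale (FD.embed π) F V.≋ List.map (λ (a , c) →
          FD.embed a , c) l →
      F ⇝ List.map (λ (a , c) → FE.fraction (φ a) d d≉0 , c) l
    ⇝-quotient {F} {π} {d} φπ≉0 φπ≈d d≉0 numerator equation =
      ⇝-resp F′≋F Wᴹ.≈ᴹ-refl (⇝-pointwise (quotients numerator))
      where
      π≉0 = φ≉0⇒≉0 φπ≉0
      1/π = FD.fraction D.1# π π≉0

      divided : List (D.Carrier × Basis) → V.Combination
      divided = List.map (λ (a , c) → FD.fraction a π π≉0 , c)

      divide : ∀ l → divided l V.≋ V.scale 1/π (List.map (λ (a , c) → FD.embed a , c) l)
      divide []            = Vᴹ.≈ᴹ-refl
      divide ((a , c) ∷ l) = Vᴹ.+ᴹ-cong {(FD.fraction a π π≉0 , c) ∷ []}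
          {(1/π QD.* FD.embed a , c) ∷ []}
        (V.mk≋ single) (divide l)
        where
        quotient : FD.fraction a π π≉0 QD.≈ 1/π QD.* FD.embed a
        quotient = FD.mk≃ (D.*-cong (D.sym (D.*-identityˡ a)) (D.*-identityʳ π))
        single : ∀ b → V.coefficient ((FD.fraction a π π≉0 , c) ∷ []) b QD.≈
                       V.coefficient ((1/π QD.* FD.embed a , c) ∷ []) b
        single b with DecSetoid._≟_ B c b
        ... | yes _ = QD.+-congʳ {QD.0#} {FD.fraction a π π≉0} {1/π QD.* FD.embed a} quotient
        ... | no  _ = QD.refl

      F′≋F : divided numerator V.≋ F
      F′≋F = Vᴹ.≈ᴹ-trans (divide numerator) (Vᴹ.≈ᴹ-trans (Vᴹ.*ₗ-congˡ {1/π} (Vᴹ.≈ᴹ-sym equation))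
        (Vᴹ.≈ᴹ-trans (Vᴹ.≈ᴹ-sym (Vᴹ.*ₗ-assoc 1/π (FD.embed π) F))
          (Vᴹ.≈ᴹ-trans (Vᴹ.*ₗ-congʳ {F} unit) (Vᴹ.*ₗ-identityˡ F))))
        where
        unit : 1/π QD.* FD.embed π QD.≈ QD.1#
        unit = FD.mk≃ (D.trans (D.*-identityʳ (D.1# D.* π)) (D.*-congˡ (D.sym (D.*-identityʳ π))))

      quotients : ∀ l → divided l ↦* List.map (λ (a , c) → FE.fraction (φ a) d d≉0 , c) l
      quotients []            = []
      quotients ((a , c) ∷ l) =
        (↦-resp QD.refl (≃-fraction E.refl φπ≈d) (↦-fraction a π π≉0 φπ≉0) , ≡.refl) ∷ quotients l

  linear-⇝ : (B C : DecSetoid 0ℓ 0ℓ) → (∀ {b c} → DecSetoid._≈_ B b c → b ≡ c) →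
    {g : DecSetoid.Carrier B → Combinations.V.Combination C}
    {h : DecSetoid.Carrier B → Combinations.W.Combination C} →
    (∀ b → Combinations._⇝_ C (g b) (h b)) → ∀ {F Φ} → Combinations._⇝_ B F Φ →
    Combinations._⇝_ C (linear (Combinations.V.freeModule C) g F)
        (linear (Combinations.W.freeModule C) h Φ)
  linear-⇝ B C B-≡ {g} {h} g⇝h (Combinations.mk⇝ F≋F′ Φ≋Φ′ p) = C.⇝-resp
    (Vᴹ.≈ᴹ-sym (LinearProperties.linear-cong {FD.commutativeRing} {B} C.V.freeModule {g}
      (λ b∼c → Vᴹ.≈ᴹ-reflexive (≡.cong g (B-≡ b∼c))) F≋F′))
    (Wᴹ.≈ᴹ-sym (LinearProperties.linear-cong {FE.commutativeRing} {B} C.W.freeModule {h}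
      (λ b∼c → Wᴹ.≈ᴹ-reflexive (≡.cong h (B-≡ b∼c))) Φ≋Φ′))
    (C.⇝-linear (Pointwise.map (λ { {_ , b} (κ↦f , ≡.refl) → κ↦f , g⇝h b }) p))
    where
    module C = Combinations C
    module Vᴹ = Module C.V.freeModule
    module Wᴹ = Module C.W.freeModule

-- Newton's identities in finitely many variables

module Newton (R : CommutativeRing 0ℓ 0ℓ) where
  open CommutativeRing R hiding (zero)
  open SemiringExp semiring using (_^_)
  open ListSums R
  open SetoidReasoning setoid
  open NaturalCoefficientsSolver commutativeSemiring using (solve; con)
    renaming (_:+_ to _⊞_; _:*_ to _⊠_; _:=_ to _⊜_)

  natural : ℕ → Carrier
  natural zero    = 0#
  natural (suc n) = 1# + natural n

  symmetric : ∀ {n} → Vec Carrier n → ℕ → Carrier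
  symmetric xs       zero    = 1#
  symmetric []       (suc j) = 0#
  symmetric (y ∷ ys) (suc j) = y * symmetric ys j + symmetric ys (suc j)

  -- without xs c r = e_r(all entries of xs except the one at c)
  without : ∀ {n} → Vec Carrier n → Fin n → ℕ → Carrier
  without xs       c       zero    = 1#
  without (y ∷ ys) zero    (suc r) = symmetric ys (suc r)
  without (y ∷ ys) (suc c) (suc r) = y * without ys c r + without ys c (suc r)

  symmetric-without : ∀ {n} (xs : Vec Carrier n) c r →
    symmetric xs (suc r) ≈ lookup xs c * without xs c r + without xs c (suc r)
  symmetric-without (y ∷ ys) zero    zero    = refl
  symmetric-without (y ∷ ys) zero    (suc r) = refl
  symmetric-without (y ∷ ys) (suc c) zero    = trans (+-congˡ (symmetric-without ys c 0))
    (solve 4 (λ y x w o → y ⊠ o ⊞ (x ⊠ o ⊞ w) ⊜ x ⊠ o ⊞ (y ⊠ o ⊞ w)) refl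
       y (lookup ys c) (without ys c 1) 1#)
  symmetric-without (y ∷ ys) (suc c) (suc r) =
    trans (+-cong (*-congˡ (symmetric-without ys c r)) (symmetric-without ys c (suc r)))
      (solve 5 (λ y x a b d → y ⊠ (x ⊠ a ⊞ b) ⊞ (x ⊠ b ⊞ d) ⊜ x ⊠ (y ⊠ a ⊞ b) ⊞ (y ⊠ b ⊞ d)) refl
         y (lookup ys c) (without ys c r) (without ys c (suc r)) (without ys c (suc (suc r))))

  -- Each squarefree monomial of degree r + 1 arises once for each of its r + 1 variables; this is
  -- Euler's identity for the homogeneous polynomial e_{r+1}.
  euler : ∀ {n} (xs : Vec Carrier n) r →
    sum (λ c → lookup xs c * without xs c r) ≈ natural (suc r) * symmetric xs (suc r)
  euler []       r       = sym (zeroʳ _)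
  euler (y ∷ ys) zero    = begin
    y * 1# + sum (λ c → lookup ys c * 1#)  ≈⟨ +-congˡ (euler ys zero) ⟩
    y * 1# + natural 1 * symmetric ys 1    ≈⟨ +-congˡ (*-congʳ one) ⟩
    y * 1# + 1# * symmetric ys 1           ≈⟨ +-congˡ (*-identityˡ _) ⟩
    y * 1# + symmetric ys 1                ≈⟨ *-identityˡ _ ⟨
    1# * (y * 1# + symmetric ys 1)         ≈⟨ *-congʳ one ⟨
    natural 1 * (y * 1# + symmetric ys 1)  ∎
    where
    one : natural 1 ≈ 1#
    one = +-identityʳ 1#
  euler {suc n} (y ∷ ys) (suc r) = begin
    y * e₁ + sum (λ c → x c * (y * w c r + w c (suc r)))
      ≈⟨ +-congˡ (sum-cong-≋ {x = λ c → x c * (y * w c r + w c (suc r))}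
           {y = λ c → y * (x c * w c r) + x c * w c (suc r)} λ c →
           solve 4 (λ x y a b → x ⊠ (y ⊠ a ⊞ b) ⊜ y ⊠ (x ⊠ a) ⊞ x ⊠ b) refl
             (x c) y (w c r) (w c (suc r))) ⟩
    y * e₁ + sum (λ c → y * (x c * w c r) + x c * w c (suc r))
      ≈⟨ +-congˡ (∑-distrib-+ (λ c → y * (x c * w c r)) (λ c → x c * w c (suc r))) ⟩
    y * e₁ + (sum (λ c → y * (x c * w c r)) + sum (λ c → x c * w c (suc r)))
      ≈⟨ +-congˡ (+-cong (sym (*-distribˡ-sum y (λ c → x c * w c r))) (euler ys (suc r))) ⟩
    y * e₁ + (y * sum (λ c → x c * w c r) + (1# + natural (suc r)) * e₂)
      ≈⟨ +-congˡ (+-congʳ (*-congˡ (euler ys r))) ⟩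
    y * e₁ + (y * (natural (suc r) * e₁) + (1# + natural (suc r)) * e₂)
      ≈⟨ solve 4 (λ y e₁ m e₂ → y ⊠ e₁ ⊞ (y ⊠ (m ⊠ e₁) ⊞ (con 1 ⊞ m) ⊠ e₂) ⊜
                                (con 1 ⊞ m) ⊠ (y ⊠ e₁ ⊞ e₂)) refl y e₁ (natural (suc r)) e₂ ⟩
    natural (suc (suc r)) * (y * e₁ + e₂) ∎
    where
    x = lookup ys
    w = without ys
    e₁ = symmetric ys (suc r)
    e₂ = symmetric ys (suc (suc r))

  -- The symmetric function that `hook r m` stands for, now in finitely many variables. The next two
  -- lemmas show that it satisfies the two defining equations of `hook`.
  hookSum : ∀ {n} → Vec Carrier n → ℕ → ℕ → Carrier
  hookSum xs r m = sum (λ c → lookup xs c ^ suc m * without xs c r)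

  hookSum-zero : ∀ {n} (xs : Vec Carrier n) r →
    hookSum xs r 0 ≈ natural (suc r) * symmetric xs (suc r)
  hookSum-zero xs r = trans
    (sum-cong-≋ {x = λ c → lookup xs c ^ 1 * without xs c r} (λ c → *-congʳ (*-identityʳ _)))
    (euler xs r)

  hookSum-suc : ∀ {n} (xs : Vec Carrier n) r m →
    hookSum xs r (suc m) ≈ symmetric xs (suc r) * hookSum xs 0 m + - hookSum xs (suc r) m
  hookSum-suc xs r m = begin
    hookSum xs r (suc m)
      ≈⟨ +-identityʳ _ ⟨
    hookSum xs r (suc m) + 0#
      ≈⟨ +-congˡ (-‿inverseʳ _) ⟨
    hookSum xs r (suc m) + (hookSum xs (suc r) m + - hookSum xs (suc r) m)
      ≈⟨ +-assoc _ _ _ ⟨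
    (hookSum xs r (suc m) + hookSum xs (suc r) m) + - hookSum xs (suc r) m
      ≈⟨ +-congʳ recursion ⟨
    symmetric xs (suc r) * hookSum xs 0 m + - hookSum xs (suc r) m ∎
    where
    recursion : symmetric xs (suc r) * hookSum xs 0 m ≈ hookSum xs r (suc m) + hookSum xs (suc r)
        m
    recursion = begin
      symmetric xs (suc r) * hookSum xs 0 m
        ≈⟨ *-distribˡ-sum (symmetric xs (suc r)) (λ c → lookup xs c ^ suc m * 1#) ⟩
      sum (λ c → symmetric xs (suc r) * (lookup xs c ^ suc m * 1#))
        ≈⟨ sum-cong-≋ {x = λ c → symmetric xs (suc r) * (lookup xs c ^ suc m * 1#)}
             {y = λ c → lookup xs c ^ suc (suc m) * without xs c r +
                        lookup xs c ^ suc m * without xs c (suc r)} (λ c →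
             trans (*-cong (symmetric-without xs c r) (*-identityʳ _))
               (solve 4 (λ x p a b → (x ⊠ a ⊞ b) ⊠ p ⊜ (x ⊠ p) ⊠ a ⊞ p ⊠ b) refl
                 (lookup xs c) (lookup xs c ^ suc m) (without xs c r) (without xs c (suc r)))) ⟩
      sum (λ c → lookup xs c ^ suc (suc m) * without xs c r +
                 lookup xs c ^ suc m * without xs c (suc r))
        ≈⟨ ∑-distrib-+ (λ c → lookup xs c ^ suc (suc m) * without xs c r)
                       (λ c → lookup xs c ^ suc m * without xs c (suc r)) ⟩
      hookSum xs r (suc m) + hookSum xs (suc r) m ∎

-- The homomorphism from Λ to ℚ[x₁,...,x_N]

module Evaluation (N : ℕ) where
  open FiniteVariables N
  private
    module P = CommutativeRing commutativeRing
    module Pᴹ = Module freeModule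
    open module Newtonᴾ = Newton commutativeRing using (natural; symmetric; hookSum)
    open SemiringExp P.semiring using () renaming (_^_ to _^ᴾ_; ^-homo-* to ^ᴾ-homo-*)
    open SetoidReasoning P.setoid

  ^≡^ : ∀ p a → p ^ a ≡ p ^ᴾ a
  ^≡^ p zero    = ≡.refl
  ^≡^ p (suc a) = ≡.cong (p *_) (^≡^ p a)

  elementary≡symmetric : ∀ {n} (xs : Vec Polynomial n) j → elementary xs j ≡ symmetric xs j
  elementary≡symmetric xs       zero    = ≡.refl
  elementary≡symmetric []       (suc j) = ≡.refl
  elementary≡symmetric (y ∷ ys) (suc j) =
    ≡.cong₂ (λ a b → (y * a) + b) (elementary≡symmetric ys j) (elementary≡symmetric ys (suc j))

  -- evaluate is the linear extension of a function on monomials that is local to its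
  -- definition.  Unification recovers that function, the with abstraction generalises its
  -- starting index 1, and the recursion behind it is then available as image.
  mutual
    evaluate-basis : List ℕ → Polynomial
    evaluate-basis = _

    evaluate-linear : evaluate ≡ linear freeModule evaluate-basis
    evaluate-linear = ≡.refl

  mutual
    image : ℕ → List ℕ → Polynomial
    image = _

    evaluate-basis-image : ∀ m → evaluate-basis m ≡ image 1 m
    evaluate-basis-image m with ℕ.suc ℕ.zero
    ... | j = ≡.refl

  image-⊕ : ∀ j m n → image j (m ⊕ n) ≈ image j m * image j n
  image-⊕ j []      n       = P.sym (P.*-identityˡ _)
  image-⊕ j (a ∷ m) []      = P.sym (P.*-identityʳ (image j (a ∷ m)))
  image-⊕ j (a ∷ m) (b ∷ n) = begin
    ē j ^ (a ℕ.+ b) * image (suc j) (m ⊕ n)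
      ≈⟨ P.*-cong (P.trans (P.reflexive (^≡^ (ē j) (a ℕ.+ b))) (P.trans (^ᴾ-homo-* (ē j) a b)
           (P.reflexive (≡.sym (≡.cong₂ _*_ (^≡^ (ē j) a) (^≡^ (ē j) b))))))
           (image-⊕ (suc j) m n) ⟩
    (ē j ^ a * ē j ^ b) * (image (suc j) m * image (suc j) n)
      ≈⟨ solve 4 (λ a b m n → (a ⊠ b) ⊠ (m ⊠ n) ⊜ (a ⊠ m) ⊠ (b ⊠ n)) P.refl
           (ē j ^ a) (ē j ^ b) (image (suc j) m) (image (suc j) n) ⟩
    (ē j ^ a * image (suc j) m) * (ē j ^ b * image (suc j) n) ∎
    where
    open NaturalCoefficientsSolver P.commutativeSemiring using (solve)
      renaming (_:*_ to _⊠_; _:=_ to _⊜_)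

  -- Monomials that agree up to trailing zeros have the same image because every extra factor is
  -- ē_j^0 = 1.
  image-≐ : ∀ j m n → m ≐ n → image j m ≈ image j n
  image-≐ j []      []      e = P.refl
  image-≐ j []      (b ∷ n) e with exponents e 0
  ... | ≡.refl = P.trans (image-≐ (suc j) [] n (mk≐ (exponents e ∘ suc)))
      (P.sym (P.*-identityˡ _))
  image-≐ j (a ∷ m) []      e with exponents e 0
  ... | ≡.refl = P.trans (P.*-identityˡ _) (image-≐ (suc j) m [] (mk≐ (exponents e ∘ suc)))
  image-≐ j (a ∷ m) (b ∷ n) e with exponents e 0
  ... | ≡.refl = P.*-congˡ {ē j ^ a} (image-≐ (suc j) m n (mk≐ (exponents e ∘ suc)))

  -- The starting index i varies because the recursion moves it along the exponent list; `evaluate`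
  -- starts at 1, as position j of that list belongs to e_{j+1}.
  image-e : ∀ i j → image i (List.replicate j 0 ++ 1 ∷ []) ≈ ē (i ℕ.+ j)
  image-e i zero    = P.trans (P.*-identityʳ (ē i ^ 1)) (P.trans (P.*-identityʳ (ē i))
    (P.reflexive (≡.cong ē (≡.sym (ℕₚ.+-identityʳ i)))))
  image-e i (suc j) = P.trans (P.*-identityˡ _) (P.trans (image-e (suc i) j)
    (P.reflexive (≡.cong ē (≡.sym (ℕₚ.+-suc i j)))))

  private
    module L = LinearProperties {ℚring} {Λ.monomials} freeModule
    module Q = LinearProperties {ℚring} {monomials} freeModule

    *-linear : ∀ p (f : List ℕ → Polynomial) q →
               linear freeModule (λ n → p * f n) q ≈ p * linear freeModule f q
    *-linear p f []            = P.sym (P.zeroʳ p)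
    *-linear p f ((a , n) ∷ q) = P.trans
      (P.+-cong {x = scale a (p * f n)} {y = p * scale a (f n)}
                {u = linear freeModule (λ n → p * f n) q} {v = p * linear freeModule f q}
                *-scale (*-linear p f q))
      (P.sym (P.distribˡ p (scale a (f n)) (linear freeModule f q)))
      where
      *-scale : scale a (p * f n) ≈ p * scale a (f n)
      *-scale = P.trans (Pᴹ.*ₗ-congˡ {a} {p * f n} {f n * p} (P.*-comm p (f n)))
        (P.trans (P.sym (Q.linear-scale (λ m → shift m p) a (f n))) (P.*-comm (scale a (f n)) p))

  evaluate-cong : ∀ {p q} → p Λ.≈ q → evaluate p ≈ evaluate q
  evaluate-cong = L.linear-cong (λ {m} {n} → image-≐ 1 m n)

  evaluate-+ : ∀ p q → evaluate (p Λ.+ q) ≈ evaluate p + evaluate q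
  evaluate-+ = L.linear-++ evaluate-basis

  evaluate-* : ∀ p q → evaluate (p Λ.* q) ≈ evaluate p * evaluate q
  evaluate-* p q = begin
    evaluate (p Λ.* q)
      ≈⟨ linear-∘ {ℚring} {Λ.monomials} freeModule evaluate-basis (λ m → Λ.shift m q) p ⟩
    linear freeModule (λ m → evaluate (Λ.shift m q)) p
      ≈⟨ L.linear-ext (λ m → P.trans (evaluate-shift m) (P.*-comm (image 1 m) (evaluate q))) p ⟩
    linear freeModule (λ m → evaluate q * image 1 m) p
      ≈⟨ *-linear (evaluate q) (image 1) p ⟩
    evaluate q * evaluate p
      ≈⟨ P.*-comm (evaluate q) (evaluate p) ⟩
    evaluate p * evaluate q ∎
    where
    evaluate-shift : ∀ m → evaluate (Λ.shift m q) ≈ image 1 m * evaluate q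
    evaluate-shift m = begin
      evaluate (Λ.shift m q)
        ≈⟨ linear-∘ {ℚring} {Λ.monomials} freeModule evaluate-basis (λ n → Λ.basis (m ⊕ n)) q ⟩
      linear freeModule (λ n → evaluate (Λ.basis (m ⊕ n))) q
        ≈⟨ L.linear-ext (λ n → P.trans (L.linear-basis evaluate-basis (m ⊕ n)) (image-⊕ 1 m n)) q
            ⟩
      linear freeModule (λ n → image 1 m * image 1 n) q
        ≈⟨ *-linear (image 1 m) (image 1) q ⟩
      image 1 m * evaluate q ∎

  evaluate-0 : evaluate Λ.0# ≈ 0#
  evaluate-0 = P.refl

  evaluate-1 : evaluate Λ.1# ≈ 1#
  evaluate-1 = L.linear-basis evaluate-basis []

  evaluate-e : ∀ j → evaluate (e j) ≈ ē j
  evaluate-e zero    = evaluate-1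
  evaluate-e (suc j) = P.trans
    (L.linear-basis evaluate-basis (List.replicate j 0 ++ 1 ∷ [])) (image-e 1 j)

  evaluate-constant : ∀ q → evaluate (Λ.constant q) ≈ constant q
  evaluate-constant q = P.reflexive (≡.cong (λ q → (q , _) ∷ []) (ℚₚ.*-identityʳ q))

  evaluate-neg : ∀ p → evaluate (Λ.- p) ≈ - evaluate p
  evaluate-neg p = P.uniqueˡ-⁻¹ (evaluate (Λ.- p)) (evaluate p) (P.trans
    (P.sym (evaluate-+ (Λ.- p) p))
    (evaluate-cong {(Λ.- p) Λ.+ p} {Λ.0#} (CommutativeRing.-‿inverseˡ Λ.commutativeRing p)))

  private
    fromℕ-suc : ∀ n → (ℤ.+ suc n) ℚ./ 1 ≡ 1ℚ ℚ.+ (ℤ.+ n) ℚ./ 1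
    fromℕ-suc n = ≡.sym (ℚₚ.toℚᵘ-injective (ℚᵘₚ.≃-trans (ℚₚ.toℚᵘ-homo-+ 1ℚ ((ℤ.+ n) ℚ./ 1))
      (ℚᵘₚ.≃-trans (ℚᵘₚ.+-congʳ ℚᵘ.1ℚᵘ (ℚₚ.toℚᵘ-fromℚᵘ (ℚᵘ.mkℚᵘ (ℤ.+ n) 0)))
      (ℚᵘₚ.≃-trans (ℚᵘ.*≡* (≡.cong (λ k → (ℤ.1ℤ ℤ.+ k) ℤ.* ℤ.1ℤ) (ℤₚ.*-identityʳ (ℤ.+ n))))
                   (ℚᵘₚ.≃-sym (ℚₚ.toℚᵘ-fromℚᵘ (ℚᵘ.mkℚᵘ (ℤ.+ suc n) 0)))))))

    constant-+ : ∀ p q → constant (p ℚ.+ q) ≈ constant p + constant q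
    constant-+ p q = mk≋ λ m → lemma m
      where
      ε = Vec.replicate N 0
      lemma : ∀ m → coefficient (constant (p ℚ.+ q)) m ≡ coefficient (constant p + constant q) m
      lemma m with DecSetoid._≟_ monomials ε m in eq
      ... | yes _ rewrite eq = ℚₚ.+-assoc p q 0ℚ
      ... | no  _ rewrite eq = ≡.refl

  constant-natural : ∀ n → constant ((ℤ.+ n) ℚ./ 1) ≈ natural n
  constant-natural zero    = mk≋ lemma
    where
    lemma : ∀ m → coefficient (constant 0ℚ) m ≡ 0ℚ
    lemma m with DecSetoid._≟_ monomials (Vec.replicate N 0) m
    ... | yes _ = ≡.refl
    ... | no  _ = ≡.refl
  constant-natural (suc n) = P.trans (P.reflexive (≡.cong constant (fromℕ-suc n)))
    (P.trans (constant-+ 1ℚ ((ℤ.+ n) ℚ./ 1))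
      (P.+-congˡ {constant 1ℚ} (constant-natural n)))

  vars : Vec Polynomial N
  vars = Vec.tabulate var

  -- Both sides satisfy the same recursion in m. The case r = 0 identifies the image of the formal
  -- p_{m+1} with the power sum of x₁,...,x_N.
  evaluate-hook : ∀ r m → evaluate (hook r m) ≈ hookSum vars r m
  evaluate-hook r zero    = begin
    evaluate (Λ.constant ((ℤ.+ suc r) ℚ./ 1) Λ.* e (suc r))
      ≈⟨ evaluate-* (Λ.constant ((ℤ.+ suc r) ℚ./ 1)) (e (suc r)) ⟩
    evaluate (Λ.constant ((ℤ.+ suc r) ℚ./ 1)) * evaluate (e (suc r))
      ≈⟨ P.*-cong (P.trans (evaluate-constant ((ℤ.+ suc r) ℚ./ 1)) (constant-natural (suc r)))
           (P.trans (evaluate-e (suc r)) (P.reflexive (elementary≡symmetric vars (suc r)))) ⟩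
    natural (suc r) * symmetric vars (suc r)
      ≈⟨ Newtonᴾ.hookSum-zero vars r ⟨
    hookSum vars r 0 ∎
  evaluate-hook r (suc m) = begin
    evaluate ((e (suc r) Λ.* hook 0 m) Λ.+ (Λ.- hook (suc r) m))
      ≈⟨ evaluate-+ (e (suc r) Λ.* hook 0 m) (Λ.- hook (suc r) m) ⟩
    evaluate (e (suc r) Λ.* hook 0 m) + evaluate (Λ.- hook (suc r) m)
      ≈⟨ P.+-cong {x = evaluate (e (suc r) Λ.* hook 0 m)} {y =
          symmetric vars (suc r) * hookSum vars 0 m}
                  {u = evaluate (Λ.- hook (suc r) m)} {v = - hookSum vars (suc r) m}
           (P.trans (evaluate-* (e (suc r)) (hook 0 m)) (P.*-cong
              (P.trans (evaluate-e (suc r)) (P.reflexive (elementary≡symmetric vars (suc r))))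
              (evaluate-hook 0 m)))
           (P.trans (evaluate-neg (hook (suc r) m))
              (P.-‿cong {evaluate (hook (suc r) m)} {hookSum vars (suc r) m}
                  (evaluate-hook (suc r) m))) ⟩
    symmetric vars (suc r) * hookSum vars 0 m + - hookSum vars (suc r) m
      ≈⟨ Newtonᴾ.hookSum-suc vars r m ⟨
    hookSum vars r (suc m) ∎

-- Tuples of distinct entries and their extensions

∉-∷⁻ : ∀ {k} {xs : Vec ℕ k} {y} → Allᵛ.All (λ x → y ≢ x) xs → y ∉ xs
∉-∷⁻ (y≢x ∷ _)  (here y≡x)  = y≢x y≡x
∉-∷⁻ (_ ∷ y≢xs) (there y∈) = ∉-∷⁻ y≢xs y∈

∉⇒All≢ : ∀ {k} {xs : Vec ℕ k} {y} → y ∉ xs → Allᵛ.All (λ x → y ≢ x) xs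
∉⇒All≢ {xs = []}    y∉ = []
∉⇒All≢ {xs = _ ∷ _} y∉ = (y∉ ∘ here) ∷ ∉⇒All≢ (y∉ ∘ there)

cons : ∀ {Label k} (σ : Tuple Label k) {y : ℕ} → Label y → y ∉ entries σ → Tuple Label (suc k)
cons (tuple σ ls ds) {y} l y∉σ = tuple (y ∷ σ) (l ∷ ls) (∉⇒All≢ y∉σ ∷ ds)

-- Case analysis at the end of a tuple, where `append` adds its entry, while vectors are built from
-- the front.
unsnoc : ∀ {Label k} (t : Tuple Label (suc k)) →
         ∃₂ λ (s : Tuple Label k) (c : ℕ) → Label c × c ∉ entries s × entries t ≡ entries s ∷ʳ c
unsnoc (tuple (x ∷ []) (l ∷ []) _) = ∅ , x , l , (λ ()) , ≡.refl
unsnoc (tuple (x ∷ xs@(_ ∷ _)) (l ∷ ls) (d ∷ ds)) with unsnoc (tuple xs ls ds)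
... | s , c , lc , c∉s , eq = cons s l (λ x∈s → x∉ (≡.subst (x ∈_) (≡.sym eq) (∈-∷ʳ x∈s)))
    , c , lc
    , (λ { (here c≡x) → x∉ (≡.subst (x ∈_) (≡.sym eq)
        (≡.subst (_∈ entries s ∷ʳ c) c≡x (last∈ (entries s))))
         ; (there c∈s) → c∉s c∈s })
    , ≡.cong (x ∷_) eq
  where
  x∉ : x ∉ xs
  x∉ = ∉-∷⁻ d
  ∈-∷ʳ : ∀ {k} {xs : Vec ℕ k} {x y} → x ∈ xs → x ∈ xs ∷ʳ y
  ∈-∷ʳ (here e)  = here e
  ∈-∷ʳ (there p) = there (∈-∷ʳ p)
  last∈ : ∀ {k} (xs : Vec ℕ k) {y} → y ∈ xs ∷ʳ y
  last∈ []       = here ≡.refl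
  last∈ (_ ∷ xs) = there (last∈ xs)

rotate : ∀ {Label k} → Tuple Label (suc k) → Tuple Label (suc k)
rotate (tuple (x ∷ xs) (l ∷ ls) (d ∷ ds)) = append (tuple xs ls ds) l (∉-∷⁻ d)

-- `K x u` records what is known about a result u of f at x; R has to follow from Q together with
-- this knowledge.
mapMaybe-AllPairs : {A B : Set} {f : A → Maybe B} {Q : A → A → Set} {R : B → B → Set} (K : A → B →
    Set) →
  (∀ x → MaybeAll.All (K x) (f x)) → (∀ {x y u v} → Q x y → K x u → K y v → R u v) →
  ∀ {xs} → AllPairs Q xs → AllPairs R (List.mapMaybe f xs)
mapMaybe-AllPairs K k r []         = []
mapMaybe-AllPairs {f = f} {Q} {R} K k r (_∷_ {x} {xs} q qs) with f x | k x
... | nothing | _                = mapMaybe-AllPairs K k r qs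
... | just u  | MaybeAll.just ku =
  Allₚ.mapMaybe⁺ (Allₚ.map⁺ (All.map (λ {y} q → MaybeAll.map (r q ku) (k y)) q)) ∷
  mapMaybe-AllPairs K k r qs

-- The step function of extensions, which is local to its definition, recovered by unification.
mutual
  extend : ∀ {Label k} b → (∀ {y} → 1 ≤ y → y ≤ b → Label y) → Tuple Label k →
           Fin b → Maybe (ℕ × Tuple Label (suc k))
  extend = _

  extensions-mapMaybe : ∀ {Label k} b (label : ∀ {y} → 1 ≤ y → y ≤ b → Label y)
      (σ : Tuple Label k) →
    extensions b label σ ≡ List.mapMaybe (extend b label σ) (List.allFin b)
  extensions-mapMaybe b label σ = ≡.refl

module _ {Label : ℕ → Set} {k : ℕ} (b : ℕ) (label : ∀ {y} → 1 ≤ y → y ≤ b → Label y)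
         (σ : Tuple Label k) where

  extend-All : ∀ d → MaybeAll.All
    (λ (y , t) → y ≡ suc (toℕ d) × (1 ≤ y × y ≤ b) × entries t ≡ entries σ ∷ʳ y)
        (extend b label σ d)
  extend-All d with suc (toℕ d) ∈? entries σ
  ... | yes _ = MaybeAll.nothing
  ... | no  _ = MaybeAll.just (≡.refl , (s≤s z≤n , Finₚ.toℕ<n d) , ≡.refl)

  extensions-All : All (λ (y , t) → (1 ≤ y × y ≤ b) × entries t ≡ entries σ ∷ʳ y)
      (extensions b label σ)
  extensions-All = Allₚ.mapMaybe⁺ (Allₚ.map⁺ (Allₚ.tabulate⁺ λ d →
      MaybeAll.map proj₂ (extend-All d)))

  extensions-distinct : AllPairs (λ (y , _) (z , _) → y ≢ z) (extensions b label σ)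
  extensions-distinct = mapMaybe-AllPairs
    (λ d (y , _) → y ≡ suc (toℕ d)) (λ d → MaybeAll.map proj₁ (extend-All d))
    (λ { i≢j ≡.refl ≡.refl eq → i≢j (Finₚ.toℕ-injective (ℕₚ.suc-injective eq)) })
    (AllPairsₚ.tabulate⁺ {f = id} id)

  module _ (R : CommutativeRing 0ℓ 0ℓ) where
    open CommutativeRing R hiding (zero)
    open ListSums R

    -- H takes the vector of entries and not the tuple, so that the right side makes sense for y ∈ σ
    -- too, where no extended tuple exists and the bracket is 0.
    extensions-sum : ∀ (H : ℕ → Vec ℕ (suc k) → Carrier) →
      listSum (λ (y , t) → H y (entries t)) (extensions b label σ) ≈
      sum {b} (λ d → ⟦ ¬? (suc (toℕ d) ∈? entries σ) ⟧ * H (suc (toℕ d))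
          (entries σ ∷ʳ suc (toℕ d)))
    extensions-sum H = trans
      (listSum-mapMaybe (λ (y , t) → H y (entries t)) (extend b label σ) (List.allFin b))
      (trans (listSum-cong term (List.allFin b))
        (reflexive (listSum-tabulate (λ d → ⟦ ¬? (suc (toℕ d) ∈? entries σ) ⟧ *
                          H (suc (toℕ d)) (entries σ ∷ʳ suc (toℕ d))) {b} id)))
      where
      term : ∀ d → maybe (λ (y , t) → H y (entries t)) 0# (extend b label σ d) ≈
                   ⟦ ¬? (suc (toℕ d) ∈? entries σ) ⟧ * H (suc (toℕ d)) (entries σ ∷ʳ suc (toℕ d))
      term d with suc (toℕ d) ∈? entries σ
      ... | yes y∈σ = sym (trans (*-congʳ (⟦⟧-no (¬? (yes y∈σ)) (λ y∉σ → y∉σ y∈σ))) (zeroˡ _))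
      ... | no  y∉σ = sym (trans (*-congʳ (⟦⟧-yes (¬? (no y∉σ)) y∉σ)) (*-identityˡ _))

-- Coefficients of vectors at tuples of colours

module ColourAlgebra
  (R : CommutativeRing 0ℓ 0ℓ) (N : ℕ) (X : ℕ → CommutativeRing.Carrier R)
  (X-out : ∀ y → ¬ (1 ≤ y × y ≤ N) → CommutativeRing._≈_ R (X y) (CommutativeRing.0# R)) where
  open CommutativeRing R hiding (zero)
  open ListSums R
  open SetoidReasoning setoid
  open FiniteColours N using (InRange; Iᴺ; colours; enumerate)

  module W (k : ℕ) = FreeProperties R (tuples InRange k)

  δ : ∀ {k} → Vec ℕ k → Vec ℕ k → Carrier
  δ xs ys = ⟦ Vecₚ.≡-dec ℕₚ._≟_ xs ys ⟧

  χ : ∀ {k} → ℕ → Vec ℕ k → Carrier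
  χ c xs = ⟦ ¬? (c ∈? xs) ⟧

  δ-∷ : ∀ {k} x y (xs ys : Vec ℕ k) → δ (x ∷ xs) (y ∷ ys) ≈ ⟦ x ℕₚ.≟ y ⟧ * δ xs ys
  δ-∷ x y xs ys = ⟦⟧-× _ _ _ Vecₚ.∷-injective (≡.cong₂ _∷_)

  δ-∷ʳ : ∀ {k} x y (xs ys : Vec ℕ k) → δ (xs ∷ʳ x) (ys ∷ʳ y) ≈ ⟦ x ℕₚ.≟ y ⟧ * δ xs ys
  δ-∷ʳ x y xs ys = ⟦⟧-× _ _ _
    (λ eq → Vecₚ.∷ʳ-injectiveʳ xs ys eq , Vecₚ.∷ʳ-injectiveˡ xs ys eq)
    (λ x≡y xs≡ys → ≡.cong₂ _∷ʳ_ xs≡ys x≡y)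

  δ-subst : ∀ {k} (f : Vec ℕ k → Carrier) xs ys → f xs * δ xs ys ≈ f ys * δ xs ys
  δ-subst f xs ys = by-cases (Vecₚ.≡-dec ℕₚ._≟_ xs ys)
    where
    by-cases : (P? : Dec (xs ≡ ys)) → f xs * ⟦ P? ⟧ ≈ f ys * ⟦ P? ⟧
    by-cases (yes ≡.refl) = refl
    by-cases P?@(no xs≢ys) = trans (vanish (f xs)) (sym (vanish (f ys)))
      where
      vanish : ∀ a → a * ⟦ P? ⟧ ≈ 0#
      vanish a = trans (*-congˡ (⟦⟧-no P? xs≢ys)) (zeroʳ a)

  χ-∷ : ∀ {k} c d (xs : Vec ℕ k) → χ c (d ∷ xs) ≈ ⟦ ¬? (c ℕₚ.≟ d) ⟧ * χ c xs
  χ-∷ c d xs = ⟦⟧-× _ _ _ (λ c∉ → (c∉ ∘ here) , (c∉ ∘ there))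
    (λ { c≢d c∉ (here c≡d) → c≢d c≡d ; c≢d c∉ (there c∈) → c∉ c∈ })

  abstract
    colourSum : (ℕ → Carrier) → Carrier
    colourSum f = sum {N} (λ d → f (suc (toℕ d)))

    colourSum-sum : ∀ f → colourSum f ≡ sum {N} (λ d → f (suc (toℕ d)))
    colourSum-sum f = ≡.refl

    colourSum-cong : ∀ {f g : ℕ → Carrier} → (∀ d → f d ≈ g d) → colourSum f ≈ colourSum g
    colourSum-cong {f} {g} e = sum-cong-≋ {N} {λ d → f (suc (toℕ d))} {λ d → g (suc (toℕ d))}
      (λ d → e (suc (toℕ d)))

    colourSum-cong-InRange : ∀ {f g : ℕ → Carrier} → (∀ d → InRange d → f d ≈ g d) →
        colourSum f ≈ colourSum g
    colourSum-cong-InRange {f} {g} e = sum-cong-≋ {N} {λ d → f (suc (toℕ d))} {λ d →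
        g (suc (toℕ d))}
      (λ d → e (suc (toℕ d)) (s≤s z≤n , Finₚ.toℕ<n d))

    colourSum-zero : ∀ {f : ℕ → Carrier} → (∀ d → InRange d → f d ≈ 0#) → colourSum f ≈ 0#
    colourSum-zero {f} e = sum-zero {N} {λ d → f (suc (toℕ d))} (λ d →
        e (suc (toℕ d)) (s≤s z≤n , Finₚ.toℕ<n d))

    pairing-colourSum : ∀ {B : DecSetoid 0ℓ 0ℓ} (let module B = FreeProperties R B)
      (f : ℕ → DecSetoid.Carrier B → Carrier) p →
      B.pairing (λ b → colourSum (λ d → f d b)) p ≈ colourSum (λ d → B.pairing (f d) p)
    pairing-colourSum {B} f p = FreeProperties.pairing-sum R B {N} (λ d → f (suc (toℕ d))) p

    colourSum-+ : ∀ f g → colourSum (λ d → f d + g d) ≈ colourSum f + colourSum g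
    colourSum-+ f g = ∑-distrib-+ {N} (λ d → f (suc (toℕ d))) (λ d → g (suc (toℕ d)))

    colourSum-* : ∀ a f → colourSum (λ d → a * f d) ≈ a * colourSum f
    colourSum-* a f = sym (*-distribˡ-sum {N} a (λ d → f (suc (toℕ d))))

    colourSum-single : ∀ (f : ℕ → Carrier) {c} → InRange c →
        colourSum (λ d → f d * ⟦ d ℕₚ.≟ c ⟧) ≈ f c
    colourSum-single f {suc c} (_ , c<N) = trans
      (sum-⟦⟧ (Fin.fromℕ< c<N) (λ d → f (suc (toℕ d))) (λ d → suc (toℕ d) ℕₚ.≟ suc c)
        (≡.cong suc (Finₚ.toℕ-fromℕ< c<N))
        (λ d eq → Finₚ.toℕ-injective (≡.trans (ℕₚ.suc-injective eq)
            (≡.sym (Finₚ.toℕ-fromℕ< c<N)))))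
      (reflexive (≡.cong (λ d → f (suc d)) (Finₚ.toℕ-fromℕ< c<N)))

    colourSum-none : ∀ (f : ℕ → Carrier) {c} → ¬ InRange c →
        colourSum (λ d → f d * ⟦ d ℕₚ.≟ c ⟧) ≈ 0#
    colourSum-none f {c} c∉N = sum-zero {N} {λ d → f (suc (toℕ d)) * ⟦ suc (toℕ d) ℕₚ.≟ c ⟧} λ d →
      trans (*-congˡ (⟦⟧-no (suc (toℕ d) ℕₚ.≟ c) λ { ≡.refl → c∉N (s≤s z≤n , Finₚ.toℕ<n d) }))
          (zeroʳ _)

  colourSum-remove : ∀ (f : ℕ → Carrier) {c} → InRange c →
                     colourSum f ≈ colourSum (λ d → ⟦ ¬? (d ℕₚ.≟ c) ⟧ * f d) + f c
  colourSum-remove f {c} c∈N = begin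
    colourSum f
      ≈⟨ colourSum-cong split ⟩
    colourSum (λ d → ⟦ ¬? (d ℕₚ.≟ c) ⟧ * f d + f d * ⟦ d ℕₚ.≟ c ⟧)
      ≈⟨ colourSum-+ _ _ ⟩
    colourSum (λ d → ⟦ ¬? (d ℕₚ.≟ c) ⟧ * f d) + colourSum (λ d → f d * ⟦ d ℕₚ.≟ c ⟧)
      ≈⟨ +-congˡ (colourSum-single f c∈N) ⟩
    colourSum (λ d → ⟦ ¬? (d ℕₚ.≟ c) ⟧ * f d) + f c ∎
    where
    split : ∀ d → f d ≈ ⟦ ¬? (d ℕₚ.≟ c) ⟧ * f d + f d * ⟦ d ℕₚ.≟ c ⟧
    split d = ⟦⟧-split (d ℕₚ.≟ c) (f d)

  -- The coefficient of v at an arbitrary vector of colours, which is 0 unless the vector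
  -- consists of distinct elements of {1,…,N}.
  infixl 8 _at_
  _at_ : ∀ {k} → W.Combination k → Vec ℕ k → Carrier
  _at_ {k} v xs = W.pairing k (λ t → δ (entries t) xs) v

  coefficient-at : ∀ {k} (v : W.Combination k) t → W.coefficient k v t ≈ v at entries t
  coefficient-at {k} v t = W.coefficient-pairing k v t

  at-invalid : ∀ {k} (v : W.Combination k) xs → (∀ (t : Iᴺ k) → entries t ≢ xs) → v at xs ≈ 0#
  at-invalid {k} v xs invalid = trans
    (W.pairing-ext k (λ t → ⟦⟧-no (Vecₚ.≡-dec ℕₚ._≟_ (entries t) xs) (invalid t)) v)
    (W.pairing-0 k v)

  at-++ : ∀ {k} (v w : W.Combination k) xs → (v ++ w) at xs ≈ v at xs + w at xs
  at-++ {k} v w xs = W.pairing-++ k (λ t → δ (entries t) xs) v w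

  at-scale : ∀ {k} a (v : W.Combination k) xs → W.scale k a v at xs ≈ a * v at xs
  at-scale {k} a v xs = W.pairing-scale k (λ t → δ (entries t) xs) a v

  at-basis : ∀ {k} (t : Iᴺ k) xs → W.basis k t at xs ≈ δ (entries t) xs
  at-basis {k} t xs = W.pairing-basis k (λ t → δ (entries t) xs) t

  at-linear : ∀ {k l} (f : Iᴺ k → W.Combination l) v xs →
              linear (W.freeModule l) f v at xs ≈ W.pairing k (λ t → f t at xs) v
  at-linear {k} {l} f v xs = linear-∘ {R} {tuples InRange l} TensorUnit.⟨module⟩ (λ t →
      δ (entries t) xs) f v

  at-cong : ∀ {k} {v w : W.Combination k} → W._≋_ k v w → ∀ xs → v at xs ≈ w at xs
  at-cong {k} v≋w xs = W.pairing-cong k (λ { {s} {t} s∼t →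
    reflexive (≡.cong (λ ys → δ ys xs) s∼t) }) v≋w

  ≋-at : ∀ {k} {v w : W.Combination k} → (∀ t → v at entries t ≈ w at entries t) → W._≋_ k v w
  ≋-at {k} {v} {w} e = W.mk≋ λ t → trans (coefficient-at v t)
      (trans (e t) (sym (coefficient-at w t)))

  ≋-at-∷ʳ : ∀ {k} {v w : W.Combination (suc k)} →
    (∀ (s : Iᴺ k) c → InRange c → c ∉ entries s → v at (entries s ∷ʳ c) ≈ w at (entries s ∷ʳ c)) →
    W._≋_ (suc k) v w
  ≋-at-∷ʳ {k} {v} {w} e = ≋-at λ t → let s , c , c∈N , c∉s , eq = unsnoc t in
    ≡.subst (λ xs → v at xs ≈ w at xs) (≡.sym eq) (e s c c∈N c∉s)

  -- `raise` and `lower` are the operators M̂ and D̂ of the finite-colour setting over an arbitrary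
  -- ring, with the values X c in place of x_c.
  raise : ∀ k → W.Combination k → W.Combination (suc k)
  raise k = linear (W.freeModule (suc k)) λ i → List.map (λ (c , ic) → X c , ic) (colours i)

  lower : ∀ k → W.Combination (suc k) → W.Combination k
  lower k = linear (W.freeModule k) λ i → (1# , rest i) ∷ []

  private
    colours-at : ∀ {k} (w : ℕ → Carrier) (i : Iᴺ k) js c →
      listSum (λ (d , t) → w d * δ (entries t) (js ∷ʳ c)) (colours i) ≈
      colourSum (λ d → (χ d (entries i) * w d * δ (entries i) js) * ⟦ d ℕₚ.≟ c ⟧)
    colours-at w i js c = trans (extensions-sum N _,_ i R (λ d t → w d * δ t (js ∷ʳ c)))
      (trans (reflexive (≡.sym (colourSum-sum λ d → χ d (entries i) *
          (w d * δ (entries i ∷ʳ d) (js ∷ʳ c)))))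
      (colourSum-cong λ d → trans
        (*-congˡ (*-congˡ (δ-∷ʳ d c (entries i) js)))
        (solve 4 (λ a w p q → a ⊠ (w ⊠ (p ⊠ q)) ⊜ (a ⊠ w ⊠ q) ⊠ p) refl
          (χ d (entries i)) (w d) (⟦ d ℕₚ.≟ c ⟧) (δ (entries i) js))))
      where
      open NaturalCoefficientsSolver commutativeSemiring using (solve)
        renaming (_:*_ to _⊠_; _:=_ to _⊜_)

  -- No validity of js or c is assumed: a repeated colour is killed by `χ c js`, a colour outside
  -- {1,...,N} by `X-out`, and an invalid js by `v at js`. This lets the formula be used under a sum
  -- over all colours.
  raise-at : ∀ {k} (v : W.Combination k) js c → raise k v at (js ∷ʳ c) ≈ χ c js * X c * v at js
  raise-at {k} v js c = trans (at-linear _ v (js ∷ʳ c)) (trans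
    (W.pairing-ext k basis-at v) (W.pairing-* k (χ c js * X c) _ v))
    where
    collapse : ∀ (i : Iᴺ k) → colourSum (λ d → (χ d (entries i) * X d * δ (entries i) js) *
        ⟦ d ℕₚ.≟ c ⟧) ≈
                              χ c (entries i) * X c * δ (entries i) js
    collapse i with 1 ℕₚ.≤? c | c ℕₚ.≤? N
    ... | yes 1≤c | yes c≤N =
      colourSum-single (λ d → χ d (entries i) * X d * δ (entries i) js) (1≤c , c≤N)
    ... | no 1≰c | _ = outside (1≰c ∘ proj₁)
      where
      outside : ¬ InRange c → _ ≈ _
      outside c∉N = trans (colourSum-none (λ d → χ d (entries i) * X d * δ (entries i) js) c∉N)
        (sym (trans (*-congʳ (trans (*-congˡ (X-out c c∉N)) (zeroʳ _))) (zeroˡ _)))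
    ... | yes _ | no c≰N = outside (c≰N ∘ proj₂)
      where
      outside : ¬ InRange c → _ ≈ _
      outside c∉N = trans (colourSum-none (λ d → χ d (entries i) * X d * δ (entries i) js) c∉N)
        (sym (trans (*-congʳ (trans (*-congˡ (X-out c c∉N)) (zeroʳ _))) (zeroˡ _)))
    basis-at : ∀ i → List.map (λ (d , t) → X d , t) (colours i) at (js ∷ʳ c) ≈
                     χ c js * X c * δ (entries i) js
    basis-at i = trans
      (reflexive (W.pairing-map (suc k) _ (X ∘ proj₁) proj₂ (colours i)))
      (trans (colours-at X i js c) (trans (collapse i)
        (δ-subst (λ is → χ c is * X c) (entries i) js)))

  -- The sum may run over all colours d, since v vanishes at vectors with a repeated entry.
  lower-at : ∀ {k} (v : W.Combination (suc k)) js →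
      lower k v at js ≈ colourSum (λ d → v at (d ∷ js))
  lower-at {k} v js = trans (at-linear _ v js) (trans
    (W.pairing-ext (suc k) basis-at v) 
    (pairing-colourSum {tuples InRange (suc k)} (λ d i → δ (entries i) (d ∷ js)) v))
    where
    basis-at : ∀ i → ((1# , rest i) ∷ []) at js ≈ colourSum (λ d → δ (entries i) (d ∷ js))
    basis-at (tuple (h ∷ is) (h∈N ∷ _) (_ ∷ _)) = begin
      1# * δ is js + 0#
        ≈⟨ trans (+-identityʳ _) (*-identityˡ _) ⟩
      δ is js
        ≈⟨ colourSum-single (λ _ → δ is js) h∈N ⟨
      colourSum (λ d → δ is js * ⟦ d ℕₚ.≟ h ⟧)
        ≈⟨ colourSum-cong (λ d → trans (*-comm _ _) (trans
             (*-congʳ (⟦⟧-cong (d ℕₚ.≟ h) (h ℕₚ.≟ d) ≡.sym ≡.sym)) (sym (δ-∷ h d is js)))) ⟩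
      colourSum (λ d → δ (h ∷ is) (d ∷ js)) ∎

  -- Induction on k: a tuple arises from exactly one shorter tuple, by appending exactly one colour.
  count : ∀ {k} (t : Iᴺ k) → listSum (λ i → δ (entries i) (entries t)) (enumerate k) ≈ 1#
  count {zero}  (tuple [] [] []) = trans (+-identityʳ _) (⟦⟧-yes (Vecₚ.≡-dec ℕₚ._≟_ [] []) ≡.refl)
  count {suc k} t with unsnoc t
  ... | s , c , c∈N , c∉s , eq = begin
    listSum (λ i → δ (entries i) (entries t)) (enumerate (suc k))
      ≈⟨ listSum-cong (λ i → reflexive (≡.cong (δ (entries i)) eq)) (enumerate (suc k)) ⟩
    listSum (λ i → δ (entries i) (js ∷ʳ c)) (enumerate (suc k))
      ≈⟨ listSum-concatMap _ (List.map proj₂ ∘ colours) (enumerate k) ⟩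
    listSum (λ i → listSum (λ i → δ (entries i) (js ∷ʳ c)) (List.map proj₂ (colours i)))
        (enumerate k)
      ≈⟨ listSum-cong inner (enumerate k) ⟩
    listSum (λ i → δ (entries i) js) (enumerate k)
      ≈⟨ count s ⟩
    1# ∎
    where
    js = entries s
    inner : ∀ i → listSum (λ i → δ (entries i) (js ∷ʳ c)) (List.map proj₂ (colours i)) ≈ δ
        (entries i) js
    inner i = begin
      listSum (λ i → δ (entries i) (js ∷ʳ c)) (List.map proj₂ (colours i))
        ≡⟨ listSum-map _ proj₂ (colours i) ⟩
      listSum (λ (d , t) → δ (entries t) (js ∷ʳ c)) (colours i)
        ≈⟨ listSum-cong (λ _ → sym (*-identityˡ _)) (colours i) ⟩
      listSum (λ (d , t) → 1# * δ (entries t) (js ∷ʳ c)) (colours i)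
        ≈⟨ colours-at (λ _ → 1#) i js c ⟩
      colourSum (λ d → (χ d (entries i) * 1# * δ (entries i) js) * ⟦ d ℕₚ.≟ c ⟧)
        ≈⟨ colourSum-single (λ d → χ d (entries i) * 1# * δ (entries i) js) c∈N ⟩
      χ c (entries i) * 1# * δ (entries i) js
        ≈⟨ δ-subst (λ is → χ c is * 1#) (entries i) js ⟩
      χ c js * 1# * δ (entries i) js
        ≈⟨ *-congʳ (trans (*-identityʳ _) (⟦⟧-yes (¬? (c ∈? js)) c∉s)) ⟩
      1# * δ (entries i) js
        ≈⟨ *-identityˡ _ ⟩
      δ (entries i) js ∎

  enumerate-at : ∀ {k} (f : Vec ℕ k → Carrier) (t : Iᴺ k) →
    List.map (λ i → f (entries i) , i) (enumerate k) at entries t ≈ f (entries t)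
  enumerate-at {k} f t = begin
    List.map (λ i → f (entries i) , i) (enumerate k) at entries t
      ≡⟨ W.pairing-map k _ (f ∘ entries) id (enumerate k) ⟩
    listSum (λ i → f (entries i) * δ (entries i) (entries t)) (enumerate k)
      ≈⟨ listSum-cong (λ i → δ-subst f (entries i) (entries t)) (enumerate k) ⟩
    listSum (λ i → f (entries t) * δ (entries i) (entries t)) (enumerate k)
      ≈⟨ listSum-*ˡ (f (entries t)) _ (enumerate k) ⟩
    f (entries t) * listSum (λ i → δ (entries i) (entries t)) (enumerate k)
      ≈⟨ trans (*-congˡ (count t)) (*-identityʳ _) ⟩
    f (entries t) ∎

  expansion : ∀ {k} (v : W.Combination k) →
    W._≋_ k v (List.map (λ i → v at entries i , i) (enumerate k))
  expansion v = ≋-at λ t → sym (enumerate-at (v at_) t)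

-- Generating the whole space by `raise` and `lower`

module ColourInversion
  (R : CommutativeRing 0ℓ 0ℓ) (R-field : IsDiscreteField R)
  (N : ℕ) (X : ℕ → CommutativeRing.Carrier R)
  (X-out : ∀ y → ¬ (1 ≤ y × y ≤ N) → CommutativeRing._≈_ R (X y) (CommutativeRing.0# R))
  (X≉0 : ∀ y → 1 ≤ y × y ≤ N → ¬ CommutativeRing._≈_ R (X y) (CommutativeRing.0# R))
  (X-injective : ∀ y z → 1 ≤ y × y ≤ N → 1 ≤ z × z ≤ N →
                 CommutativeRing._≈_ R (X y) (X z) → y ≡ z)
  where
  open CommutativeRing R hiding (zero)
  open IsDiscreteField R-field
  open ListSums R
  open SetoidReasoning setoid
  open FiniteColours N using (InRange; Iᴺ; colours; enumerate)
  open ColourAlgebra R N X X-out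
  module Wᴹ (k : ℕ) = Module (W.freeModule k)
  module Wᴸ (k l : ℕ) = LinearProperties {R} {tuples InRange k} (W.freeModule l)

  spin : ∀ k → W.Combination (suc k) → W.Combination (suc k)
  spin k = linear (W.freeModule (suc k)) λ t → (X (Vec.head (entries t)) , rotate t) ∷ []

  spin-at : ∀ {k} (v : W.Combination (suc k)) js c → spin k v at (js ∷ʳ c) ≈ X c * v at (c ∷ js)
  spin-at {k} v js c = trans (at-linear _ v (js ∷ʳ c))
    (trans (W.pairing-ext (suc k) basis-at v) (W.pairing-* (suc k) (X c) (λ t →
        δ (entries t) (c ∷ js)) v))
    where
    basis-at : ∀ t → ((X (Vec.head (entries t)) , rotate t) ∷ []) at (js ∷ʳ c) ≈ X c * δ
        (entries t) (c ∷ js)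
    basis-at t@(tuple (x ∷ xs) (_ ∷ _) (_ ∷ _)) = begin
      X x * δ (xs ∷ʳ x) (js ∷ʳ c) + 0#      ≈⟨ +-identityʳ _ ⟩
      X x * δ (xs ∷ʳ x) (js ∷ʳ c)           ≈⟨ *-congˡ
          (trans (δ-∷ʳ x c xs js) (sym (δ-∷ x c xs js))) ⟩
      X x * δ (x ∷ xs) (c ∷ js)             ≈⟨ δ-subst (λ ys → X (Vec.head ys)) (x ∷ xs) (c ∷ js)
          ⟩
      X c * δ (x ∷ xs) (c ∷ js)             ∎

  -- Once `lower` has removed the first colour, `raise` may append that same colour again; in the
  -- opposite order it is still present and may not be appended. This one extra term is `spin`.
  raise-lower : ∀ k v → W._≋_ (suc k) (raise k (lower k v))
      (lower (suc k) (raise (suc k) v) ++ spin k v)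
  raise-lower k v = ≋-at-∷ʳ {v = raise k (lower k v)} {w =
      lower (suc k) (raise (suc k) v) ++ spin k v}
    λ s c c∈N c∉s → let js = entries s in begin
    raise k (lower k v) at (js ∷ʳ c)
      ≈⟨ raise-at (lower k v) js c ⟩
    χ c js * X c * lower k v at js
      ≈⟨ *-cong (trans (*-congʳ (⟦⟧-yes (¬? (c ∈? js)) c∉s)) (*-identityˡ _)) (lower-at v js) ⟩
    X c * colourSum (λ d → v at (d ∷ js))
      ≈⟨ *-congˡ (colourSum-remove (λ d → v at (d ∷ js)) c∈N) ⟩
    X c * (colourSum (λ d → ⟦ ¬? (d ℕₚ.≟ c) ⟧ * v at (d ∷ js)) + v at (c ∷ js))
      ≈⟨ distribˡ _ _ _ ⟩
    X c * colourSum (λ d → ⟦ ¬? (d ℕₚ.≟ c) ⟧ * v at (d ∷ js)) + X c * v at (c ∷ js)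
      ≈⟨ +-cong (trans (sym (colourSum-* (X c) _)) (colourSum-cong (λ d → term js c∉s d)))
                (sym (spin-at v js c)) ⟩
    colourSum (λ d → raise (suc k) v at (d ∷ (js ∷ʳ c))) + spin k v at (js ∷ʳ c)
      ≈⟨ +-congʳ (lower-at (raise (suc k) v) (js ∷ʳ c)) ⟨
    lower (suc k) (raise (suc k) v) at (js ∷ʳ c) + spin k v at (js ∷ʳ c)
      ≈⟨ at-++ (lower (suc k) (raise (suc k) v)) (spin k v) (js ∷ʳ c) ⟨
    (lower (suc k) (raise (suc k) v) ++ spin k v) at (js ∷ʳ c) ∎
    where
    term : ∀ (js : Vec ℕ k) {c} → c ∉ js → ∀ d →
           X c * (⟦ ¬? (d ℕₚ.≟ c) ⟧ * v at (d ∷ js)) ≈ raise (suc k) v at (d ∷ (js ∷ʳ c))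
    term js {c} c∉js d = begin
      X c * (⟦ ¬? (d ℕₚ.≟ c) ⟧ * v at (d ∷ js))
        ≈⟨ trans (sym (*-assoc _ _ _)) (*-congʳ (*-comm _ _)) ⟩
      ⟦ ¬? (d ℕₚ.≟ c) ⟧ * X c * v at (d ∷ js)
        ≈⟨ *-congʳ (*-congʳ (trans (⟦⟧-cong (¬? (d ℕₚ.≟ c)) (¬? (c ℕₚ.≟ d)) (_∘ ≡.sym) (_∘ ≡.sym))
             (sym (trans (*-congˡ (⟦⟧-yes (¬? (c ∈? js)) c∉js)) (*-identityʳ _))))) ⟩
      ⟦ ¬? (c ℕₚ.≟ d) ⟧ * χ c js * X c * v at (d ∷ js)
        ≈⟨ *-congʳ (*-congʳ (χ-∷ c d js)) ⟨
      χ c (d ∷ js) * X c * v at (d ∷ js)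
        ≈⟨ raise-at v (d ∷ js) c ⟨
      raise (suc k) v at (d ∷ (js ∷ʳ c)) ∎

  iterate : {A : Set} → ℕ → (A → A) → A → A
  iterate zero    f a = a
  iterate (suc n) f a = iterate n f (f a)

  -- The scalar that n applications of `spin` collect on the basis vector of t.
  headProduct : ∀ {k} → ℕ → Iᴺ (suc k) → Carrier
  headProduct zero    t = 1#
  headProduct (suc n) t = X (Vec.head (entries t)) * headProduct n (rotate t)

  iterate-spin : ∀ {k} n v → W._≋_ (suc k) (iterate n (spin k) v)
    (linear (W.freeModule (suc k)) (λ t → W.scale (suc k) (headProduct n t)
        (W.basis (suc k) (iterate n rotate t))) v)
  iterate-spin {k} zero v = ≋-at {v = v} {w = linear (W.freeModule (suc k)) f v} λ u →
      sym (trans (at-linear f v (entries u))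
    (W.pairing-ext (suc k) (λ t → trans (at-scale 1# (W.basis (suc k) t) (entries u))
      (trans (*-identityˡ _) (at-basis t (entries u)))) v))
    where
    f : Iᴺ (suc k) → W.Combination (suc k)
    f t = W.scale (suc k) 1# (W.basis (suc k) t)
  iterate-spin {k} (suc n) v = ≈ᴹ-trans (iterate-spin n (spin k v))
    (≈ᴹ-trans (linear-∘ {R} {tuples InRange (suc k)} (W.freeModule (suc k)) g _ v)
      (Wᴸ.linear-ext (suc k) (suc k) (λ t → ≈ᴹ-trans (+ᴹ-identityʳ _) (≈ᴹ-sym (*ₗ-assoc _ _ _)))
          v))
    where
    open Wᴹ (suc k)
    g : Iᴺ (suc k) → W.Combination (suc k)
    g t = W.scale (suc k) (headProduct n t) (W.basis (suc k) (iterate n rotate t))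

  weight : ∀ {k} → Vec ℕ k → Carrier
  weight []       = 1#
  weight (x ∷ xs) = X x * weight xs

  weight-∷ʳ : ∀ {k} (xs : Vec ℕ k) c → weight (xs ∷ʳ c) ≈ X c * weight xs
  weight-∷ʳ []       c = refl
  weight-∷ʳ (x ∷ xs) c = trans (*-congˡ (weight-∷ʳ xs c))
    (trans (sym (*-assoc _ _ _)) (trans (*-congʳ (*-comm _ _)) (*-assoc _ _ _)))

  weight≉0 : ∀ {k} {xs : Vec ℕ k} → Allᵛ.All InRange xs → ¬ weight xs ≈ 0#
  weight≉0 []        w≈0 = 1≉0 w≈0
  weight≉0 (x ∷ xs) w≈0 = weight≉0 xs (*-cancel-0 (X≉0 _ x) w≈0)

  private
    -- The first l rotations move the prefix p to the end and collect its weight. The statement is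
    -- about lists because the lengths of p and q add up to that of t only propositionally; with p
    -- all of t and q empty it gives `full-turn`.
    headProduct-prefix : ∀ {k l} (p : Vec ℕ l) (q : List ℕ) (t : Iᴺ (suc k)) →
      Vec.toList (entries t) ≡ Vec.toList p ++ q →
      headProduct l t ≡ weight p × Vec.toList (entries (iterate l rotate t)) ≡ q ++ Vec.toList p
    headProduct-prefix []      q t eq = ≡.refl , ≡.trans eq (≡.sym (Listₚ.++-identityʳ q))
    headProduct-prefix (x ∷ p) q t@(tuple (y ∷ ys) (l ∷ ls) (d ∷ ds)) eq =
      let e₁ , e₂ = headProduct-prefix p (q ++ x ∷ []) (rotate t) (≡.trans (Vecₚ.toList-∷ʳ y ys)
                      (≡.trans (≡.cong₂ (λ zs z → zs ++ z ∷ []) (Listₚ.∷-injectiveʳ eq)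
                          (Listₚ.∷-injectiveˡ eq))
                        (Listₚ.++-assoc (Vec.toList p) q (x ∷ []))))
      in ≡.cong₂ (λ z a → X z * a) (Listₚ.∷-injectiveˡ eq) e₁
       , ≡.trans e₂ (Listₚ.++-assoc q (x ∷ []) (Vec.toList p))

    full-turn : ∀ {k} (t : Iᴺ (suc k)) → headProduct (suc k) t ≡ weight (entries t) ×
                entries (iterate (suc k) rotate t) ≡ entries t
    full-turn t =
      let e₁ , e₂ = headProduct-prefix (entries t) [] t (≡.sym (Listₚ.++-identityʳ _))
      in e₁ , ≡.trans (≡.sym (Vecₚ.cast-is-id ≡.refl _)) (Vecₚ.toList-injective ≡.refl _ _ e₂)

  stretch : ∀ k → W.Combination k → W.Combination k
  stretch k = linear (W.freeModule k) λ t → W.scale k (weight (entries t)) (W.basis k t)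

  stretch-spin : ∀ k v → W._≋_ (suc k) (iterate (suc k) (spin k) v) (stretch (suc k) v)
  stretch-spin k v = ≈ᴹ-trans (iterate-spin (suc k) v) (Wᴸ.linear-ext (suc k) (suc k)
    (λ t → let e₁ , e₂ = full-turn t in
      *ₗ-cong {y = weight (entries t)} {v = W.basis (suc k) t} (reflexive e₁)
          (W.basis-cong (suc k) e₂)) v)
    where open Wᴹ (suc k)

  module _ (S : ∀ k → Submodule (W.freeModule k)) where
    infix 4 _∈S_
    _∈S_ : ∀ {k} → W.Combination k → Submodule (W.freeModule k) → Set
    v ∈S Sₖ = Submodule._∈ Sₖ v

    module _ (∅∈ : W.basis 0 ∅ ∈S S 0)
             (raise∈ : ∀ k v → v ∈S S k → raise k v ∈S S (suc k))
             (lower∈ : ∀ k v → v ∈S S (suc k) → lower k v ∈S S k) where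

      private
        module SV (k : ℕ) = Vandermonde R R-field (S k)

        spin∈ : ∀ k v → v ∈S S (suc k) → spin k v ∈S S (suc k)
        spin∈ k v v∈ = +ᴹ-cancelʳ-∈ {u = spin k v}
          (∈-resp (≈ᴹ-trans (raise-lower k v) (+ᴹ-comm (lower (suc k) (raise (suc k) v))
              (spin k v)))
            (raise∈ k (lower k v) (lower∈ k v v∈)))
          (lower∈ (suc k) (raise (suc k) v) (raise∈ (suc k) v v∈))
          where
          open SV (suc k)
          open Submodule (S (suc k))
          open Wᴹ (suc k)

        stretch∈ : ∀ k v → v ∈S S (suc k) → stretch (suc k) v ∈S S (suc k)
        stretch∈ k v v∈ = Submodule.∈-resp (S (suc k)) (stretch-spin k v) (iterated (suc k) v v∈)
          where
          iterated : ∀ n v → v ∈S S (suc k) → iterate n (spin k) v ∈S S (suc k)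
          iterated zero    v v∈ = v∈
          iterated (suc n) v v∈ = iterated n (spin k v) (spin∈ k v v∈)

        -- `raise` sends the basis vector of i to a sum of eigenvectors of `stretch` with
        -- eigenvalues X c · weight i. These differ for different c, because X is injective on the
        -- colours and the weight is nonzero. Each component lies in the submodule and is finally
        -- divided by X c.
        step : ∀ k (i : Iᴺ k) → W.basis k i ∈S S k →
               All (λ (_ , t) → W.basis (suc k) t ∈S S (suc k)) (colours i)
        step k i i∈ = undo (colours i) (extensions-All N _,_ i)
          (eigencomponents (W.linear-homomorphism (suc k) (W.freeModule (suc k)) stretch-cong)
            (λ {v} → stretch∈ k v) (List.map component (colours i))
            (Allₚ.map⁺ (All.map eigen (extensions-All N _,_ i)))
            (AllPairsₚ.map⁺ (separated (colours i) (extensions-All N _,_ i)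
                (extensions-distinct N _,_ i)))
            (∈-resp (≈ᴹ-trans
                (Wᴸ.linear-basis k (suc k) (λ i → List.map (λ (c , ic) → X c , ic) (colours i)) i)
                    (moment-components (colours i))) (raise∈ k (W.basis k i) i∈)))
          where
          open SV (suc k)
          open Submodule (S (suc k))
          open Wᴹ (suc k)
          w = weight (entries i)

          component : ℕ × Iᴺ (suc k) → Carrier × W.Combination (suc k)
          component (c , t) = X c * w , W.scale (suc k) (X c) (W.basis (suc k) t)

          stretch-cong : ∀ {s t : Iᴺ (suc k)} → entries s ≡ entries t →
            W._≋_ (suc k) (W.scale (suc k) (weight (entries s)) (W.basis (suc k) s))
                          (W.scale (suc k) (weight (entries t)) (W.basis (suc k) t))
          stretch-cong {s} {t} e = *ₗ-cong {y = weight (entries t)} {v = W.basis (suc k) t}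
            (reflexive (≡.cong weight e)) (W.basis-cong (suc k) e)

          eigen : ∀ {ct : ℕ × Iᴺ (suc k)} → InRange (proj₁ ct) ×
              entries (proj₂ ct) ≡ entries i ∷ʳ proj₁ ct →
            W._≋_ (suc k) (stretch (suc k) (proj₂ (component ct)))
                          (W.scale (suc k) (proj₁ (component ct)) (proj₂ (component ct)))
          eigen {c , t} (_ , e) = ≈ᴹ-trans
            (Wᴸ.linear-scale (suc k) (suc k) g (X c) (W.basis (suc k) t))
            (≈ᴹ-trans (*ₗ-congˡ {X c} {linear (W.freeModule (suc k)) g (W.basis (suc k) t)}
                {W.scale (suc k) (X c * w) β}
                (≈ᴹ-trans (Wᴸ.linear-basis (suc k) (suc k) g t)
                  (*ₗ-congʳ {β} {weight (entries t)} {X c * w}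
                    (trans (reflexive (≡.cong weight e)) (weight-∷ʳ (entries i) c)))))
              (≈ᴹ-trans (≈ᴹ-sym (*ₗ-assoc (X c) (X c * w) β))
                (≈ᴹ-trans (*ₗ-congʳ {β} (*-comm (X c) (X c * w))) (*ₗ-assoc (X c * w) (X c) β))))
            where
            β = W.basis (suc k) t
            g : Iᴺ (suc k) → W.Combination (suc k)
            g t = W.scale (suc k) (weight (entries t)) (W.basis (suc k) t)

          separate : ∀ {c d} → InRange c → InRange d → c ≢ d → ¬ X d * w + - (X c * w) ≈ 0#
          separate c∈N d∈N c≢d e = c≢d (≡.sym (X-injective _ _ d∈N c∈N
            (x∙y⁻¹≈ε⇒x≈y _ _ (*-cancel-0 (weight≉0 (labels i)) (trans (*-comm w _)
              (trans (distribʳ w _ _) (trans (+-congˡ (sym (-‿distribˡ-* _ w))) e)))))))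
            where
            open RingProperties ring using (-‿distribˡ-*)
            open GroupProperties +-group using (x∙y⁻¹≈ε⇒x≈y)

          separated : ∀ cts → All (λ (c , t) → InRange c × entries t ≡ entries i ∷ʳ c) cts →
            AllPairs (λ (c , _) (d , _) → c ≢ d) cts →
            AllPairs (λ ct dt → ¬ proj₁ (component dt) + - proj₁ (component ct) ≈ 0#) cts
          separated []        []               []       = []
          separated (_ ∷ cts) ((c∈N , _) ∷ as) (d ∷ ds) =
            All.zipWith (λ (c≢d , (d∈N , _)) → separate c∈N d∈N c≢d) (d , as) ∷ separated cts as
                ds

          moment-components : ∀ cts → W._≋_ (suc k)
            (List.map (λ (c , ic) → X c , ic) cts) (moment 0 (List.map component cts))
          moment-components []              = ≈ᴹ-refl
          moment-components ((c , t) ∷ cts) = ≈ᴹ-trans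
            (+ᴹ-cong {(X c , t) ∷ []} {W.scale (suc k) 1#
                (W.scale (suc k) (X c) (W.basis (suc k) t))}
                     {List.map (λ (c , ic) → X c , ic) cts} {moment 0 (List.map component cts)}
              (≈ᴹ-trans (≈ᴹ-sym (W.scale-basis (suc k) (X c) t))
                        (≈ᴹ-sym (*ₗ-identityˡ (W.scale (suc k) (X c) (W.basis (suc k) t)))))
              (moment-components cts))
            ≈ᴹ-refl

          undo : ∀ cts → All (λ (c , t) → InRange c × entries t ≡ entries i ∷ʳ c) cts →
                 All (λ (_ , v) → v ∈S S (suc k)) (List.map component cts) →
                 All (λ (_ , t) → W.basis (suc k) t ∈S S (suc k)) cts
          undo []              []               []       = []
          undo ((c , t) ∷ cts) ((c∈N , _) ∷ as) (v∈ ∷ vs) =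
            *ₗ-cancelˡ-∈ {u = W.basis (suc k) t} (X≉0 c c∈N) v∈ ∷ undo cts as vs

      basis∈ : ∀ k → All (λ i → W.basis k i ∈S S k) (enumerate k)
      basis∈ zero    = ∅∈ ∷ []
      basis∈ (suc k) = Allₚ.concat⁺ (Allₚ.map⁺ (All.map (λ {i} i∈ → Allₚ.map⁺ (step k i i∈))
          (basis∈ k)))

      everything∈ : ∀ k v → v ∈S S k
      everything∈ k v = ∈-resp (≈ᴹ-sym (expansion v)) (combine (enumerate k) (basis∈ k))
        where
        open Submodule (S k)
        open Wᴹ k
        combine : ∀ is → All (λ i → W.basis k i ∈S S k) is →
                  List.map (λ i → v at entries i , i) is ∈S S k
        combine []       []         = ∈-0
        combine (i ∷ is) (i∈ ∷ is∈) = ∈-resp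
          (+ᴹ-congʳ {List.map (λ i → v at entries i , i) is}
              {W.scale k (v at entries i) (W.basis k i)}
            {(v at entries i , i) ∷ []} (W.scale-basis k (v at entries i) i))
          (∈-+ (∈-* (v at entries i) i∈) (combine is is∈))

  -- Surjective endomorphisms are injective

  private
    lookup-AllPairs : {A : Set} {Q : A → A → Set} → (∀ {x y} → Q x y → Q y x) →
      ∀ {xs} → AllPairs Q xs → ∀ i j → i ≢ j → Q (List.lookup xs i) (List.lookup xs j)
    lookup-AllPairs Q-sym (q ∷ qs) zero    zero    i≢j = contradiction ≡.refl i≢j
    lookup-AllPairs Q-sym (q ∷ qs) zero    (suc j) i≢j = All.lookup q (∈-lookup j)
    lookup-AllPairs Q-sym (q ∷ qs) (suc i) zero    i≢j = Q-sym (All.lookup q (∈-lookup i))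
    lookup-AllPairs Q-sym (q ∷ qs) (suc i) (suc j) i≢j =
      lookup-AllPairs Q-sym qs i j (i≢j ∘ ≡.cong suc)

  enumerate-distinct : ∀ k → AllPairs (λ s t → entries s ≢ entries t) (enumerate k)
  enumerate-distinct zero    = [] ∷ []
  enumerate-distinct (suc k) = AllPairsₚ.concat⁺
    (Allₚ.map⁺ (All.universal (λ i → AllPairsₚ.map⁺
      (within i (colours i) (extensions-All N _,_ i) (extensions-distinct N _,_ i)))
          (enumerate k)))
    (AllPairsₚ.map⁺ (AllPairs.map (λ {i} {j} → across i j) (enumerate-distinct k)))
    where
    within : ∀ (i : Iᴺ k) cts → All (λ (c , t) → InRange c × entries t ≡ entries i ∷ʳ c) cts →
      AllPairs (λ (c , _) (d , _) → c ≢ d) cts → AllPairs (λ (_ , s) (_ , t) →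
          entries s ≢ entries t) cts
    within i []        []             []       = []
    within i (_ ∷ cts) ((_ , e) ∷ as) (d ∷ ds) =
      All.zipWith (λ (c≢d , (_ , e′)) eq → c≢d (Vecₚ.∷ʳ-injectiveʳ (entries i) (entries i)
        (≡.trans (≡.sym e) (≡.trans eq e′)))) (d , as) ∷ within i cts as ds
    across : ∀ (i j : Iᴺ k) → entries i ≢ entries j →
      All (λ s → All (λ t → entries s ≢ entries t) (List.map proj₂ (colours j)))
          (List.map proj₂ (colours i))
    across i j i≢j = Allₚ.map⁺ (All.map (λ (_ , e) → Allₚ.map⁺ (All.map (λ (_ , e′) eq →
      i≢j (Vecₚ.∷ʳ-injectiveˡ (entries i) (entries j) (≡.trans (≡.sym e) (≡.trans eq e′))))
      (extensions-All N _,_ j))) (extensions-All N _,_ i))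

  combination : ∀ {k m} → (Fin m → Carrier) → (Fin m → W.Combination k) → W.Combination k
  combination {k} {zero}  c w = []
  combination {k} {suc m} c w = W.scale k (c zero) (w zero) ++ combination (c ∘ suc) (w ∘ suc)

  combination-at : ∀ {k m} (c : Fin m → Carrier) (w : Fin m → W.Combination k) xs →
                   combination c w at xs ≈ sum (λ i → c i * w i at xs)
  combination-at {k} {zero}  c w xs = refl
  combination-at {k} {suc m} c w xs = trans
    (at-++ (W.scale k (c zero) (w zero)) (combination (c ∘ suc) (w ∘ suc)) xs)
    (+-cong (at-scale (c zero) (w zero) xs) (combination-at (c ∘ suc) (w ∘ suc) xs))

  module _ {k : ℕ} {U : W.Combination k → W.Combination k}
    (U-hom : IsModuleHomomorphism (Module.rawModule (W.freeModule k))
        (Module.rawModule (W.freeModule k)) U)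
    (preimage : ∀ w → ∃ λ v → W._≋_ k (U v) w) where
    open Wᴹ k using (≈ᴹ-trans; ≈ᴹ-sym; ≈ᴹ-refl; +ᴹ-cong; *ₗ-congˡ)
    open IsModuleHomomorphism U-hom

    private
      n = List.length (enumerate k)

      eⱼ : Fin n → Iᴺ k
      eⱼ = List.lookup (enumerate k)

      U-combination : ∀ {m} (c : Fin m → Carrier) w →
          W._≋_ k (U (combination c w)) (combination c (U ∘ w))
      U-combination {zero}  c w = 0ᴹ-homo
      U-combination {suc m} c w = ≈ᴹ-trans
        (+ᴹ-homo (W.scale k (c zero) (w zero)) (combination (c ∘ suc) (w ∘ suc)))
        (+ᴹ-cong {U (W.scale k (c zero) (w zero))} {W.scale k (c zero) (U (w zero))}
                 {U (combination (c ∘ suc) (w ∘ suc))} {combination (c ∘ suc) (U ∘ w ∘ suc)}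
          (*ₗ-homo (c zero) (w zero)) (U-combination (c ∘ suc) (w ∘ suc)))

      vanishing : ∀ w → (∀ j → w at entries (eⱼ j) ≈ 0#) → W._≋_ k w []
      vanishing w w≈0 = ≈ᴹ-trans (expansion w) (zeros (enumerate k) w≈0)
        where
        zeros : ∀ is → (∀ j → w at entries (List.lookup is j) ≈ 0#) →
                W._≋_ k (List.map (λ i → w at entries i , i) is) []
        zeros []       _ = ≈ᴹ-refl
        zeros (i ∷ is) z = +ᴹ-cong {(w at entries i , i) ∷ []} {[]}
            {List.map (λ i → w at entries i , i) is} {[]}
          (≋-at {v = (w at entries i , i) ∷ []} {w = []} λ t →
            trans (+-identityʳ _) (trans (*-congʳ (z zero)) (zeroˡ _)))
          (zeros is (z ∘ suc))

    -- A kernel vector v and chosen preimages of the n basis vectors are n + 1 vectors with n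
    -- coordinates, hence dependent. Applying U annihilates v and turns the preimages into the
    -- basis, so their coefficients are 0. The coefficient of v is then nonzero, and v = 0.
    surjective⇒injective : ∀ v → W._≋_ k (U v) [] → W._≋_ k v []
    surjective⇒injective v Uv≋0 = vanishing v λ j → *-cancel-0 c₀≉0 (begin
      c zero * v at entries (eⱼ j)
        ≈⟨ +-identityʳ _ ⟨
      c zero * v at entries (eⱼ j) + 0#
        ≈⟨ +-congˡ (sum-zero {f = λ i → c (suc i) * rows (suc i) at entries (eⱼ j)}
             (λ i → trans (*-congʳ (cᵢ≈0 i)) (zeroˡ _))) ⟨
      sum (λ i → c i * rows i at entries (eⱼ j))
        ≈⟨ relation j ⟩
      0# ∎)
      where
      rows : Fin (suc n) → W.Combination k
      rows zero    = v
      rows (suc i) = proj₁ (preimage (W.basis k (eⱼ i)))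
      dependent = LinearDependence.dependence R R-field n (λ i j → rows i at entries (eⱼ j))
      c = proj₁ dependent
      relation : ∀ j → sum (λ i → c i * rows i at entries (eⱼ j)) ≈ 0#
      relation = proj₂ (proj₂ dependent)
      image≋0 : W._≋_ k (combination c (U ∘ rows)) []
      image≋0 = ≈ᴹ-trans (≈ᴹ-sym (U-combination c rows))
        (≈ᴹ-trans (U-cong (vanishing (combination c rows)
          (λ j → trans (combination-at c rows (entries (eⱼ j))) (relation j)))) 0ᴹ-homo)
        where
        U-cong : ∀ {v w} → W._≋_ k v w → W._≋_ k (U v) (U w)
        U-cong = IsModuleHomomorphism.⟦⟧-cong U-hom
      cᵢ≈0 : ∀ j → c (suc j) ≈ 0#
      cᵢ≈0 j = begin
        c (suc j)
          ≈⟨ sum-⟦⟧ j (c ∘ suc) (λ i → Vecₚ.≡-dec ℕₚ._≟_ (entries (eⱼ i)) (entries (eⱼ j))) ≡.refl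
              only ⟨
        sum (λ i → c (suc i) * δ (entries (eⱼ i)) (entries (eⱼ j)))
          ≈⟨ +-identityˡ _ ⟨
        0# + sum (λ i → c (suc i) * δ (entries (eⱼ i)) (entries (eⱼ j)))
          ≈⟨ +-cong (sym (trans (*-congˡ (at-cong Uv≋0 (entries (eⱼ j)))) (zeroʳ _)))
               (sum-cong-≋ {x = λ i → c (suc i) * δ (entries (eⱼ i)) (entries (eⱼ j))}
                 {y = λ i → c (suc i) * U (rows (suc i)) at entries (eⱼ j)} λ i → *-congˡ (sym
                   (trans (at-cong (proj₂ (preimage (W.basis k (eⱼ i)))) (entries (eⱼ j)))
                          (at-basis (eⱼ i) (entries (eⱼ j)))))) ⟩
        sum (λ i → c i * U (rows i) at entries (eⱼ j))
          ≈⟨ combination-at c (U ∘ rows) (entries (eⱼ j)) ⟨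
        combination c (U ∘ rows) at entries (eⱼ j)
          ≈⟨ at-cong image≋0 (entries (eⱼ j)) ⟩
        0# ∎
        where
        only : ∀ i → entries (eⱼ i) ≡ entries (eⱼ j) → i ≡ j
        only i e with i Finₚ.≟ j
        ... | yes i≡j = i≡j
        ... | no  i≢j = contradiction e (lookup-AllPairs (_∘ ≡.sym) (enumerate-distinct k) i j
            i≢j)
      c₀≉0 : ¬ c zero ≈ 0#
      c₀≉0 c₀≈0 with proj₁ (proj₂ dependent)
      ... | zero  , c≉0 = c≉0 c₀≈0
      ... | suc j , c≉0 = c≉0 (cᵢ≈0 j)

-- Values of polynomials at tuples of colours

module MonomialEvaluation
  (R : CommutativeRing 0ℓ 0ℓ) (N : ℕ) (X : ℕ → CommutativeRing.Carrier R)
  (X-out : ∀ y → ¬ (1 ≤ y × y ≤ N) → CommutativeRing._≈_ R (X y) (CommutativeRing.0# R)) where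
  open CommutativeRing R hiding (zero)
  open ListSums R
  open SetoidReasoning setoid
  open FiniteColours N using (InRange)
  open ColourAlgebra R N X X-out
  open RingProperties ring using (-‿distribˡ-*; -1*x≈-x)
  open SemiringExp semiring using (_^_; ^-homo-*)

  module Ŵ (k : ℕ) = FreeProperties R (exponentVectors k)

  monomial : ∀ {k} → Vec ℕ k → Vec ℕ k → Carrier
  monomial []      []       = 1#
  monomial (a ∷ m) (j ∷ js) = X j ^ suc a * monomial m js

  monomial-product : ∀ {k} (m js : Vec ℕ k) →
    monomial m js ≡ List.foldr _*_ 1# (List.tabulate (λ r → X (lookup js r) ^ suc (lookup m r)))
  monomial-product []      []       = ≡.refl
  monomial-product (a ∷ m) (j ∷ js) = ≡.cong (X j ^ suc a *_) (monomial-product m js)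

  monomial-∷ʳ : ∀ {k} (m js : Vec ℕ k) c → monomial (m ∷ʳ 0) (js ∷ʳ c) ≈ X c * monomial m js
  monomial-∷ʳ []      []       c = *-congʳ (*-identityʳ _)
  monomial-∷ʳ (a ∷ m) (j ∷ js) c = trans (*-congˡ (monomial-∷ʳ m js c))
    (trans (sym (*-assoc _ _ _)) (trans (*-congʳ (*-comm _ _)) (*-assoc _ _ _)))

  monomial-updateAt : ∀ {k} (m js : Vec ℕ k) r a →
    monomial (Vec.updateAt m r (λ mᵣ → mᵣ ℕ.+ a)) js ≈ X (lookup js r) ^ a * monomial m js
  monomial-updateAt (b ∷ m) (j ∷ js) zero    a = trans (*-congʳ (^-homo-* (X j) (suc b) a))
    (trans (*-congʳ (*-comm _ _)) (*-assoc _ _ _))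
  monomial-updateAt (b ∷ m) (j ∷ js) (suc r) a = trans (*-congˡ (monomial-updateAt m js r a))
    (trans (sym (*-assoc _ _ _)) (trans (*-congʳ (*-comm _ _)) (*-assoc _ _ _)))

  evalAt : ∀ {k} → Vec ℕ k → Ŵ.Combination k → Carrier
  evalAt {k} js = Ŵ.pairing k (λ m → monomial m js)

  evalAt-cong : ∀ {k} (js : Vec ℕ k) {Φ Ψ} → Ŵ._≋_ k Φ Ψ → evalAt js Φ ≈ evalAt js Ψ
  evalAt-cong {k} js = Ŵ.pairing-cong k (λ { ≡.refl → refl })

  evalAt-linear : ∀ {k l} (js : Vec ℕ l) (f : Vec ℕ k → Ŵ.Combination l) Φ →
    evalAt js (linear (Ŵ.freeModule l) f Φ) ≈ Ŵ.pairing k (λ m → evalAt js (f m)) Φ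
  evalAt-linear {k} {l} js f Φ =
    linear-∘ {R} {exponentVectors l} TensorUnit.⟨module⟩ (λ m → monomial m js) f Φ

  multiply : ∀ k → Ŵ.Combination k → Ŵ.Combination (suc k)
  multiply k = linear (Ŵ.freeModule (suc k)) λ m → Ŵ.basis (suc k) (m ∷ʳ 0)

  evalAt-multiply : ∀ {k} (js : Vec ℕ k) c Φ → evalAt (js ∷ʳ c) (multiply k Φ) ≈ X c * evalAt js Φ
  evalAt-multiply {k} js c Φ = trans (evalAt-linear (js ∷ʳ c) (λ m → Ŵ.basis (suc k) (m ∷ʳ 0)) Φ)
    (trans (Ŵ.pairing-ext k (λ m → trans (Ŵ.pairing-basis (suc k) (λ m → monomial m (js ∷ʳ c))
        (m ∷ʳ 0))
                                         (monomial-∷ʳ m js c)) Φ)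
           (Ŵ.pairing-* k (X c) (λ m → monomial m js) Φ))

  colourSum-complement : ∀ (f : ℕ → Carrier) {k} {js : Vec ℕ k} → Allᵛ.All InRange js →
      Unique js →
    colourSum f ≈ colourSum (λ c → χ c js * f c) + sum (λ r → f (lookup js r))
  colourSum-complement f [] [] = trans
    (colourSum-cong (λ c → sym (trans (*-congʳ (⟦⟧-yes (¬? (c ∈? [])) (λ ()))) (*-identityˡ _))))
    (sym (+-identityʳ _))
  colourSum-complement f {js = j ∷ js} (j∈N ∷ ls) (d ∷ ds) = begin
    colourSum f
      ≈⟨ colourSum-complement f ls ds ⟩
    colourSum (λ c → χ c js * f c) + sum (λ r → f (lookup js r))
      ≈⟨ +-congʳ (colourSum-remove (λ c → χ c js * f c) j∈N) ⟩
    (colourSum (λ c → ⟦ ¬? (c ℕₚ.≟ j) ⟧ * (χ c js * f c)) + χ j js * f j) + sum (λ r →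
        f (lookup js r))
      ≈⟨ +-congʳ (+-cong
           (colourSum-cong (λ c → trans (sym (*-assoc _ _ _)) (*-congʳ (sym (χ-∷ c j js)))))
           (trans (*-congʳ (⟦⟧-yes (¬? (j ∈? js)) (∉-∷⁻ d))) (*-identityˡ _))) ⟩
    (colourSum (λ c → χ c (j ∷ js) * f c) + f j) + sum (λ r → f (lookup js r))
      ≈⟨ +-assoc _ _ _ ⟩
    colourSum (λ c → χ c (j ∷ js) * f c) + sum (λ r → f (lookup (j ∷ js) r)) ∎

  -- `contract` has the same shape as `D̂`. The parameters stand for the images of p_{a+1} and of
  -- the constant -1 under specialisation, so that the two operators can be matched term by term.
  module Contraction
    (powerSum : ℕ → Carrier) (powerSum≈ : ∀ a → powerSum a ≈ colourSum (λ c → X c ^ suc a))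
    (minusOne : Carrier) (minusOne≈ : minusOne ≈ - 1#) where

    contractBasis : ∀ {k} → Vec ℕ (suc k) → Ŵ.Combination k
    contractBasis {k} am =
      let a = Vec.head am
          m = Vec.tail am
      in (powerSum a , m) ∷
         List.map (λ r → minusOne , Vec.updateAt m r (λ mᵣ → mᵣ ℕ.+ suc a)) (List.allFin k)

    contract : ∀ k → Ŵ.Combination (suc k) → Ŵ.Combination k
    contract k = linear (Ŵ.freeModule k) contractBasis

    -- The power sum contributes every colour c, and the negative terms of `contractBasis` take away
    -- those that occur in js; as js is distinct, each is taken away once. This identifies the
    -- formula for D̂ on polynomials with the sum over c ∉ js.
    evalAt-contract : ∀ {k} {js : Vec ℕ k} → Allᵛ.All InRange js → Unique js → ∀ Φ →
      evalAt js (contract k Φ) ≈ colourSum (λ c → χ c js * evalAt (c ∷ js) Φ)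
    evalAt-contract {k} {js} js∈N distinct Φ = begin
      evalAt js (contract k Φ)
        ≈⟨ evalAt-linear js contractBasis Φ ⟩
      Ŵ.pairing (suc k) (λ am → evalAt js (contractBasis am)) Φ
        ≈⟨ Ŵ.pairing-ext (suc k) (λ { (a ∷ m) → basisCase a m }) Φ ⟩
      Ŵ.pairing (suc k) (λ am → colourSum (λ c → χ c js * monomial am (c ∷ js))) Φ
        ≈⟨ pairing-colourSum {exponentVectors (suc k)} (λ c am → χ c js * monomial am (c ∷ js)) Φ
            ⟩
      colourSum (λ c → Ŵ.pairing (suc k) (λ am → χ c js * monomial am (c ∷ js)) Φ)
        ≈⟨ colourSum-cong (λ c → Ŵ.pairing-* (suc k) (χ c js) (λ am → monomial am (c ∷ js)) Φ) ⟩
      colourSum (λ c → χ c js * evalAt (c ∷ js) Φ) ∎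
      where
      basisCase : ∀ a m → evalAt js (contractBasis (a ∷ m)) ≈
                          colourSum (λ c → χ c js * monomial (a ∷ m) (c ∷ js))
      basisCase a m = begin
        powerSum a * μ + Ŵ.pairing k (λ m → monomial m js)
            (List.map (λ r → minusOne , Vec.updateAt m r (λ mᵣ → mᵣ ℕ.+ suc a)) (List.allFin k))
          ≈⟨ +-cong (*-congʳ (powerSum≈ a)) corrections ⟩
        colourSum f * μ + - (sum (λ r → f (lookup js r)) * μ)
          ≈⟨ +-congʳ (trans (*-congʳ (colourSum-complement f js∈N distinct)) (distribʳ _ _ _)) ⟩
        (colourSum (λ c → χ c js * f c) * μ + sum (λ r → f (lookup js r)) * μ) +
            - (sum (λ r → f (lookup js r)) * μ)
          ≈⟨ trans (+-assoc _ _ _) (trans (+-congˡ (-‿inverseʳ _)) (+-identityʳ _)) ⟩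
        colourSum (λ c → χ c js * f c) * μ
          ≈⟨ trans (*-comm _ _) (sym (colourSum-* μ _)) ⟩
        colourSum (λ c → μ * (χ c js * f c))
          ≈⟨ colourSum-cong (λ c → trans (*-comm _ _) (*-assoc _ _ _)) ⟩
        colourSum (λ c → χ c js * (f c * μ)) ∎
        where
        μ = monomial m js
        f : ℕ → Carrier
        f c = X c ^ suc a
        corrections : Ŵ.pairing k (λ m → monomial m js)
            (List.map (λ r → minusOne , Vec.updateAt m r (λ mᵣ → mᵣ ℕ.+ suc a)) (List.allFin k)) ≈
          - (sum (λ r → f (lookup js r)) * μ)
        corrections = begin
          Ŵ.pairing k (λ m → monomial m js)
            (List.map (λ r → minusOne , Vec.updateAt m r (λ mᵣ → mᵣ ℕ.+ suc a)) (List.allFin k))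
            ≡⟨ Ŵ.pairing-map k (λ m → monomial m js) (λ _ → minusOne)
                 (λ r → Vec.updateAt m r (λ mᵣ → mᵣ ℕ.+ suc a)) (List.allFin k) ⟩
          listSum (λ r → minusOne * monomial (Vec.updateAt m r (λ mᵣ → mᵣ ℕ.+ suc a)) js)
              (List.allFin k)
            ≡⟨ listSum-tabulate (λ r → minusOne * monomial
                (Vec.updateAt m r (λ mᵣ → mᵣ ℕ.+ suc a)) js) id ⟩
          sum (λ r → minusOne * monomial (Vec.updateAt m r (λ mᵣ → mᵣ ℕ.+ suc a)) js)
            ≈⟨ sum-cong-≋ {x = λ r → minusOne * monomial (Vec.updateAt m r (λ mᵣ → mᵣ ℕ.+ suc a))
                js}
                 {y = λ r → (- μ) * f (lookup js r)} (λ r → term r) ⟩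
          sum (λ r → (- μ) * f (lookup js r))
            ≈⟨ *-distribˡ-sum (- μ) (λ r → f (lookup js r)) ⟨
          (- μ) * sum (λ r → f (lookup js r))
            ≈⟨ trans (sym (-‿distribˡ-* _ _)) (-‿cong (*-comm _ _)) ⟩
          - (sum (λ r → f (lookup js r)) * μ) ∎
          where
          term : ∀ r → minusOne * monomial (Vec.updateAt m r (λ mᵣ → mᵣ ℕ.+ suc a)) js ≈
                       (- μ) * f (lookup js r)
          term r = begin
            minusOne * monomial (Vec.updateAt m r (λ mᵣ → mᵣ ℕ.+ suc a)) js
              ≈⟨ *-cong minusOne≈ (monomial-updateAt m js r (suc a)) ⟩
            (- 1#) * (f (lookup js r) * μ)
              ≈⟨ -1*x≈-x _ ⟩
            - (f (lookup js r) * μ)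
              ≈⟨ trans (-‿cong (*-comm _ _)) (-‿distribˡ-* _ _) ⟩
            (- μ) * f (lookup js r) ∎

-- Pigeonhole arguments

distinct-length : ∀ {k n} (t : Tuple (λ y → 1 ≤ y × y ≤ n) k) → k ≤ n
distinct-length {k} {n} t with k ℕₚ.≤? n
... | yes k≤n = k≤n
... | no  k≰n =
  let i , j , i<j , e = Finₚ.pigeonhole (ℕₚ.≰⇒> k≰n) index
  in contradiction (lookup-injective (distinct t) i j (same i j e)) (Finₚ.<⇒≢ i<j)
  where
  entry : ∀ i → 1 ≤ lookup (entries t) i × lookup (entries t) i ≤ n
  entry i = Allᵛₚ.lookup⁺ (labels t) i
  pred< : ∀ {y} → 1 ≤ y × y ≤ n → ℕ.pred y < n
  pred< {suc y} (_ , y<n) = y<n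
  index : Fin k → Fin n
  index i = Fin.fromℕ< (pred< (entry i))
  pred-injective : ∀ {y z} → 1 ≤ y → 1 ≤ z → ℕ.pred y ≡ ℕ.pred z → y ≡ z
  pred-injective {suc y} {suc z} _ _ e = ≡.cong suc e
  same : ∀ i j → index i ≡ index j → lookup (entries t) i ≡ lookup (entries t) j
  same i j e = pred-injective (proj₁ (entry i)) (proj₁ (entry j))
    (≡.trans (≡.sym (Finₚ.toℕ-fromℕ< (pred< (entry i))))
      (≡.trans (≡.cong toℕ e) (Finₚ.toℕ-fromℕ< (pred< (entry j)))))

missing : ∀ {k n} (xs : Vec ℕ k) → k < n → ∃ λ y → (1 ≤ y × y ≤ n) × y ∉ xs
missing {k} {n} xs k<n with Finₚ.any? {n} (λ d → ¬? (suc (toℕ d) ∈? xs))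
... | yes (d , d∉) = suc (toℕ d) , (s≤s z≤n , Finₚ.toℕ<n d) , d∉
... | no  none     =
  let i , j , i<j , e = Finₚ.pigeonhole k<n (λ d → Anyᵛ.index (present d))
  in contradiction
       (Finₚ.toℕ-injective (ℕₚ.suc-injective (≡.trans (Anyᵛₚ.lookup-index (present i))
         (≡.trans (≡.cong (lookup xs) e) (≡.sym (Anyᵛₚ.lookup-index (present j)))))))
       (Finₚ.<⇒≢ i<j)
  where
  present : ∀ d → suc (toℕ d) ∈ xs
  present d with suc (toℕ d) ∈? xs
  ... | yes d∈ = d∈
  ... | no  d∉ = contradiction (d , d∉) none

-- The embedding of a domain into its fractions

module EmbedProperties (D : CommutativeRing 0ℓ 0ℓ) (D-isDomain : IsDomain D) where
  private module D = CommutativeRing D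
  open Fractions D D-isDomain
  private module Q = CommutativeRing commutativeRing
  open SemiringExp Q.semiring using (_^_)
  open SemiringExp D.semiring using () renaming (_^_ to _^ᴰ_)

  embed-cong : ∀ {a b} → a D.≈ b → embed a Q.≈ embed b
  embed-cong a≈b = mk≃ (D.*-congʳ a≈b)

  embed-+ : ∀ a b → embed (a D.+ b) Q.≈ embed a Q.+ embed b
  embed-+ a b = mk≃ (D.*-cong (D.sym (D.+-cong (D.*-identityʳ a) (D.*-identityʳ b)))
      (D.*-identityʳ D.1#))

  embed-* : ∀ a b → embed (a D.* b) Q.≈ embed a Q.* embed b
  embed-* a b = mk≃ (D.*-congˡ (D.*-identityʳ D.1#))

  embed-injective : ∀ {a b} → embed a Q.≈ embed b → a D.≈ b
  embed-injective {a} {b} (mk≃ e) = D.trans (D.sym (D.*-identityʳ a))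
      (D.trans e (D.*-identityʳ b))

  embed-^ : ∀ p a → embed (p ^ᴰ a) Q.≈ embed p ^ a
  embed-^ p zero    = Q.refl
  embed-^ p (suc a) = Q.trans (embed-* p (p ^ᴰ a)) (Q.*-congˡ {embed p} (embed-^ p a))

  embed-sum : ∀ {n} (f : Fin n → D.Carrier) → embed (ListSums.sum D f) Q.≈ ListSums.sum
      commutativeRing (λ i → embed (f i))
  embed-sum {zero}  f = Q.refl
  embed-sum {suc n} f = Q.trans (embed-+ (f zero) (ListSums.sum D (λ i → f (suc i))))
    (Q.+-congˡ {embed (f zero)} (embed-sum (λ i → f (suc i))))

  embed-monomial : ∀ {k} (p : Fin k → D.Carrier) (a : Fin k → ℕ) →
    embed (List.foldr D._*_ D.1# (List.tabulate (λ r → p r ^ᴰ a r))) Q.≈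
    List.foldr Q._*_ Q.1# (List.tabulate (λ r → embed (p r) ^ a r))
  embed-monomial {zero}  p a = Q.refl
  embed-monomial {suc k} p a = Q.trans
    (embed-* (p zero ^ᴰ a zero) (List.foldr D._*_ D.1#
        (List.tabulate (λ r → p (suc r) ^ᴰ a (suc r)))))
    (Q.*-cong (embed-^ (p zero) (a zero)) (embed-monomial (λ r → p (suc r)) (λ r → a (suc r))))

  fraction-* : ∀ a b {d} (d≉0 : ¬ d D.≈ D.0#) → fraction (a D.* b) d d≉0 Q.≈ fraction a d d≉0 Q.*
      embed b
  fraction-* a b d≉0 = mk≃ (D.*-congˡ (D.*-identityʳ _))

  fraction-+ : ∀ a b {d} (d≉0 : ¬ d D.≈ D.0#) →
               fraction (a D.+ b) d d≉0 Q.≈ fraction a d d≉0 Q.+ fraction b d d≉0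
  fraction-+ a b d≉0 = mk≃ (D.trans (D.sym (D.*-assoc _ _ _)) (D.*-congʳ (D.distribʳ _ a b)))

  -- Adds fractions over a common denominator. There are two proofs that d is nonzero because
  -- `specialise` and `image-of` derive this from different bounds.
  linear-fractions : {A C : Set} (w : C → D.Carrier) (ω : C → Fraction) →
      (∀ c → ω c Q.≈ embed (w c)) →
    ∀ (g : A → D.Carrier) {d} (d≉0 d≉0′ : ¬ d D.≈ D.0#) (l : List (A × C)) →
    linear {commutativeRing} TensorUnit.⟨module⟩ ω (List.map (λ (a , c) → fraction (g a) d d≉0 ,
        c) l) Q.≈
    fraction (linear {D} TensorUnit.⟨module⟩ w (List.map (λ (a , c) → g a , c) l)) d d≉0′
  linear-fractions w ω ω≈w g d≉0 d≉0′ []            =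
    mk≃ (D.trans (D.zeroˡ _) (D.sym (D.zeroˡ _)))
  linear-fractions w ω ω≈w g d≉0 d≉0′ ((a , c) ∷ l) = Q.trans
    (Q.+-cong (Q.trans (Q.*-congˡ {fraction (g a) _ d≉0} (ω≈w c))
        (Q.sym (fraction-* (g a) (w c) d≉0)))
              (linear-fractions w ω ω≈w g d≉0 d≉0 l))
    (Q.trans (Q.sym (fraction-+ (g a D.* w c) (linear {D} TensorUnit.⟨module⟩ w
        (List.map (λ (a , c) → g a , c) l)) d≉0))
      (mk≃ D.refl))

-- Bounds on entries, and the vanishing of A

max-∷ʳ : ∀ {k n} (xs : Vec ℕ k) {y} → max xs ≤ n → y ≤ n → max (xs ∷ʳ y) ≤ n
max-∷ʳ []       xs≤n y≤n = ℕₚ.⊔-lub y≤n z≤n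
max-∷ʳ (x ∷ xs) xs≤n y≤n = ℕₚ.⊔-lub (ℕₚ.m⊔n≤o⇒m≤o x (max xs) xs≤n)
  (max-∷ʳ xs (ℕₚ.m⊔n≤o⇒n≤o x (max xs) xs≤n) y≤n)

lookup≤max : ∀ {k} (xs : Vec ℕ k) r → lookup xs r ≤ max xs
lookup≤max (x ∷ xs) zero    = ℕₚ.m≤m⊔n x (max xs)
lookup≤max (x ∷ xs) (suc r) = ℕₚ.≤-trans (lookup≤max xs r) (ℕₚ.m≤n⊔m x (max xs))

A-zero : ∀ {k} y (xs : Vec ℕ k) → suc (max xs) < y → A y xs ≡ 0ℚ
A-zero y xs lt with y ℕₚ.≟ 1 | Finₚ.any? (λ r → y ℕₚ.≟ suc (lookup xs r))
... | yes ≡.refl | _               = contradiction lt λ { (s≤s ()) }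
... | no  _      | yes (r , ≡.refl) = contradiction (ℕₚ.≤-trans lt (s≤s (lookup≤max xs r)))
    (ℕₚ.<-irrefl ≡.refl)
... | no  _      | no _            = ≡.refl

-- The variables x_c as distinct nonzero elements of the field

module FiniteColourings (N : ℕ) where
  open FiniteVariables N
  open FiniteColours N using (InRange)
  open Evaluation N
  private
    module P = CommutativeRing commutativeRing
    module Q = CommutativeRing field⟨x⟩
  open EmbedProperties commutativeRing isDomain
  open SemiringExp P.semiring using () renaming (_^_ to _^ᴾ_)
  open SemiringExp Q.semiring using () renaming (_^_ to _^ᶠ_)

  zero? : ∀ p → Dec (p ≈ 0#)
  zero? = DecidableZero._≋0? ℚring monomials (ℚₚ._≟ 0ℚ)

  fieldIsDiscrete : IsDiscreteField field⟨x⟩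
  fieldIsDiscrete = FractionDecidability.discreteField commutativeRing isDomain zero?

  X : ℕ → Fraction
  X c = embed (x c)

  x-var : ∀ {c} → InRange c → ∃ λ i → x c ≡ var i × c ≡ suc (toℕ i)
  x-var {suc c} (_ , c<N) with c ℕₚ.<? N
  ... | yes c<N′ = Fin.fromℕ< c<N′ , ≡.refl , ≡.cong suc (≡.sym (Finₚ.toℕ-fromℕ< c<N′))
  ... | no  c≮N  = contradiction c<N c≮N

  x-out : ∀ c → ¬ InRange c → x c ≡ 0#
  x-out zero    _   = ≡.refl
  x-out (suc c) c∉N with c ℕₚ.<? N
  ... | yes c<N = contradiction (s≤s z≤n , c<N) c∉N
  ... | no  _   = ≡.refl

  private
    unit : Fin N → Vec ℕ N
    unit i = Vec.replicate N 0 Vec.[ i ]≔ 1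

    unit-injective : ∀ {i j} → unit i ≡ unit j → i ≡ j
    unit-injective {i} {j} e with i Finₚ.≟ j
    ... | yes i≡j = i≡j
    ... | no  i≢j = contradiction (≡.trans (≡.sym (Vecₚ.lookup∘update i (Vec.replicate N 0) 1))
      (≡.trans (≡.cong (λ m → lookup m i) e)
        (≡.trans (Vecₚ.lookup∘update′ i≢j (Vec.replicate N 0) 1) (Vecₚ.lookup-replicate i 0))))
            λ ()

    coefficient-var : ∀ i → coefficient (var i) (unit i) ≡ 1ℚ
    coefficient-var i with DecSetoid._≟_ monomials (unit i) (unit i)
    ... | yes _ = ≡.refl
    ... | no ¬e = contradiction ≡.refl ¬e

    coefficient-var-≢ : ∀ {i j} → i ≢ j → coefficient (var j) (unit i) ≡ 0ℚ
    coefficient-var-≢ {i} {j} i≢j with DecSetoid._≟_ monomials (unit j) (unit i)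
    ... | yes e = contradiction (≡.sym (unit-injective e)) i≢j
    ... | no _  = ≡.refl

  var-injective : ∀ i j → var i ≈ var j → i ≡ j
  var-injective i j e with i Finₚ.≟ j
  ... | yes i≡j = i≡j
  ... | no  i≢j = contradiction
    (≡.trans (≡.sym (coefficient-var i)) (≡.trans (coefficients e (unit i))
        (coefficient-var-≢ i≢j))) λ ()

  var≉0 : ∀ i → var i ≉ 0#
  var≉0 i e = contradiction (≡.trans (≡.sym (coefficient-var i)) (coefficients e (unit i))) λ ()

  X-out : ∀ c → ¬ InRange c → X c Q.≈ Q.0#
  X-out c c∉N = Q.reflexive (≡.cong embed (x-out c c∉N))

  X≉0 : ∀ c → InRange c → ¬ X c Q.≈ Q.0#
  X≉0 c c∈N e = let i , xc≡ , _ = x-var c∈N in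
    var≉0 i (≡.subst (_≈ 0#) xc≡ (embed-injective e))

  X-injective : ∀ c d → InRange c → InRange d → X c Q.≈ X d → c ≡ d
  X-injective c d c∈N d∈N e =
    let i , xc≡ , c≡ = x-var c∈N
        j , xd≡ , d≡ = x-var d∈N
    in ≡.trans c≡ (≡.trans (≡.cong (λ i → suc (toℕ i))
         (var-injective i j (≡.subst₂ _≈_ xc≡ xd≡ (embed-injective e)))) (≡.sym d≡))

  open ListSums field⟨x⟩ using (sum-cong-≋)
  open ColourAlgebra field⟨x⟩ N X X-out
  open MonomialEvaluation field⟨x⟩ N X X-out using (monomial; monomial-product)

  powerSum : ℕ → Fraction
  powerSum a = embed (evaluate p[1+ a ])

  x-suc : ∀ i → x (suc (toℕ i)) ≡ var i
  x-suc i = let j , xi≡ , i≡ = x-var (s≤s z≤n , Finₚ.toℕ<n i) in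
    ≡.trans xi≡ (≡.cong var (≡.sym (Finₚ.toℕ-injective (ℕₚ.suc-injective i≡))))

  powerSum≈ : ∀ a → powerSum a Q.≈ colourSum (λ c → X c ^ᶠ suc a)
  powerSum≈ a = Q.trans (embed-cong (evaluate-hook 0 a))
    (Q.trans (embed-sum (λ c → (lookup vars c ^ᴾ suc a) * 1#))
    (Q.trans (sum-cong-≋ {N} {λ c → embed ((lookup vars c ^ᴾ suc a) * 1#)} {λ c →
        X (suc (toℕ c)) ^ᶠ suc a} term)
             (Q.reflexive (≡.sym (colourSum-sum (λ c → X c ^ᶠ suc a))))))
    where
    term : ∀ c → embed ((lookup vars c ^ᴾ suc a) * 1#) Q.≈ X (suc (toℕ c)) ^ᶠ suc a
    term c = Q.trans (embed-cong (P.*-identityʳ (lookup vars c ^ᴾ suc a)))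
      (Q.trans (Q.reflexive (≡.cong (λ p → embed (p ^ᴾ suc a))
                  (≡.trans (Vecₚ.lookup∘tabulate var c) (≡.sym (x-suc c)))))
               (embed-^ (x (suc (toℕ c))) (suc a)))

  minusOne : Fraction
  minusOne = constantᶠ (ℚ.- 1ℚ)

  minusOne≈ : minusOne Q.≈ Q.- Q.1#
  minusOne≈ = Q.refl

  monomial-embed : ∀ {k} (m js : Vec ℕ k) →
    monomial m js Q.≈ embed (∏ (List.map (λ r → x (lookup js r) ^ suc (lookup m r))
        (List.allFin k)))
  monomial-embed {k} m js = Q.trans (Q.reflexive (monomial-product m js)) (Q.trans
    (Q.sym (embed-monomial (λ r → x (lookup js r)) (λ r → suc (lookup m r))))
    (Q.reflexive (≡.cong (λ ps → embed (∏ ps)) (≡.trans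
      (≡.sym (Listₚ.tabulate-cong (λ r → ^≡^ (x (lookup js r)) (suc (lookup m r)))))
      (≡.sym (Listₚ.map-tabulate {n = k} id (λ r → x (lookup js r) ^ suc (lookup m r))))))))

-- Specialised images of the basis vectors

module FiniteIntertwiner (U : Family) (U-intertwines : IsIntertwiner U)
                         (U-denominators : HasDenominators U) (N : ℕ) where
  open FiniteVariables N
  open FiniteColours N
  open Evaluation N
  open FiniteColourings N
  open IsIntertwiner U-intertwines
  private
    module P = CommutativeRing commutativeRing
    module Q = CommutativeRing field⟨x⟩
    module KR = CommutativeRing K.commutativeRing
  open EmbedProperties commutativeRing isDomain
  open ListSums field⟨x⟩
  open ColourAlgebra field⟨x⟩ N X X-out
  open MonomialEvaluation field⟨x⟩ N X X-out
  open Contraction powerSum powerSum≈ minusOne minusOne≈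
  open Specialisation Λ.commutativeRing commutativeRing Λ.isDomain isDomain
    evaluate evaluate-cong evaluate-+ evaluate-* evaluate-0 evaluate-1
  private
    module C (k : ℕ) = Combinations (exponentVectors k)
    module VK (k : ℕ) = FreeProperties K.commutativeRing (tuples (1 ≤_) k)
    module V̂ᴹ (k : ℕ) = Module (V̂ k)
    module Ŵᴹ (k : ℕ) = Module (Ŵ.freeModule k)

  -- j < n ≤ N + 1 leaves j ≤ N, which is the range where ē_j is nonzero. Hence tuples with the
  -- colour N + 1 can still be specialised.
  factors≉0 : ∀ {n} {js : List ℕ} → n ≤ suc N → All (_< n) js → ∏ (List.map ē js) ≉ 0#
  factors≉0 n≤1+N js<n = ∏-≉0 (Allₚ.map⁺ (All.map (λ j<n → ē≉0 (ℕₚ.≤-pred (ℕₚ.≤-trans j<n n≤1+N)))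
      js<n))

  image-of : ∀ {n k F} → Localised n {k} F → n ≤ suc N → Ŵ.Combination k
  image-of loc n≤1+N = List.map
    (λ (a , m) → fraction (evaluate a) (∏ (List.map ē factors)) (factors≉0 n≤1+N factors<n) , m)
        numerator
    where open Localised loc

  private
    evaluate-∏ : ∀ js → evaluate (Λ.∏ (List.map e js)) ≈ ∏ (List.map ē js)
    evaluate-∏ []       = evaluate-1
    evaluate-∏ (j ∷ js) = P.trans (evaluate-* (e j) (Λ.∏ (List.map e js)))
      (P.*-cong (evaluate-e j) (evaluate-∏ js))

  image-of-⇝ : ∀ {n k F} (loc : Localised n {k} F) (n≤1+N : n ≤ suc N) →
      C._⇝_ k F (image-of loc n≤1+N)
  image-of-⇝ {n} {k} {F} loc n≤1+N = C.⇝-quotient k {F} {Λ.∏ (List.map e factors)}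
      {∏ (List.map ē factors)}
    (λ z → factors≉0 n≤1+N factors<n (P.trans (P.sym (evaluate-∏ factors)) z))
    (evaluate-∏ factors) (factors≉0 n≤1+N factors<n) numerator equation
    where open Localised loc

  private
    Φ-cases : ∀ {k} (σ : I k) → Dec (max (entries σ) ≤ suc N) → Ŵ.Combination k
    Φ-cases σ (yes σ≤1+N) = image-of (U-denominators σ) σ≤1+N
    Φ-cases σ (no _)      = []

  -- Φ σ represents U b_σ in N variables; it is 0 by convention if max σ > N + 1.
  Φ : ∀ {k} → I k → Ŵ.Combination k
  Φ σ = Φ-cases σ (max (entries σ) ℕₚ.≤? suc N)

  Φ-⇝ : ∀ {k} (σ : I k) → max (entries σ) ≤ suc N → C._⇝_ k (U k (b σ)) (Φ σ)
  Φ-⇝ {k} σ σ≤1+N = by-cases (max (entries σ) ℕₚ.≤? suc N)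
    where
    by-cases : ∀ d → C._⇝_ k (U k (b σ)) (Φ-cases σ d)
    by-cases (yes p) = image-of-⇝ (U-denominators σ) p
    by-cases (no ¬p) = contradiction σ≤1+N ¬p

  U-cong : ∀ {k v w} → Module._≈ᴹ_ (V k) v w → Module._≈ᴹ_ (V̂ k) (U k v) (U k w)
  U-cong {k} = IsModuleHomomorphism.⟦⟧-cong (isLinear k)

  b-cong : ∀ {k} {σ τ : I k} → entries σ ≡ entries τ → Module._≈ᴹ_ (V k) (b σ) (b τ)
  b-cong {k} {σ} {τ} = VK.basis-cong k {σ} {τ}

  Φ-entries : ∀ {k} {σ τ : I k} → entries σ ≡ entries τ → Ŵ._≋_ k (Φ σ) (Φ τ)
  Φ-entries {k} {σ} {τ} σ≡τ = by-cases (max (entries σ) ℕₚ.≤? suc N) (max (entries τ) ℕₚ.≤? suc N)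
    where
    by-cases : ∀ d d′ → Ŵ._≋_ k (Φ-cases σ d) (Φ-cases τ d′)
    by-cases (yes p) (yes q) = C.⇝-functional k (U-cong (b-cong {k} {σ} {τ} σ≡τ))
      (image-of-⇝ (U-denominators σ) p) (image-of-⇝ (U-denominators τ) q)
    by-cases (no _)  (no _)  = Ŵᴹ.≈ᴹ-refl k
    by-cases (yes p) (no ¬q) = contradiction (≡.subst (λ xs → max xs ≤ suc N) σ≡τ p) ¬q
    by-cases (no ¬p) (yes q) = contradiction (≡.subst (λ xs → max xs ≤ suc N) (≡.sym σ≡τ) q) ¬p

  U-linear : ∀ {k} v → Module._≈ᴹ_ (V̂ k) (U k v) (linear (V̂ k) (λ σ → U k (b σ)) v)
  U-linear {k} v = VK.homomorphism-linear k (V̂ k) (isLinear k) v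

  constant-↦ : ∀ q → constantᴷ q ↦ constantᶠ q
  constant-↦ q = ↦-resp KR.refl (embed-cong (evaluate-constant q)) (↦-embed (Λ.constant q))

  ratio : ∀ s → ē (ℕ.pred s) ≉ 0# → Fraction
  ratio s = fraction (ē s) (ē (ℕ.pred s))

  ratio-↦ : ∀ s ē≉ → K.fraction (e s) (e (ℕ.pred s)) (e≉0 (ℕ.pred s)) ↦ ratio s ē≉
  ratio-↦ s ē≉ = ↦-resp KR.refl
    (FractionField.mk≃ (P.*-cong (evaluate-e s) (P.sym (evaluate-e (ℕ.pred s)))))
    (↦-fraction (e s) (e (ℕ.pred s)) (e≉0 (ℕ.pred s))
      (λ z → ē≉ (P.trans (P.sym (evaluate-e (ℕ.pred s))) z)))

  private
    -- The two sides are definitionally equal, but only after unfolding two large module structures.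
    linear-Ŵ : ∀ l {B : Set} (h : B → Ŵ.Combination l) Ψ →
               linear (C.W.freeModule l) h Ψ ≡ linear (Ŵ.freeModule l) h Ψ
    linear-Ŵ l h []            = ≡.refl
    linear-Ŵ l h ((a , m) ∷ Ψ) = ≡.cong (Ŵ.scale l a (h m) ++_) (linear-Ŵ l h Ψ)

  M̂-⇝ : ∀ {k F Ψ} → C._⇝_ k F Ψ → C._⇝_ (suc k) (M̂ k F) (multiply k Ψ)
  M̂-⇝ {k} {F} {Ψ} F⇝Ψ = ≡.subst (C._⇝_ (suc k) (M̂ k F))
      (linear-Ŵ (suc k) (λ m → Ŵ.basis (suc k) (m ∷ʳ 0)) Ψ)
    (linear-⇝ (exponentVectors k) (exponentVectors (suc k)) id
      {λ m → b̂ (m ∷ʳ 0)} {λ m → Ŵ.basis (suc k) (m ∷ʳ 0)} (λ m → C.⇝-basis (suc k) (m ∷ʳ 0)) F⇝Ψ)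

  D̂-⇝ : ∀ {k F Ψ} → C._⇝_ (suc k) F Ψ → C._⇝_ k (D̂ k F) (contract k Ψ)
  D̂-⇝ {k} {F} {Ψ} F⇝Ψ = ≡.subst (C._⇝_ k (D̂ k F)) (linear-Ŵ k contractBasis Ψ)
    (linear-⇝ (exponentVectors (suc k)) (exponentVectors k) id
      {D̂-basis} {contractBasis}
      (λ am → C.⇝-pointwise k ((↦-embed p[1+ Vec.head am ] , ≡.refl) ∷ corrections am
          (List.allFin k))) F⇝Ψ)
    where
    D̂-basis : Vec ℕ (suc k) → Module.Carrierᴹ (V̂ k)
    D̂-basis am = (K.embed p[1+ Vec.head am ] , Vec.tail am) ∷
      List.map (λ r → constantᴷ (ℚ.- 1ℚ) , Vec.updateAt (Vec.tail am) r (λ mᵣ →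
          mᵣ ℕ.+ suc (Vec.head am))) (List.allFin k)
    corrections : ∀ (am : Vec ℕ (suc k)) rs → C._↦*_ k
      (List.map (λ r → constantᴷ (ℚ.- 1ℚ) , Vec.updateAt (Vec.tail am) r (λ mᵣ →
          mᵣ ℕ.+ suc (Vec.head am))) rs)
      (List.map (λ r → minusOne , Vec.updateAt (Vec.tail am) r (λ mᵣ → mᵣ ℕ.+ suc (Vec.head am)))
          rs)
    corrections am []       = []
    corrections am (r ∷ rs) = (constant-↦ (ℚ.- 1ℚ) , ≡.refl) ∷ corrections am rs

  -- The relation D̂U = UD at b_τ. It covers tuples with the colour N + 1, which is what
  -- `Φ-vanishes` relies on.
  Φ-D : ∀ {k} (τ : I (suc k)) → max (entries τ) ≤ suc N → ∀ ē≉ →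
    Ŵ._≋_ k (contract k (Φ τ)) (Ŵ.scale k (ratio (Vec.head (entries τ)) ē≉) (Φ (rest τ)))
  Φ-D {k} τ@(tuple (s ∷ σ) (_ ∷ _) (_ ∷ _)) τ≤1+N ē≉ = C.⇝-functional k intertwined
    (D̂-⇝ (Φ-⇝ τ τ≤1+N))
    (C.⇝-scale k (ratio-↦ s ē≉) (Φ-⇝ (rest τ) (ℕₚ.m⊔n≤o⇒n≤o s (max σ) τ≤1+N)))
    where
    open V̂ᴹ k
    κ = K.fraction (e s) (e (ℕ.pred s)) (e≉0 (ℕ.pred s))
    D-basis : Module._≈ᴹ_ (V k) (D k (b τ)) (VK.scale k κ (b (rest τ)))
    D-basis = Module.≈ᴹ-trans (V k) (LinearProperties.linear-basis {K.commutativeRing}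
        {tuples (1 ≤_) (suc k)} (V k)
        (λ σ → (K.fraction (e (Vec.head (entries σ))) (e (ℕ.pred (Vec.head (entries σ))))
                  (e≉0 (ℕ.pred (Vec.head (entries σ)))) , rest σ) ∷ []) τ)
      (Module.≈ᴹ-sym (V k) (VK.scale-basis k κ (rest τ)))
    intertwined : D̂ k (U (suc k) (b τ)) ≈ᴹ κ *ₗ U k (b (rest τ))
    intertwined = ≈ᴹ-trans (D̂-U k (b τ)) (≈ᴹ-trans (U-cong D-basis)
      (IsModuleHomomorphism.*ₗ-homo (isLinear k) κ (b (rest τ))))

  private
    above : ∀ {k} → I k → List (ℕ × I (suc k))
    above σ = extensions (suc (max (entries σ))) (λ 1≤y _ → 1≤y) σ

  -- The relation UM = M̂U at b_σ. The bound N leaves room for the colours up to 1 + max σ that `M`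
  -- creates, as these must not exceed N + 1.
  Φ-M : ∀ {k} (σ : I k) → max (entries σ) ≤ N →
    Ŵ._≋_ (suc k)
      (linear (Ŵ.freeModule (suc k)) Φ (List.map (λ (y , t) → constantᶠ (A y (entries σ)) , t)
          (above σ)))
      (multiply k (Φ σ))
  Φ-M {k} σ σ≤N = C.⇝-functional (suc k) intertwined
    (≡.subst (C._⇝_ (suc k) (linear (V̂ (suc k)) (λ t → U (suc k) (b t)) created))
      (linear-Ŵ (suc k) Φ (List.map (λ (y , t) → constantᶠ (A y (entries σ)) , t) (above σ)))
      (C.⇝-linear (suc k) (pointwise (above σ) (extensions-All (suc (max (entries σ))) (λ 1≤y _ →
          1≤y) σ))))
    (M̂-⇝ (Φ-⇝ σ (ℕₚ.m≤n⇒m≤1+n σ≤N)))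
    where
    open V̂ᴹ (suc k)
    created = List.map (λ (y , t) → constantᴷ (A y (entries σ)) , t) (above σ)
    intertwined : linear (V̂ (suc k)) (λ t → U (suc k) (b t)) created ≈ᴹ M̂ k (U k (b σ))
    intertwined = ≈ᴹ-trans (≈ᴹ-sym (U-linear created)) (≈ᴹ-trans
      (U-cong (Module.≈ᴹ-sym (V (suc k)) (LinearProperties.linear-basis {K.commutativeRing}
          {tuples (1 ≤_) k} (V (suc k))
        (λ σ → List.map (λ (y , t) → constantᴷ (A y (entries σ)) , t) (above σ)) σ)))
      (U-M k (b σ)))
    pointwise : ∀ l → All (λ (y , t) → (1 ≤ y × y ≤ suc (max (entries σ))) ×
        entries t ≡ entries σ ∷ʳ y) l →
      Pointwise (λ (κ , t) (f , t′) → κ ↦ f × C._⇝_ (suc k) (U (suc k) (b t)) (Φ t′))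
        (List.map (λ (y , t) → constantᴷ (A y (entries σ)) , t) l)
        (List.map (λ (y , t) → constantᶠ (A y (entries σ)) , t) l)
    pointwise []            []                    = []
    pointwise ((y , t) ∷ l) (((_ , y≤) , e) ∷ as) =
      (constant-↦ (A y (entries σ)) , Φ-⇝ t (≡.subst (λ xs → max xs ≤ suc N) (≡.sym e)
        (max-∷ʳ (entries σ) (ℕₚ.m≤n⇒m≤1+n σ≤N) (ℕₚ.≤-trans y≤ (s≤s σ≤N))))) ∷ pointwise l as

  -- Vanishing for tuples that contain the colour N + 1

  open SetoidReasoning Q.setoid
  open IsDiscreteField fieldIsDiscrete using (*-cancel-0)

  -- Induction on d, which bounds how many more colours can be prepended before the length exceeds
  -- N. In the step the value at j is, up to the factor ē_y/ē_{y-1}, the sum of the values of `Φ τ`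
  -- at (c , j), and these vanish by induction. The factor can be cancelled because ē_y ≠ 0 for y ≤
  -- N.
  Φ-vanishes : ∀ d {k} → N < k ℕ.+ d → (σ : I k) → suc N ∈ entries σ → max (entries σ) ≤ suc N →
               (j : Iᴺ k) → evalAt (entries j) (Φ σ) Q.≈ Q.0#
  Φ-vanishes zero {k} N<k+0 σ _ _ j =
    contradiction (ℕₚ.<-≤-trans (≡.subst (N <_) (ℕₚ.+-identityʳ k) N<k+0) (distinct-length j))
        (ℕₚ.<-irrefl ≡.refl)
  Φ-vanishes (suc d) {k} N<k+1+d σ N+1∈σ σ≤1+N j = *-cancel-0 {ratio y ē≉}
      {evalAt (entries j) (Φ σ)} ratio≉0 (begin
    ratio y ē≉ Q.* evalAt (entries j) (Φ σ)
      ≈⟨ Ŵ.pairing-scale k (λ m → monomial m (entries j)) (ratio y ē≉) (Φ σ) ⟨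
    evalAt (entries j) (Ŵ.scale k (ratio y ē≉) (Φ σ))
      ≈⟨ evalAt-cong (entries j) (Φ-D τ (ℕₚ.⊔-lub (proj₂ y∈) σ≤1+N) ē≉) ⟨
    evalAt (entries j) (contract k (Φ τ))
      ≈⟨ evalAt-contract (labels j) (distinct j) (Φ τ) ⟩
    colourSum (λ c → χ c (entries j) Q.* evalAt (c ∷ entries j) (Φ τ))
      ≈⟨ colourSum-zero (λ c c∈N → term c c∈N (c ∈? entries j)) ⟩
    Q.0# ∎)
    where
    -- The tuple j has k distinct colours from [N], so k ≤ N and σ misses some y ≤ N + 1. This y is
    -- at most N because N + 1 occurs in σ.
    absent = missing (entries σ) (s≤s (distinct-length j))
    y = proj₁ absent
    y∈ = proj₁ (proj₂ absent)
    y∉σ = proj₂ (proj₂ absent)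
    y≤N : y ≤ N
    y≤N = ℕₚ.≤-pred (ℕₚ.≤∧≢⇒< (proj₂ y∈) λ y≡ → y∉σ (≡.subst (_∈ entries σ) (≡.sym y≡) N+1∈σ))
    ē≉ : ē (ℕ.pred y) ≉ 0#
    ē≉ = ē≉0 (ℕₚ.≤-trans ℕₚ.pred[n]≤n y≤N)
    τ : I (suc k)
    τ = cons σ (proj₁ y∈) y∉σ
    ratio≉0 : ¬ ratio y ē≉ Q.≈ Q.0#
    ratio≉0 z = ē≉0 y≤N (FractionDecidability.≃0⇒numerator≈0 commutativeRing isDomain zero? z)
    term : ∀ c → InRange c → Dec (c ∈ entries j) → χ c (entries j) Q.* evalAt (c ∷ entries j)
        (Φ τ) Q.≈ Q.0#
    term c c∈N (yes c∈j) = Q.trans (Q.*-congʳ {evalAt (c ∷ entries j) (Φ τ)}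
      (⟦⟧-no (¬? (c ∈? entries j)) (λ c∉j → c∉j c∈j))) (Q.zeroˡ (evalAt (c ∷ entries j) (Φ τ)))
    term c c∈N (no c∉j)  = Q.trans (Q.*-congˡ {χ c (entries j)}
      (Φ-vanishes d (≡.subst (N <_) (ℕₚ.+-suc k d) N<k+1+d) τ (there N+1∈σ)
        (ℕₚ.⊔-lub (proj₂ y∈) σ≤1+N) (cons j c∈N c∉j))) (Q.zeroʳ (χ c (entries j)))

  private
    valid? : ∀ {k} (xs : Vec ℕ k) → Dec (Allᵛ.All (1 ≤_) xs × Unique xs)
    valid? xs = Allᵛ.all? (1 ℕₚ.≤?_) xs ×-dec allPairs? (λ x y → ¬? (x ℕₚ.≟ y)) xs

    Φ-vector-cases : ∀ {k} (xs : Vec ℕ k) → Dec (Allᵛ.All (1 ≤_) xs × Unique xs) → Ŵ.Combination k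
    Φ-vector-cases xs (yes (ls , ds)) = Φ (tuple xs ls ds)
    Φ-vector-cases xs (no _)          = []

  -- `Φ` extended by 0 to all vectors, as `extensions-sum` asks for a function of entries.
  Φ-vector : ∀ {k} → Vec ℕ k → Ŵ.Combination k
  Φ-vector xs = Φ-vector-cases xs (valid? xs)

  Φ-Φ-vector : ∀ {k} (σ : I k) → Ŵ._≋_ k (Φ σ) (Φ-vector (entries σ))
  Φ-Φ-vector {k} σ = by-cases (valid? (entries σ))
    where
    by-cases : ∀ d → Ŵ._≋_ k (Φ σ) (Φ-vector-cases (entries σ) d)
    by-cases (yes (ls , ds)) = Φ-entries {k} {σ} {tuple (entries σ) ls ds} ≡.refl
    by-cases (no ¬valid)     = contradiction (labels σ , distinct σ) ¬valid

  Φ-vector-vanishes : ∀ {k} (xs : Vec ℕ k) → suc N ∈ xs → max xs ≤ suc N →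
                      (j : Iᴺ k) → evalAt (entries j) (Φ-vector xs) Q.≈ Q.0#
  Φ-vector-vanishes {k} xs N+1∈xs xs≤1+N j = by-cases (valid? xs)
    where
    by-cases : ∀ d → evalAt (entries j) (Φ-vector-cases xs d) Q.≈ Q.0#
    -- The value d = N + 1 is large enough for every length k.
    by-cases (yes (ls , ds)) = Φ-vanishes (suc N) (ℕₚ.m≤n+m (suc N) k) (tuple xs ls ds) N+1∈xs
        xs≤1+N j
    by-cases (no _)          = Q.refl

  constantᶠ-0 : constantᶠ 0ℚ Q.≈ Q.0#
  constantᶠ-0 = embed-cong (constant-natural 0)

  -- The colour N + 1, which M can create but Mᴺ cannot, does not contribute.
  created-sum : ∀ {k} (σ : Iᴺ k) (j : Iᴺ (suc k)) →
    listSum (λ (y , t) → constantᶠ (A y (entries σ)) Q.* evalAt (entries j) (Φ t))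
            (extensions (suc (max (entries σ))) (λ 1≤y _ → 1≤y) (forget σ)) Q.≈
    listSum (λ (y , t) → constantᶠ (A y (entries σ)) Q.* evalAt (entries j) (Φ (forget t)))
        (colours σ)
  created-sum {k} σ j = begin
    listSum (λ (y , t) → constantᶠ (A y xs) Q.* evalAt js (Φ t)) above-σ
      ≈⟨ listSum-cong (λ (y , t) → Q.*-congˡ {constantᶠ (A y xs)} (evalAt-cong js (Φ-Φ-vector t)))
          above-σ ⟩
    listSum (λ (y , t) → H y (entries t)) above-σ
      ≈⟨ extensions-sum (suc (max xs)) (λ 1≤y _ → 1≤y) (forget σ) field⟨x⟩ H ⟩
    -- Index d belongs to the colour d + 1. The sum is lengthened to the colours up to N + 1, where
    -- A vanishes beyond 1 + max σ, and then the colour N + 1 is dropped.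
    sum {suc (max xs)} (λ d → term (toℕ d))
      ≈⟨ sum-extend {suc (max xs)} {suc N} term (s≤s σ≤N) (λ d 1+max≤d _ → beyond d 1+max≤d) ⟨
    sum {suc N} (λ d → term (toℕ d))
      ≈⟨ sum-extend {N} {suc N} term (ℕₚ.n≤1+n N) (λ d N≤d d<1+N →
          last d (ℕₚ.≤-antisym N≤d (ℕₚ.≤-pred d<1+N))) ⟩
    sum {N} (λ d → term (toℕ d))
      ≈⟨ extensions-sum N _,_ σ field⟨x⟩ H ⟨
    listSum (λ (y , t) → H y (entries t)) (colours σ)
      ≈⟨ listSum-cong (λ (y , t) → Q.*-congˡ {constantᶠ (A y xs)}
          (evalAt-cong js (Φ-Φ-vector (forget t)))) (colours σ) ⟨
    listSum (λ (y , t) → constantᶠ (A y xs) Q.* evalAt js (Φ (forget t))) (colours σ) ∎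
    where
    xs = entries σ
    js = entries j
    above-σ = extensions (suc (max xs)) (λ 1≤y _ → 1≤y) (forget σ)
    σ≤N : max xs ≤ N
    σ≤N = max≤N (labels σ)
    H : ℕ → Vec ℕ (suc k) → Fraction
    H y t = constantᶠ (A y xs) Q.* evalAt js (Φ-vector t)
    term : ℕ → Fraction
    term d = χ (suc d) xs Q.* H (suc d) (xs ∷ʳ suc d)
    vanish : ∀ d → H (suc d) (xs ∷ʳ suc d) Q.≈ Q.0# → term d Q.≈ Q.0#
    vanish d z = Q.trans (Q.*-congˡ {χ (suc d) xs} z) (Q.zeroʳ (χ (suc d) xs))
    beyond : ∀ d → suc (max xs) ≤ d → term d Q.≈ Q.0#
    beyond d max<d = vanish d (Q.trans (Q.*-congʳ {evalAt js (Φ-vector (xs ∷ʳ suc d))}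
        (Q.trans (Q.reflexive (≡.cong constantᶠ (A-zero (suc d) xs (s≤s max<d)))) constantᶠ-0))
      (Q.zeroˡ (evalAt js (Φ-vector (xs ∷ʳ suc d)))))
    last∈ : ∀ {k} (xs : Vec ℕ k) {y} → y ∈ xs ∷ʳ y
    last∈ []       = here ≡.refl
    last∈ (_ ∷ xs) = there (last∈ xs)
    last : ∀ d → N ≡ d → term d Q.≈ Q.0#
    last d ≡.refl = vanish N (Q.trans (Q.*-congˡ {constantᶠ (A (suc N) xs)}
      (Φ-vector-vanishes (xs ∷ʳ suc N) (last∈ xs) (max-∷ʳ xs (ℕₚ.m≤n⇒m≤1+n σ≤N) ℕₚ.≤-refl) j))
      (Q.zeroʳ (constantᶠ (A (suc N) xs))))

  -- The map Uᴺ and its intertwining relations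

  specialise-evalAt : ∀ {k} (σ i : Iᴺ k) →
    specialise (U-denominators (forget σ)) (max≤N (labels σ)) i Q.≈ evalAt (entries i)
        (Φ (forget σ))
  specialise-evalAt {k} σ i = by-cases (max (entries σ) ℕₚ.≤? suc N)
    where
    open Localised (U-denominators (forget σ))
    by-cases : ∀ d → specialise (U-denominators (forget σ)) (max≤N (labels σ)) i Q.≈
                     evalAt (entries i) (Φ-cases (forget σ) d)
    by-cases (yes p) = Q.sym (linear-fractions
      (λ m → ∏ (List.map (λ r → x (lookup (entries i) r) ^ suc (lookup m r)) (List.allFin k)))
      (λ m → monomial m (entries i)) (λ m → monomial-embed m (entries i))
      evaluate (factors≉0 p factors<n) _ numerator)
    by-cases (no ¬p) = contradiction (ℕₚ.m≤n⇒m≤1+n (max≤N (labels σ))) ¬p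

  Uᴺ-basis : ∀ {k} → Iᴺ k → W.Combination k
  Uᴺ-basis {k} σ =
    List.map (λ i → specialise (U-denominators (forget σ)) (max≤N (labels σ)) i , i) (enumerate k)

  Uᴺ-basis-at : ∀ {k} (σ j : Iᴺ k) → Uᴺ-basis σ at entries j Q.≈ evalAt (entries j) (Φ (forget σ))
  Uᴺ-basis-at {k} σ j = begin
    Uᴺ-basis σ at entries j
      ≡⟨ W.pairing-map k (λ t → δ (entries t) (entries j))
          (specialise (U-denominators (forget σ)) (max≤N (labels σ)))
           id (enumerate k) ⟩
    listSum (λ i → specialise (U-denominators (forget σ)) (max≤N (labels σ)) i Q.* δ (entries i)
        (entries j)) (enumerate k)
      ≈⟨ listSum-cong (λ i → Q.*-congʳ {δ (entries i) (entries j)} (specialise-evalAt σ i))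
          (enumerate k) ⟩
    listSum (λ i → evalAt (entries i) (Φ (forget σ)) Q.* δ (entries i) (entries j)) (enumerate k)
      ≡⟨ W.pairing-map k (λ t → δ (entries t) (entries j)) (λ i →
          evalAt (entries i) (Φ (forget σ))) id (enumerate k) ⟨
    List.map (λ i → evalAt (entries i) (Φ (forget σ)) , i) (enumerate k) at entries j
      ≈⟨ enumerate-at (λ is → evalAt is (Φ (forget σ))) j ⟩
    evalAt (entries j) (Φ (forget σ)) ∎

  U⟨N⟩ : ∀ k → W.Combination k → W.Combination k
  U⟨N⟩ = Uᴺ U U-denominators

  U⟨N⟩-at : ∀ {k} v (j : Iᴺ k) →
            U⟨N⟩ k v at entries j Q.≈ W.pairing k (λ σ → evalAt (entries j) (Φ (forget σ))) v
  U⟨N⟩-at {k} v j = Q.trans (at-linear Uᴺ-basis v (entries j))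
    (W.pairing-ext k (λ σ → Uᴺ-basis-at σ j) v)

  U⟨N⟩-homomorphism : ∀ k → IsModuleHomomorphism (Module.rawModule (Vᴺ k))
      (Module.rawModule (V̂ᴺ k)) (U⟨N⟩ k)
  U⟨N⟩-homomorphism k = W.linear-homomorphism k (W.freeModule k) {Uᴺ-basis}
    λ {σ} {τ} σ≡τ → ≋-at {k} {Uᴺ-basis σ} {Uᴺ-basis τ} λ j → Q.trans (Uᴺ-basis-at σ j)
      (Q.trans (evalAt-cong (entries j) (Φ-entries {k} {forget σ} {forget τ} σ≡τ))
          (Q.sym (Uᴺ-basis-at τ j)))

  private
    U⟨N⟩-M-at : ∀ k v (s : Iᴺ k) c → InRange c → c ∉ entries s →
      U⟨N⟩ (suc k) (Mᴺ k v) at (entries s ∷ʳ c) Q.≈ raise k (U⟨N⟩ k v) at (entries s ∷ʳ c)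
    U⟨N⟩-M-at k v s c c∈N c∉s = begin
      U⟨N⟩ (suc k) (Mᴺ k v) at js
        ≈⟨ U⟨N⟩-at (Mᴺ k v) j ⟩
      W.pairing (suc k) value (Mᴺ k v)
        ≈⟨ linear-∘ {field⟨x⟩} {tuples InRange (suc k)} TensorUnit.⟨module⟩ value created v ⟩
      W.pairing k (λ σ → W.pairing (suc k) value (created σ)) v
        ≈⟨ W.pairing-ext k step v ⟩
      W.pairing k (λ σ → X c Q.* evalAt (entries s) (Φ (forget σ))) v
        ≈⟨ W.pairing-* k (X c) (λ σ → evalAt (entries s) (Φ (forget σ))) v ⟩
      X c Q.* W.pairing k (λ σ → evalAt (entries s) (Φ (forget σ))) v
        ≈⟨ Q.*-cong {X c} {χ c (entries s) Q.* X c} {W.pairing k (λ σ →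
            evalAt (entries s) (Φ (forget σ))) v} {U⟨N⟩ k v at entries s}
             (Q.sym (Q.trans (Q.*-congʳ {X c} (⟦⟧-yes (¬? (c ∈? entries s)) c∉s))
                 (Q.*-identityˡ (X c))))
             (Q.sym (U⟨N⟩-at v s)) ⟩
      (χ c (entries s) Q.* X c) Q.* U⟨N⟩ k v at entries s
        ≈⟨ raise-at (U⟨N⟩ k v) (entries s) c ⟨
      raise k (U⟨N⟩ k v) at js ∎
      where
      j : Iᴺ (suc k)
      j = append s c∈N c∉s
      js = entries s ∷ʳ c
      value : Iᴺ (suc k) → Fraction
      value t = evalAt js (Φ (forget t))
      created : Iᴺ k → W.Combination (suc k)
      created σ = List.map (λ (y , σy) → constantᶠ (A y (entries σ)) , σy) (colours σ)
      step : ∀ σ → W.pairing (suc k) value (created σ) Q.≈ X c Q.* evalAt (entries s)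
          (Φ (forget σ))
      step σ = begin
        W.pairing (suc k) value (created σ)
          ≡⟨ W.pairing-map (suc k) value (λ (y , _) → constantᶠ (A y (entries σ))) proj₂
              (colours σ) ⟩
        listSum (λ (y , t) → constantᶠ (A y (entries σ)) Q.* value t) (colours σ)
          ≈⟨ created-sum σ j ⟨
        listSum (λ (y , t) → constantᶠ (A y (entries σ)) Q.* evalAt js (Φ t)) above-σ
          ≡⟨ FreeProperties.pairing-map field⟨x⟩ (tuples (1 ≤_) (suc k)) (λ t → evalAt js (Φ t))
               (λ (y , _) → constantᶠ (A y (entries σ))) proj₂ above-σ ⟨
        linear {field⟨x⟩} TensorUnit.⟨module⟩ (λ t → evalAt js (Φ t)) infinite
          ≈⟨ linear-∘ {field⟨x⟩} {exponentVectors (suc k)} TensorUnit.⟨module⟩ (λ m →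
              monomial m js) Φ infinite ⟨
        evalAt js (linear (Ŵ.freeModule (suc k)) Φ infinite)
          ≈⟨ evalAt-cong js (Φ-M (forget σ) (max≤N (labels σ))) ⟩
        evalAt js (multiply k (Φ (forget σ)))
          ≈⟨ evalAt-multiply (entries s) c (Φ (forget σ)) ⟩
        X c Q.* evalAt (entries s) (Φ (forget σ)) ∎
        where
        above-σ = extensions (suc (max (entries σ))) (λ 1≤y _ → 1≤y) (forget σ)
        infinite = List.map (λ (y , t) → constantᶠ (A y (entries σ)) , t) above-σ

  U⟨N⟩-M : ∀ k v → Module._≈ᴹ_ (V̂ᴺ (suc k)) (U⟨N⟩ (suc k) (Mᴺ k v)) (M̂ᴺ k (U⟨N⟩ k v))
  U⟨N⟩-M k v = ≋-at-∷ʳ {k} {U⟨N⟩ (suc k) (Mᴺ k v)} {raise k (U⟨N⟩ k v)} (U⟨N⟩-M-at k v)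

  private
    -- The expression on the right is the common value of both sides of the relation for D̂;
    -- `U⟨N⟩-D-at` reaches it from the other side.
    lower-U⟨N⟩-at : ∀ k v (j : Iᴺ k) → lower k (U⟨N⟩ (suc k) v) at entries j Q.≈
                    W.pairing (suc k) (λ σ → evalAt (entries j) (contract k (Φ (forget σ)))) v
    lower-U⟨N⟩-at k v j = begin
      lower k (U⟨N⟩ (suc k) v) at js
        ≈⟨ lower-at (U⟨N⟩ (suc k) v) js ⟩
      colourSum (λ c → U⟨N⟩ (suc k) v at (c ∷ js))
        ≈⟨ colourSum-cong-InRange (λ c c∈N → term c c∈N (c ∈? js)) ⟩
      colourSum (λ c → W.pairing (suc k) (λ σ → χ c js Q.* evalAt (c ∷ js) (Φ (forget σ))) v)
        ≈⟨ pairing-colourSum {tuples InRange (suc k)} (λ c σ →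
            χ c js Q.* evalAt (c ∷ js) (Φ (forget σ))) v ⟨
      W.pairing (suc k) (λ σ → colourSum (λ c → χ c js Q.* evalAt (c ∷ js) (Φ (forget σ)))) v
        ≈⟨ W.pairing-ext (suc k) (λ σ → evalAt-contract (labels j) (distinct j) (Φ (forget σ))) v
            ⟨
      W.pairing (suc k) (λ σ → evalAt js (contract k (Φ (forget σ)))) v ∎
      where
      js = entries j
      value : ℕ → Iᴺ (suc k) → Fraction
      value c σ = evalAt (c ∷ js) (Φ (forget σ))
      term : ∀ c → InRange c → Dec (c ∈ js) →
             U⟨N⟩ (suc k) v at (c ∷ js) Q.≈ W.pairing (suc k) (λ σ → χ c js Q.* value c σ) v
      term c c∈N (no c∉j)  = Q.trans (U⟨N⟩-at v (cons j c∈N c∉j)) (W.pairing-ext (suc k)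
        (λ σ → Q.sym (Q.trans (Q.*-congʳ {value c σ} (⟦⟧-yes (¬? (c ∈? js)) c∉j))
            (Q.*-identityˡ (value c σ)))) v)
      -- For c ∈ js the vector (c , js) is not a tuple, so the coefficient on the left is 0; on the
      -- right the bracket vanishes.
      term c c∈N (yes c∈j) = Q.trans (at-invalid (U⟨N⟩ (suc k) v) (c ∷ js) repeated)
        (Q.sym (Q.trans (W.pairing-ext (suc k) (λ σ → Q.trans
            (Q.*-congʳ {value c σ} (⟦⟧-no (¬? (c ∈? js)) (λ c∉j → c∉j c∈j)))
                (Q.zeroˡ (value c σ))) v)
          (W.pairing-0 (suc k) v)))
        where
        repeated : ∀ (t : Iᴺ (suc k)) → entries t ≢ c ∷ js
        repeated (tuple (c ∷ js) _ (d ∷ _)) ≡.refl = ∉-∷⁻ d c∈j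

    U⟨N⟩-D-at : ∀ k v (j : Iᴺ k) → U⟨N⟩ k (Dᴺ k v) at entries j Q.≈
                W.pairing (suc k) (λ σ → evalAt (entries j) (contract k (Φ (forget σ)))) v
    U⟨N⟩-D-at k v j = Q.trans (U⟨N⟩-at (Dᴺ k v) j) (Q.trans
      (linear-∘ {field⟨x⟩} {tuples InRange k} TensorUnit.⟨module⟩ value _ v)
      (W.pairing-ext (suc k) step v))
      where
      value : Iᴺ k → Fraction
      value σ = evalAt (entries j) (Φ (forget σ))
      step : ∀ σ → _ Q.≈ evalAt (entries j) (contract k (Φ (forget σ)))
      step σ@(tuple (s ∷ ss) ((1≤s , s≤N) ∷ ls) (d ∷ ds)) = Q.trans
        (Q.+-identityʳ (ratio s ē≉ Q.* value (rest σ)))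
        (Q.sym (Q.trans
          (evalAt-cong (entries j) (Φ-D (forget σ) (ℕₚ.m≤n⇒m≤1+n (max≤N (labels σ))) ē≉))
          (Ŵ.pairing-scale k (λ m → monomial m (entries j)) (ratio s ē≉) (Φ (forget (rest σ))))))
        where
        ē≉ = ē≉0 (ℕₚ.≤-trans ℕₚ.pred[n]≤n s≤N)

  D̂-U⟨N⟩ : ∀ k v → Module._≈ᴹ_ (V̂ᴺ k) (D̂ᴺ k (U⟨N⟩ (suc k) v)) (U⟨N⟩ k (Dᴺ k v))
  D̂-U⟨N⟩ k v = ≋-at {k} {lower k (U⟨N⟩ (suc k) v)} {U⟨N⟩ k (Dᴺ k v)}
    λ j → Q.trans (lower-U⟨N⟩-at k v j) (Q.sym (U⟨N⟩-D-at k v j))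

  -- Surjectivity and invertibility of Uᴺ

  open ColourInversion field⟨x⟩ fieldIsDiscrete N X X-out X≉0 X-injective
    using (everything∈; surjective⇒injective)

  imageModule : ∀ k → Submodule (W.freeModule k)
  imageModule k = record
    { _∈     = λ w → ∃ λ v → W._≋_ k (U⟨N⟩ k v) w
    ; ∈-resp = λ w≋w′ (v , e) → v , ≈ᴹ-trans e w≋w′
    ; ∈-+    = λ {w} {w′} (v , e) (v′ , e′) → v ++ v′ ,
        ≈ᴹ-trans (+ᴹ-homo v v′) (+ᴹ-cong {U⟨N⟩ k v} {w} {U⟨N⟩ k v′} {w′} e e′)
    ; ∈-*    = λ a {w} (v , e) → W.scale k a v , ≈ᴹ-trans (*ₗ-homo a v)
        (*ₗ-congˡ {a} {U⟨N⟩ k v} {w} e)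
    ; ∈-0    = [] , 0ᴹ-homo
    }
    where
    open Module (W.freeModule k)
    open IsModuleHomomorphism (U⟨N⟩-homomorphism k)

  raise-cong : ∀ k {v w} → W._≋_ k v w → W._≋_ (suc k) (raise k v) (raise k w)
  raise-cong k {v} {w} v≋w = ≋-at-∷ʳ {k} {raise k v} {raise k w} λ s c _ _ →
      Q.trans (raise-at v (entries s) c)
    (Q.trans (Q.*-congˡ {χ c (entries s) Q.* X c} (at-cong v≋w (entries s)))
        (Q.sym (raise-at w (entries s) c)))

  lower-cong : ∀ k {v w} → W._≋_ (suc k) v w → W._≋_ k (lower k v) (lower k w)
  lower-cong k {v} {w} v≋w = ≋-at {k} {lower k v} {lower k w} λ j →
      Q.trans (lower-at v (entries j))
    (Q.trans (colourSum-cong (λ c → at-cong v≋w (c ∷ entries j)))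
        (Q.sym (lower-at w (entries j))))

  U⟨N⟩-∅ : W._≋_ 0 (U⟨N⟩ 0 (W.basis 0 ∅)) (W.basis 0 ∅)
  U⟨N⟩-∅ = ≋-at {0} {U⟨N⟩ 0 (W.basis 0 ∅)} {W.basis 0 ∅} λ { j@(tuple [] [] []) → begin
    U⟨N⟩ 0 (W.basis 0 ∅) at []
      ≈⟨ U⟨N⟩-at (W.basis 0 ∅) j ⟩
    W.pairing 0 (λ σ → evalAt [] (Φ (forget σ))) (W.basis 0 ∅)
      ≈⟨ W.pairing-basis 0 (λ σ → evalAt [] (Φ (forget σ))) ∅ ⟩
    evalAt [] (Φ ∅)
      ≈⟨ evalAt-cong [] (C.⇝-functional 0 U-∅ (Φ-⇝ ∅ z≤n) (C.⇝-basis 0 [])) ⟩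
    evalAt [] (Ŵ.basis 0 [])
      ≈⟨ Ŵ.pairing-basis 0 (λ m → monomial m []) [] ⟩
    Q.1#
      ≈⟨ ⟦⟧-yes (Vecₚ.≡-dec ℕₚ._≟_ [] []) ≡.refl ⟨
    δ [] []
      ≈⟨ at-basis ∅ [] ⟨
    W.basis 0 ∅ at [] ∎ }

  -- The intertwining relations supply the preimages: if v maps to w, then `Mᴺ k v` maps to the
  -- raised w and `Dᴺ k v` to the lowered w.
  U⟨N⟩-surjective : ∀ k w → ∃ λ v → W._≋_ k (U⟨N⟩ k v) w
  U⟨N⟩-surjective = everything∈ imageModule (W.basis 0 ∅ , U⟨N⟩-∅)
    (λ k w (v , e) → Mᴺ k v , Module.≈ᴹ-trans (W.freeModule (suc k)) (U⟨N⟩-M k v)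
        (raise-cong k e))
    (λ k w (v , e) → Dᴺ k v , Module.≈ᴹ-trans (W.freeModule k)
      (Module.≈ᴹ-sym (W.freeModule k) (D̂-U⟨N⟩ k v)) (lower-cong k e))

  U⟨N⟩-invertible : ∀ k → Invertible (Vᴺ k) (V̂ᴺ k) (U⟨N⟩ k)
  U⟨N⟩-invertible k = bijective⇒invertible (Vᴺ k) (V̂ᴺ k) (U⟨N⟩-homomorphism k)
    (surjective⇒injective {k} (U⟨N⟩-homomorphism k) (U⟨N⟩-surjective k)) (U⟨N⟩-surjective k)

proposition20 :
  (U : Family) (isIntertwiner : IsIntertwiner U) (hasDenominators : HasDenominators U) (N : ℕ) →
  let open FiniteColours N
      U⟨N⟩ = Uᴺ U hasDenominators
      _≈_ = λ {k : ℕ} → Module._≈ᴹ_ (V̂ᴺ k)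
  in
  (∀ k → k ≤ N → Invertible (Vᴺ k) (V̂ᴺ k) (U⟨N⟩ k)) ×
  (∀ k → suc k ≤ N →
    (∀ v → U⟨N⟩ (suc k) (Mᴺ k v) ≈ M̂ᴺ k (U⟨N⟩ k v)) ×
    (∀ v → D̂ᴺ k (U⟨N⟩ (suc k) v) ≈ U⟨N⟩ k (Dᴺ k v)))
proposition20 U isIntertwiner hasDenominators N =
  (λ k _ → U⟨N⟩-invertible k) , λ k _ → U⟨N⟩-M k , D̂-U⟨N⟩ k
  where open FiniteIntertwiner U isIntertwiner hasDenominators N
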